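{- Let $k,\ell\ge 1$, $\lambda\in\mathrm{P}^k_\ell$, and let $z\in[0,b_\lambda]$ be such that $\lambda_1>\lambda_2>\cdots>\lambda_z$, and suppose further that $\lambda_z>\lambda_{z+1}$ when $z\neq b_\lambda$ (with the convention $\lambda_0=\infty$). Then there are integers $b_{\lambda\mu}$, indexed by $k$-bounded partitions $\mu$ and only finitely many nonzero, such that $$\mathfrak g^{(k)}_{\lambda,z+1}=\sum_{\mu} b_{\lambda\mu}\, g^{(k)}_\mu,\qquad\text{where } (-1)^{|\lambda|-|\mu|}b_{\lambda\mu}\in\mathbb Z_{\ge 0}\text{ for all }\mu .$$
   Context: Notation: $[a,b]=\{a,a+1,\dots,b\}$ (empty if $a>b$), $[b]=[1,b]$; $\epsilon_i\in\mathbb Z^\ell$ is the $i$-th unit vector; $|\gamma|=\sum_i\gamma_i$. $h_m$ is the complete homogeneous symmetric function ($h_0=1$, $h_m=0$ for $m<0$). For $m\in\mathbb Z$, $r\in\mathbb Z_{\ge0}$ put $k^{(r)}_m=\sum_{i=0}^{m}\binom{r+i-1}{i}h_{m-i}$, with $k^{(r)}_m=0$ for $m<0$ and $k^{(0)}_m=h_m$. For $\gamma\in\mathbb Z^\ell$ let $g_\gamma=\det\big(k^{(i-1)}_{\gamma_i+j-i}\big)_{1\le i,j\le\ell}$. Let $\Delta^+_\ell=\{(i,j):1\le i<j\le\ell\}$ with partial order $(a,b)\le(c,d)$ iff $a\ge c$ and $b\le d$; a root ideal is an upper order ideal $\Psi\subseteq\Delta^+_\ell$. For a root ideal $\Psi$,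 a multiset $M$ with support in $[\ell]$ and $\gamma\in\mathbb Z^\ell$, the Katalan function (Blasiak–Morse–Seelinger) is $K(\Psi;M;\gamma)=\prod_{z\in M}(1-L_z)\prod_{(i,j)\in\Psi}(1-R_{ij})^{ -1}g_\gamma$, where the lowering and raising operators act on the index, $L_zg_\gamma=g_{\gamma-\epsilon_z}$, $R_{ij}g_\gamma=g_{\gamma+\epsilon_i-\epsilon_j}$, and $(1-R_{ij})^{ -1}=\sum_{n\ge0}R_{ij}^n$. $\mathrm P^k_\ell$ denotes the set of $k$-bounded partitions with at most $\ell$ parts, written as $\ell$-tuples $\lambda=(\lambda_1\ge\cdots\ge\lambda_\ell\ge0)$ with $\lambda_1\le k$. For $\lambda\in\mathrm P^k_\ell$ let $\Delta^k(\lambda)=\{(i,j)\in\Delta^+_\ell: k-\lambda_i+i<j\}$ (a root ideal), and let $L(\Delta^k(\lambda))$ be the multiset of second coordinates $j$ of its elements $(i,j)$. Let $b_\lambda$ be the bottom of $\Delta^k(\lambda)$: the largest row index $x$ such that $\Delta^k(\lambda)$ contains some root $(x,p)$ ($b_\lambda=0$ if $\Delta^k(\lambda)=\emptyset$). For $x\in[b_\lambda]$ let $\mathrm{down}_\lambda(x)$ be the unique $j$ such that $(x,j)$ is a removable root of $\Delta^k(\lambda)$ (i.e. $\Delta^k(\lambda)\setminus\{(x,j)\}$ is still a root ideal); explicitly $\mathrm{down}_\lambda(x)=k-\lambda_x+x+1$. Weighted $K$-$k$-Schur function: for $z\in[b_\lambda+1]$, $\mathfrak g^{(k)}_{\lambda,z}:=K\big(\Delta^k(\lambda);\,L(\Delta^k(\lambda))\setminus\{\mathrm{down}_\lambda(x):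 x\in[z,b_\lambda]\};\,\lambda\big)$, where one copy of each listed value is removed from the multiset. $g^{(k)}_\mu$ is the $K$-$k$-Schur function (Lam–Schilling–Shimozono) of a $k$-bounded partition $\mu$; by a theorem of Blasiak–Morse–Seelinger, for $\mu\in\mathrm P^k_\ell$ it equals $K(\Delta^k(\mu);L(\Delta^{k+1}(\mu));\mu)$. -}

module Defs where

open import Data.Bool using (Bool; true; false; _∧_; if_then_else_)
open import Data.Nat as ℕ using (ℕ; zero; suc; _∸_; _⊔_; _≤_; _<_)
open import Data.Nat.Combinatorics using (_C_)
open import Data.Integer as ℤ using (ℤ; +_; -[1+_]; 0ℤ; 1ℤ; -1ℤ)
open import Data.Fin as Fin using (Fin; toℕ; punchIn)
open import Data.Vec as Vec using (Vec; lookup; toList; fromList)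
open import Data.List as List using (List; []; _∷_; _++_; map; concatMap; foldr; upTo; allFin; filterᵇ; length)
open import Data.Nat.ListAction using (sum)
open import Data.List.Properties using (≡-dec)
open import Data.List.Relation.Unary.All using (All)
open import Data.List.Relation.Unary.Linked using (Linked)
open import Data.Product using (_×_; _,_; proj₁; proj₂; ∃-syntax)
open import Relation.Nullary.Decidable using (⌊_⌋)
open import Relation.Binary.PropositionalEquality using (_≡_)

-- The ring of symmetric functions Λ = ℤ[h₁,h₂,…] (the h's are
-- algebraically independent).  An element is a finite formal ℤ-linear
-- combination of h-monomials h_{m₁}⋯h_{m_r}; a monomial is stored as the
-- weakly decreasing list (m₁ ≥ … ≥ m_r), all mᵢ ≥ 1.  Equality of
-- symmetric functions = equality of all coefficients ('coeff').

Mono : Set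
Mono = List ℕ

Sym : Set
Sym = List (Mono × ℤ)

insertM : ℕ → Mono → Mono
insertM a [] = a ∷ []
insertM a (b ∷ bs) = if ⌊ b ℕ.≤? a ⌋ then a ∷ b ∷ bs else b ∷ insertM a bs

mulMono : Mono → Mono → Mono
mulMono p q = foldr insertM q p

0S : Sym
0S = []

1S : Sym
1S = ([] , 1ℤ) ∷ []

_+S_ : Sym → Sym → Sym
_+S_ = _++_

scaleS : ℤ → Sym → Sym
scaleS c = map (λ t → proj₁ t , c ℤ.* proj₂ t)

negS : Sym → Sym
negS = scaleS -1ℤ

_*S_ : Sym → Sym → Sym
p *S q = concatMap (λ t → map (λ u → mulMono (proj₁ t) (proj₁ u) , proj₂ t ℤ.* proj₂ u) q) p

sumS : List Sym → Sym
sumS = foldr _+S_ 0S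

coeff : Sym → Mono → ℤ
coeff [] m = 0ℤ
coeff ((m' , c) ∷ f) m = (if ⌊ ≡-dec ℕ._≟_ m' m ⌋ then c else 0ℤ) ℤ.+ coeff f m

_≈S_ : Sym → Sym → Set
f ≈S g = ∀ m → coeff f m ≡ coeff g m

-- A sequence of symmetric functions converges (coefficientwise,
-- i.e. each coefficient is eventually constant) to F.  Used to give
-- meaning to the infinite series (1 - R_ij)^{-1} = Σ_n R_ij^n.
Converges : (ℕ → Sym) → Sym → Set
Converges f F = ∀ m → ∃[ N₀ ] (∀ N → N₀ ≤ N → coeff (f N) m ≡ coeff F m)

hS : ℤ → Sym
hS (+ zero) = 1S
hS (+ suc n) = ((suc n ∷ []) , 1ℤ) ∷ []
hS -[1+ n ] = 0S

-- k^{(r)}_m = Σ_{i=0}^m binom(r+i-1, i) h_{m-i}   (binom(-1,0)=1 via ∸)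
kS : ℕ → ℤ → Sym
kS r (+ m) = sumS (map (λ i → scaleS (+ ((r ℕ.+ i ∸ 1) C i)) (hS (+ (m ∸ i)))) (upTo (suc m)))
kS r -[1+ m ] = 0S

signZ : ℕ → ℤ
signZ zero = 1ℤ
signZ (suc n) = ℤ.- signZ n

det : (n : ℕ) → (Fin n → Fin n → Sym) → Sym
det zero M = 1S
det (suc n) M =
  sumS (map (λ j → scaleS (signZ (toℕ j)) (M Fin.zero j *S det n (λ a b → M (Fin.suc a) (punchIn j b))))
            (allFin (suc n)))

pos : {ℓ : ℕ} → Fin ℓ → ℕ
pos i = suc (toℕ i)

gS : (ℓ : ℕ) → (Fin ℓ → ℤ) → Sym
gS ℓ γ = det ℓ (λ i j → kS (toℕ i) (γ i ℤ.+ + pos j ℤ.- + pos i))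

Idx : ℕ → Set
Idx ℓ = Fin ℓ → ℤ

shift : {ℓ : ℕ} → Idx ℓ → Fin ℓ → ℤ → Idx ℓ
shift γ i d a = if ⌊ a Fin.≟ i ⌋ then γ a ℤ.+ d else γ a

-- (1 - L_z) acting on index-functions
lowerOp : {ℓ : ℕ} → Fin ℓ → (Idx ℓ → Sym) → (Idx ℓ → Sym)
lowerOp z F γ = F γ +S negS (F (shift γ z -1ℤ))

-- Σ_{n=0}^{N} R_ij^n acting on index-functions
raiseOp : {ℓ : ℕ} → ℕ → Fin ℓ × Fin ℓ → (Idx ℓ → Sym) → (Idx ℓ → Sym)
raiseOp N (i , j) F γ = sumS (map (λ n → F (shift (shift γ i (+ n)) j (ℤ.- (+ n)))) (upTo (suc N)))

-- truncation at N of K(Ψ; M; γ) = Π_{z∈M}(1-L_z) Π_{(i,j)∈Ψ}(1-R_ij)^{-1} g_γ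
katTrunc : {ℓ : ℕ} → List (Fin ℓ × Fin ℓ) → List (Fin ℓ) → Idx ℓ → ℕ → Sym
katTrunc {ℓ} Ψ M γ N = foldr lowerOp (foldr (raiseOp N) (gS ℓ) Ψ) M γ

InP : (k ℓ : ℕ) → Vec ℕ ℓ → Set
InP k ℓ lam = (∀ i → lookup lam i ≤ k) × (∀ i j → toℕ i ≤ toℕ j → lookup lam j ≤ lookup lam i)

KBddPartition : ℕ → List ℕ → Set
KBddPartition k μ = All (λ p → 1 ≤ p × p ≤ k) μ × Linked ℕ._≥_ μ

allPairs : (ℓ : ℕ) → List (Fin ℓ × Fin ℓ)
allPairs ℓ = concatMap (λ i → map (λ j → i , j) (allFin ℓ)) (allFin ℓ)

Δk : (k : ℕ) {ℓ : ℕ} → Vec ℕ ℓ → List (Fin ℓ × Fin ℓ)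
Δk k {ℓ} lam = filterᵇ (λ p → ⌊ pos (proj₁ p) ℕ.<? pos (proj₂ p) ⌋
                         ∧ ⌊ (+ k ℤ.- + lookup lam (proj₁ p) ℤ.+ + pos (proj₁ p)) ℤ.<? + pos (proj₂ p) ⌋)
                     (allPairs ℓ)

Lmult : {ℓ : ℕ} → List (Fin ℓ × Fin ℓ) → List (Fin ℓ)
Lmult = map proj₂

-- bottom b_λ of Δ^k(λ) (1-based, 0 if empty)
bottom : (k : ℕ) {ℓ : ℕ} → Vec ℕ ℓ → ℕ
bottom k lam = foldr (λ p acc → pos (proj₁ p) ⊔ acc) 0 (Δk k lam)

down : (k : ℕ) {ℓ : ℕ} → Vec ℕ ℓ → Fin ℓ → ℤ
down k lam x = + k ℤ.- + lookup lam x ℤ.+ + pos x ℤ.+ 1ℤ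

removeOne : {ℓ : ℕ} → ℤ → List (Fin ℓ) → List (Fin ℓ)
removeOne v [] = []
removeOne v (j ∷ js) = if ⌊ + pos j ℤ.≟ v ⌋ then js else j ∷ removeOne v js

weightMult : (k : ℕ) {ℓ : ℕ} → Vec ℕ ℓ → ℕ → List (Fin ℓ)
weightMult k {ℓ} lam z =
  foldr (λ x acc → removeOne (down k lam x) acc) (Lmult (Δk k lam))
        (filterᵇ (λ x → ⌊ z ℕ.≤? pos x ⌋ ∧ ⌊ pos x ℕ.≤? bottom k lam ⌋) (allFin ℓ))

vecZ : {ℓ : ℕ} → Vec ℕ ℓ → Idx ℓ
vecZ lam i = + lookup lam i

weightedKkSchurTrunc : (k : ℕ) {ℓ : ℕ} → Vec ℕ ℓ → ℕ → ℕ → Sym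
weightedKkSchurTrunc k lam z = katTrunc (Δk k lam) (weightMult k lam z) (vecZ lam)

-- truncations of the K-k-Schur function g^{(k)}_μ, via the
-- Blasiak–Morse–Seelinger formula K(Δ^k(μ); L(Δ^{k+1}(μ)); μ), ℓ = length μ
KkSchurTrunc : ℕ → List ℕ → ℕ → Sym
KkSchurTrunc k μ = katTrunc (Δk k v) (Lmult (Δk (suc k) v)) (vecZ v)
  where v = fromList μ

ent : {ℓ : ℕ} → Vec ℕ ℓ → ℕ → ℕ
ent lam x = go (toList lam) (x ∸ 1)
  where go : List ℕ → ℕ → ℕ
        go [] _ = 0
        go (a ∷ as) zero = a
        go (a ∷ as) (suc n) = go as n

size : {ℓ : ℕ} → Vec ℕ ℓ → ℕ
size lam = sum (toList lam)

linComb : (List ℕ → Sym) → List (List ℕ × ℤ) → Sym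
linComb G bs = foldr (λ t acc → scaleS (proj₂ t) (G (proj₁ t)) +S acc) 0S bs

{-# OPTIONS --safe #-}
-- Every linear functional on symmetric functions turns g into an integer valued function of the weight γ,
-- on which K(Ψ; M; –) acts by commuting shift operators.  Write F(c) = K(Δ^k(λ); M_z; λ − ε_c), where M_z is the
-- multiset of 𝔤_{λ,z}, so that 𝔤_{λ,z+1} = 𝔤_{λ,z} − F(down(z)).  Removing the root (c , down(c)) gives
-- F(c) = T + F(down(c)).  If λ_c > λ_{c+1}, then μ = λ − ε_c is a partition and T = 𝔤_{μ,z} − F_μ(down_μ(c)), so
-- induction on |λ| applies, each subtraction matching a drop of the degree by one.  If λ_c = λ_{c+1}, then T = 0:
-- the columns c, c + 1 are alike, or become alike after pushing the defect up the down-orbit to a row where λ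
-- is strictly decreasing (such a row exists by the hypothesis on z), and then T is fixed and negated by the
-- reflection exchanging c and c + 1, because (1 − L_{c+1}) g is antisymmetric.
module Submission where

open import Defs
open import Data.Nat using (ℕ; suc; _≤_; _<_)
open import Data.Integer using (ℤ; +_; _*_) renaming (_≤_ to _≤ℤ_)
open import Data.Vec using (Vec)
open import Data.List using (List; map)
open import Data.Nat.ListAction using (sum)
open import Data.List.Relation.Unary.All using (All)
open import Data.List.Relation.Unary.Unique.Propositional using (Unique)
open import Data.Product using (Σ; _×_; proj₁; proj₂; ∃-syntax)
open import Relation.Binary.PropositionalEquality using (_≢_)

open import Data.Bool using (Bool; true; false; T; T?; _∧_; if_then_else_)
open import Data.Bool.Properties using (T-∧)
open import Data.Empty using (⊥)
open import Data.Fin as Fin using (Fin; toℕ; punchIn)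
import Data.Fin.Properties as Finₚ
open import Data.Integer as ℤ using (-[1+_]; 0ℤ; 1ℤ; -1ℤ)
import Data.Integer.Properties as ℤₚ
open import Data.Integer.Tactic.RingSolver using (solve-∀)
open import Data.List as List using ([]; _∷_; _++_; _∷ʳ_; foldr; filter; filterᵇ; allFin; cartesianProduct; upTo; applyUpTo; tabulate; length; concatMap)
import Data.List.Properties as Listₚ
open import Data.List.Membership.Propositional using (_∈_; _∉_)
open import Data.List.Membership.Propositional.Properties using (∈-filter⁺; ∈-filter⁻; ∈-cartesianProduct⁺; ∈-cartesianProduct⁻; ∈-upTo⁺; ∈-upTo⁻; ∈-map⁺; ∈-map⁻; ∈-allFin)
open import Data.List.Membership.Propositional.Properties.WithK using (unique∧set⇒bag)
open import Data.List.Relation.Binary.BagAndSetEquality using (∼bag⇒↭)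
open import Data.List.Relation.Binary.Permutation.Propositional as Perm using (_↭_; ↭-sym; ↭-trans)
import Data.List.Relation.Binary.Permutation.Propositional.Properties as Permₚ
open import Data.List.Relation.Binary.Pointwise using (Pointwise; []; _∷_)
open import Data.List.Relation.Unary.All as All using ([]; _∷_)
import Data.List.Relation.Unary.All.Properties as Allₚ
open import Data.List.Relation.Unary.Any using (here; there)
import Data.List.Relation.Unary.Linked.Properties as Linkedₚ
open import Data.List.Relation.Unary.Unique.Propositional using ([]; _∷_)
import Data.List.Relation.Unary.Unique.Propositional.Properties as Uniqueₚ
open import Data.Nat as ℕ using (zero; z≤n; s≤s)
open import Data.Nat.Combinatorics using (_C_; nCk+nC[k+1]≡[n+1]C[k+1])
import Data.Nat.Properties as ℕₚ
open import Data.Product using (_,_)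
open import Data.Sum using (_⊎_; inj₁; inj₂)
open import Data.Unit using (⊤; tt)
open import Data.Vec as Vec using (lookup; toList; fromList)
open import Function using (_∘_)
open import Function.Bundles using (mk⇔; Equivalence)
open import Relation.Binary.Definitions using (tri<; tri≈; tri>)
open import Relation.Binary.PropositionalEquality using (_≡_; refl; sym; trans; cong; cong₂; subst; subst₂; _≗_; module ≡-Reasoning)
open import Relation.Nullary using (Dec; yes; no; ¬_; contradiction)
open import Relation.Nullary.Decidable using (⌊_⌋; toWitness; fromWitness)

-- Shift operators on functions of a weight

-- The series (1 - R_ij)⁻¹ are available only as truncations at `N`, so each relation between
-- Katalan functions must become an exact identity of truncations. The height Σ i γ_i achieves this:
-- no L_z or R_ij raises it, R_ij lowers it strictly, and g vanishes below a fixed height, so for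
-- `N` beyond a bound depending on the weight the neglected terms are zero. Every weight met in the
-- induction comes from λ by adding vectors -ε_c and positive roots, so the bound `B` found for λ
-- serves throughout. Another obstacle is uniformity: one list of partitions must serve all
-- coefficients and all large `N`. It is therefore produced before the linear functional and `N` are
-- known; these enter only through an `Environment`. Rows and columns are numbered from 0, and both
-- root sets and multisets of lowering factors are described by the first column of each row. The
-- partitions found are padded with zeros to the length of λ, whereas a K-k-Schur function is formed
-- with exactly the positive parts, so trailing zeros are stripped at the end.

Weight : Set
Weight = ℕ → ℤ

infixl 6 _∔_

_∔_ : Weight → Weight → Weight
(γ ∔ δ) a = γ a ℤ.+ δ a

_·_ : ℤ → Weight → Weight
(n · δ) a = n ℤ.* δ a

unit : ℕ → Weight
unit zero    zero    = 1ℤ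
unit zero    (suc a) = 0ℤ
unit (suc i) zero    = 0ℤ
unit (suc i) (suc a) = unit i a

unit-same : ∀ i → unit i i ≡ 1ℤ
unit-same zero    = refl
unit-same (suc i) = unit-same i

unit-diff : ∀ {i a} → i ≢ a → unit i a ≡ 0ℤ
unit-diff {zero}  {zero}  i≢a = contradiction refl i≢a
unit-diff {zero}  {suc a} i≢a = refl
unit-diff {suc i} {zero}  i≢a = refl
unit-diff {suc i} {suc a} i≢a = unit-diff (λ i≡a → i≢a (cong suc i≡a))

-ε : ℕ → Weight
-ε z = -1ℤ · unit z

root : ℕ × ℕ → Weight
root (i , j) a = unit i a ℤ.- unit j a

-- Weights are compared only pointwise, so invariance under pointwise equality travels with the
-- function.
record Fn : Set where
  field
    ap  : Weight → ℤ
    ext : ∀ {γ δ} → γ ≗ δ → ap γ ≡ ap δ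
open Fn public

-- A Laurent polynomial in the commuting translations of the weight; a term `(c , δ)` contributes c
-- F(γ + δ).
Op : Set
Op = List (ℤ × Weight)

opValue : Op → Fn → Weight → ℤ
opValue []            F γ = 0ℤ
opValue ((c , δ) ∷ P) F γ = c ℤ.* ap F (γ ∔ δ) ℤ.+ opValue P F γ

opValue-ext : ∀ P F {γ δ} → γ ≗ δ → opValue P F γ ≡ opValue P F δ
opValue-ext []            F γ≗δ = refl
opValue-ext ((c , d) ∷ P) F γ≗δ =
  cong₂ (λ x y → c ℤ.* x ℤ.+ y) (ext F (λ a → cong (ℤ._+ d a) (γ≗δ a))) (opValue-ext P F γ≗δ)

op : Op → Fn → Fn
op P F = record { ap = opValue P F ; ext = opValue-ext P F }

op-cong : ∀ P {F G} → (∀ γ → ap F γ ≡ ap G γ) → ∀ γ → opValue P F γ ≡ opValue P G γ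
op-cong []            eq γ = refl
op-cong ((c , d) ∷ P) eq γ = cong₂ (λ x y → c ℤ.* x ℤ.+ y) (eq (γ ∔ d)) (op-cong P eq γ)

op-zeroʳ : ∀ Q F γ → opValue Q (op [] F) γ ≡ 0ℤ
op-zeroʳ []            F γ = refl
op-zeroʳ ((c , d) ∷ Q) F γ rewrite op-zeroʳ Q F γ = trans (ℤₚ.+-identityʳ _) (ℤₚ.*-zeroʳ c)

∔-swap : ∀ γ δ η → (γ ∔ δ) ∔ η ≗ (γ ∔ η) ∔ δ
∔-swap γ δ η a = lemma (γ a) (δ a) (η a)
  where
  lemma : ∀ x y z → (x ℤ.+ y) ℤ.+ z ≡ (x ℤ.+ z) ℤ.+ y
  lemma = solve-∀

op-consʳ : ∀ Q c d P F γ →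
  opValue Q (op ((c , d) ∷ P) F) γ ≡ c ℤ.* opValue Q F (γ ∔ d) ℤ.+ opValue Q (op P F) γ
op-consʳ []              c d P F γ = sym (trans (ℤₚ.+-identityʳ _) (ℤₚ.*-zeroʳ c))
op-consʳ ((c′ , d′) ∷ Q) c d P F γ
  rewrite op-consʳ Q c d P F γ | ext F (∔-swap γ d′ d) =
    lemma c c′ (ap F ((γ ∔ d) ∔ d′)) (opValue P F (γ ∔ d′)) (opValue Q F (γ ∔ d)) (opValue Q (op P F) γ)
  where
  lemma : ∀ c c′ f p q r → c′ ℤ.* (c ℤ.* f ℤ.+ p) ℤ.+ (c ℤ.* q ℤ.+ r)
                         ≡ c ℤ.* (c′ ℤ.* f ℤ.+ q) ℤ.+ (c′ ℤ.* p ℤ.+ r)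
  lemma = solve-∀

op-comm : ∀ P Q F γ → opValue P (op Q F) γ ≡ opValue Q (op P F) γ
op-comm []            Q F γ = sym (op-zeroʳ Q F γ)
op-comm ((c , d) ∷ P) Q F γ =
  trans (cong (λ x → c ℤ.* opValue Q F (γ ∔ d) ℤ.+ x) (op-comm P Q F γ))
        (sym (op-consʳ Q c d P F γ))

prod : List Op → Fn → Fn
prod Ps F = foldr op F Ps

-- The factors commute, so a Katalan function depends only on the multisets of its roots and
-- lowering factors; later manipulations are permutations of these lists.
prod-↭ : ∀ {Ps Qs} F → Ps ↭ Qs → ∀ γ → ap (prod Ps F) γ ≡ ap (prod Qs F) γ
prod-↭ F Perm.refl γ = refl
prod-↭ F (Perm.prep P p) γ = op-cong P (prod-↭ F p) γ
prod-↭ {_ ∷ _ ∷ Ps} F (Perm.swap P Q p) γ =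
  trans (op-comm P Q (prod Ps F) γ) (op-cong Q (op-cong P (prod-↭ F p)) γ)
prod-↭ F (Perm.trans p q) γ = trans (prod-↭ F p γ) (prod-↭ F q γ)

-- The factor 1 − L_z.
low : ℕ → Op
low z = (1ℤ , 0ℤ · unit z) ∷ (-1ℤ , -ε z) ∷ []

-- The truncation Σ_{n ≤ N} R^n of (1 − R)⁻¹.
geom : ℕ → ℕ × ℕ → Op
geom N β = applyUpTo (λ n → 1ℤ , (+ n) · root β) (suc N)

low-value : ∀ z F γ → opValue (low z) F γ ≡ ap F γ ℤ.- ap F (γ ∔ -ε z)
low-value z F γ rewrite ext F {γ ∔ (0ℤ · unit z)} {γ} (λ a → ℤₚ.+-identityʳ (γ a)) =
  lemma (ap F γ) (ap F (γ ∔ -ε z))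
  where
  lemma : ∀ x y → 1ℤ ℤ.* x ℤ.+ (-1ℤ ℤ.* y ℤ.+ 0ℤ) ≡ x ℤ.- y
  lemma = solve-∀

sumTo : (ℕ → ℤ) → ℕ → ℤ
sumTo f zero    = 0ℤ
sumTo f (suc n) = f 0 ℤ.+ sumTo (λ i → f (suc i)) n

sumTo-cong : ∀ {f g} n → (∀ i → i < n → f i ≡ g i) → sumTo f n ≡ sumTo g n
sumTo-cong zero    eq = refl
sumTo-cong (suc n) eq = cong₂ ℤ._+_ (eq 0 (s≤s z≤n)) (sumTo-cong n (λ i i<n → eq (suc i) (s≤s i<n)))

sumTo-suc : ∀ f n → sumTo f (suc n) ≡ sumTo f n ℤ.+ f n
sumTo-suc f zero    = trans (ℤₚ.+-identityʳ (f 0)) (sym (ℤₚ.+-identityˡ (f 0)))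
sumTo-suc f (suc n) =
  trans (cong (λ x → f 0 ℤ.+ x) (sumTo-suc (λ i → f (suc i)) n)) (sym (ℤₚ.+-assoc (f 0) _ _))

sumTo-+ : ∀ f g n → sumTo (λ i → f i ℤ.+ g i) n ≡ sumTo f n ℤ.+ sumTo g n
sumTo-+ f g zero    = refl
sumTo-+ f g (suc n) rewrite sumTo-+ (λ i → f (suc i)) (λ i → g (suc i)) n =
  lemma (f 0) (g 0) (sumTo (λ i → f (suc i)) n) (sumTo (λ i → g (suc i)) n)
  where
  lemma : ∀ a b x y → (a ℤ.+ b) ℤ.+ (x ℤ.+ y) ≡ (a ℤ.+ x) ℤ.+ (b ℤ.+ y)
  lemma = solve-∀

sumTo-* : ∀ c f n → sumTo (λ i → c ℤ.* f i) n ≡ c ℤ.* sumTo f n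
sumTo-* c f zero    = sym (ℤₚ.*-zeroʳ c)
sumTo-* c f (suc n) rewrite sumTo-* c (λ i → f (suc i)) n = sym (ℤₚ.*-distribˡ-+ c (f 0) _)

applyUpTo-value : ∀ (d : ℕ → Weight) F γ n →
  opValue (applyUpTo (λ i → 1ℤ , d i) n) F γ ≡ sumTo (λ i → ap F (γ ∔ d i)) n
applyUpTo-value d F γ zero    = refl
applyUpTo-value d F γ (suc n) =
  cong₂ ℤ._+_ (ℤₚ.*-identityˡ (ap F (γ ∔ d 0))) (applyUpTo-value (λ i → d (suc i)) F γ n)

geom-value : ∀ N β F γ → opValue (geom N β) F γ ≡ sumTo (λ n → ap F (γ ∔ (+ n) · root β)) (suc N)
geom-value N β F γ = applyUpTo-value (λ n → (+ n) · root β) F γ (suc N)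

-- The relation (1 - R)⁻¹ = 1 + R (1 - R)⁻¹. A truncation violates it by the single term R^(N+1),
-- which the hypothesis kills.
geom-unfold : ∀ N β F γ → ap F (γ ∔ (+ suc N) · root β) ≡ 0ℤ →
  opValue (geom N β) F γ ≡ ap F γ ℤ.+ opValue (geom N β) F (γ ∔ root β)
geom-unfold N β F γ last≡0 = begin
  opValue (geom N β) F γ
    ≡⟨ geom-value N β F γ ⟩
  ap F (γ ∔ (+ 0) · root β) ℤ.+ sumTo (λ n → ap F (γ ∔ (+ suc n) · root β)) N
    ≡⟨ cong₂ ℤ._+_ (ext F (λ a → ℤₚ.+-identityʳ (γ a))) (sym (ℤₚ.+-identityʳ _)) ⟩
  ap F γ ℤ.+ (sumTo (λ n → ap F (γ ∔ (+ suc n) · root β)) N ℤ.+ 0ℤ)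
    ≡⟨ cong (λ x → ap F γ ℤ.+ (sumTo (λ n → ap F (γ ∔ (+ suc n) · root β)) N ℤ.+ x)) (sym last≡0) ⟩
  ap F γ ℤ.+ (sumTo (λ n → ap F (γ ∔ (+ suc n) · root β)) N ℤ.+ ap F (γ ∔ (+ suc N) · root β))
    ≡⟨ cong (ℤ._+_ (ap F γ)) (sym (sumTo-suc (λ n → ap F (γ ∔ (+ suc n) · root β)) N)) ⟩
  ap F γ ℤ.+ sumTo (λ n → ap F (γ ∔ (+ suc n) · root β)) (suc N)
    ≡⟨ cong (ℤ._+_ (ap F γ)) (sumTo-cong (suc N) (λ n _ → ext F (step n))) ⟩
  ap F γ ℤ.+ sumTo (λ n → ap F ((γ ∔ root β) ∔ (+ n) · root β)) (suc N)
    ≡⟨ cong (ℤ._+_ (ap F γ)) (sym (geom-value N β F (γ ∔ root β))) ⟩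
  ap F γ ℤ.+ opValue (geom N β) F (γ ∔ root β) ∎
  where
  open ≡-Reasoning
  step : ∀ n → γ ∔ (+ suc n) · root β ≗ (γ ∔ root β) ∔ (+ n) · root β
  step n a = trans (cong (λ x → γ a ℤ.+ x) (ℤₚ.suc-* (+ n) (root β a)))
                   (sym (ℤₚ.+-assoc (γ a) (root β a) _))

-- Truncated series and root sets

sumTo-zero : ∀ n → sumTo (λ _ → 0ℤ) n ≡ 0ℤ
sumTo-zero zero    = refl
sumTo-zero (suc n) = trans (ℤₚ.+-identityˡ _) (sumTo-zero n)

sumTo-unit : ∀ (f : ℕ → ℤ) {i} n → i < n → sumTo (λ a → f a ℤ.* unit i a) n ≡ f i
sumTo-unit f {zero} (suc n) _ =
  trans (cong₂ ℤ._+_ (ℤₚ.*-identityʳ (f 0))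
                     (trans (sumTo-cong n (λ a _ → ℤₚ.*-zeroʳ (f (suc a)))) (sumTo-zero n)))
        (ℤₚ.+-identityʳ (f 0))
sumTo-unit f {suc i} (suc n) (s≤s i<n) =
  trans (cong₂ ℤ._+_ (ℤₚ.*-zeroʳ (f 0)) (sumTo-unit (λ a → f (suc a)) n i<n))
        (ℤₚ.+-identityˡ (f (suc i)))

Positive : ℕ → ℕ × ℕ → Set
Positive ℓ (i , j) = i < j × j < ℓ

katalanOps : ℕ → List (ℕ × ℕ) → List (ℕ × ℕ) → List Op
katalanOps N Φ Ψ = map (low ∘ proj₂) Φ ++ map (geom N) Ψ

-- The truncation of K(Ψ; L(Φ); γ) with g_γ replaced by G.
katalan : ℕ → Fn → List (ℕ × ℕ) → List (ℕ × ℕ) → Fn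
katalan N G Φ Ψ = prod (katalanOps N Φ Ψ) G

katalan-↭ : ∀ N G {Φ Φ′ Ψ Ψ′} → Φ ↭ Φ′ → Ψ ↭ Ψ′ →
  ∀ γ → ap (katalan N G Φ Ψ) γ ≡ ap (katalan N G Φ′ Ψ′) γ
katalan-↭ N G p q = prod-↭ G (Permₚ.++⁺ (Permₚ.map⁺ (low ∘ proj₂) p) (Permₚ.map⁺ (geom N) q))

katalan-lower : ∀ N G β Φ Ψ γ →
  ap (katalan N G (β ∷ Φ) Ψ) γ ≡ ap (katalan N G Φ Ψ) γ ℤ.- ap (katalan N G Φ Ψ) (γ ∔ -ε (proj₂ β))
katalan-lower N G β Φ Ψ γ = low-value (proj₂ β) (katalan N G Φ Ψ) γ

katalan-split : ∀ N G Φ Ψ → katalan N G Φ Ψ ≡ prod (map (low ∘ proj₂) Φ) (prod (map (geom N) Ψ) G)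
katalan-split N G Φ Ψ = Listₚ.foldr-++ op G (map (low ∘ proj₂) Φ) (map (geom N) Ψ)

module Truncation (ℓ C : ℕ) where

  ht : Weight → ℤ
  ht γ = sumTo (λ i → + i ℤ.* γ i) ℓ

  ht-∔ : ∀ γ δ → ht (γ ∔ δ) ≡ ht γ ℤ.+ ht δ
  ht-∔ γ δ = trans (sumTo-cong ℓ (λ i _ → ℤₚ.*-distribˡ-+ (+ i) (γ i) (δ i)))
                     (sumTo-+ (λ i → + i ℤ.* γ i) (λ i → + i ℤ.* δ i) ℓ)

  ht-· : ∀ n δ → ht (n · δ) ≡ n ℤ.* ht δ
  ht-· n δ = trans (sumTo-cong ℓ (λ i _ → lemma (+ i) n (δ i))) (sumTo-* n (λ i → + i ℤ.* δ i) ℓ)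
    where
    lemma : ∀ i n x → i ℤ.* (n ℤ.* x) ≡ n ℤ.* (i ℤ.* x)
    lemma = solve-∀

  ht-unit : ∀ {i} → i < ℓ → ht (unit i) ≡ + i
  ht-unit i<ℓ = sumTo-unit (λ i → + i) ℓ i<ℓ

  ht--ε : ∀ {i} → i < ℓ → ht (-ε i) ≡ ℤ.- (+ i)
  ht--ε {i} i<ℓ = trans (ht-· -1ℤ (unit i))
                            (trans (cong (-1ℤ ℤ.*_) (ht-unit i<ℓ)) (ℤₚ.-1*i≡-i (+ i)))

  ht-root : ∀ {i j} → i < ℓ → j < ℓ → ht (root (i , j)) ≡ + i ℤ.- + j
  ht-root {i} {j} i<ℓ j<ℓ = begin
    ht (root (i , j))
      ≡⟨ sumTo-cong ℓ (λ a _ → lemma (+ a) (unit i a) (unit j a)) ⟩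
    ht (unit i ∔ -ε j)
      ≡⟨ ht-∔ (unit i) (-ε j) ⟩
    ht (unit i) ℤ.+ ht (-ε j)
      ≡⟨ cong₂ ℤ._+_ (ht-unit i<ℓ) (ht--ε j<ℓ) ⟩
    + i ℤ.- + j ∎
    where
    open ≡-Reasoning
    lemma : ∀ a x y → a ℤ.* (x ℤ.- y) ≡ a ℤ.* (x ℤ.+ -1ℤ ℤ.* y)
    lemma = solve-∀

  -- All weights occurring in the support have height at least −C; as R_ij (i < j) and L_z do not
  -- increase the height, this makes Σ R_ij^n a finite sum.
  Supported : Fn → Set
  Supported F = ∀ γ → ht γ ℤ.+ + C ℤ.< 0ℤ → ap F γ ≡ 0ℤ

  Lowering : Op → Set
  Lowering = All (λ t → ht (proj₂ t) ℤ.≤ 0ℤ)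

  op-supported : ∀ {P F} → Lowering P → Supported F → Supported (op P F)
  op-supported [] supp γ h<0 = refl
  op-supported {(c , d) ∷ P} {F} (d≤0 ∷ P≤0) supp γ h<0 =
    trans (cong₂ (λ x y → c ℤ.* x ℤ.+ y) (supp (γ ∔ d) lower) (op-supported P≤0 supp γ h<0))
          (trans (ℤₚ.+-identityʳ _) (ℤₚ.*-zeroʳ c))
    where
    open ℤₚ.≤-Reasoning
    lower : ht (γ ∔ d) ℤ.+ + C ℤ.< 0ℤ
    lower = begin-strict
      ht (γ ∔ d) ℤ.+ + C          ≡⟨ cong (ℤ._+ + C) (ht-∔ γ d) ⟩
      ht γ ℤ.+ ht d ℤ.+ + C     ≤⟨ ℤₚ.+-monoˡ-≤ (+ C) (ℤₚ.+-monoʳ-≤ (ht γ) d≤0) ⟩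
      ht γ ℤ.+ 0ℤ ℤ.+ + C         ≡⟨ cong (ℤ._+ + C) (ℤₚ.+-identityʳ (ht γ)) ⟩
      ht γ ℤ.+ + C                <⟨ h<0 ⟩
      0ℤ ∎

  prod-supported : ∀ {Ps F} → All Lowering Ps → Supported F → Supported (prod Ps F)
  prod-supported []           supp = supp
  prod-supported (P≤0 ∷ Ps≤0) supp = op-supported P≤0 (prod-supported Ps≤0 supp)

  ht-multiple : ∀ {β} n → Positive ℓ β → ht ((+ n) · root β) ℤ.≤ ℤ.- (+ n)
  ht-multiple {i , j} n (i<j , j<ℓ) = begin
    ht ((+ n) · root (i , j))    ≡⟨ ht-· (+ n) (root (i , j)) ⟩
    + n ℤ.* ht (root (i , j))    ≡⟨ cong (+ n ℤ.*_) (ht-root (ℕₚ.<-trans i<j j<ℓ) j<ℓ) ⟩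
    + n ℤ.* (+ i ℤ.- + j)          ≤⟨ ℤₚ.*-monoˡ-≤-nonNeg (+ n) i-j≤-1 ⟩
    + n ℤ.* -1ℤ                    ≡⟨ trans (ℤₚ.*-comm (+ n) -1ℤ) (ℤₚ.-1*i≡-i (+ n)) ⟩
    ℤ.- (+ n) ∎
    where
    open ℤₚ.≤-Reasoning
    i-j≤-1 : + i ℤ.- + j ℤ.≤ -1ℤ
    i-j≤-1 = begin
      + i ℤ.- + j              ≤⟨ ℤₚ.+-monoʳ-≤ (+ i) (ℤₚ.neg-mono-≤ (ℤ.+≤+ i<j)) ⟩
      + i ℤ.- + suc i          ≡⟨ lemma (+ i) ⟩
      -1ℤ ∎
      where
      lemma : ∀ x → x ℤ.- (1ℤ ℤ.+ x) ≡ -1ℤ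
      lemma = solve-∀

  geom-lowering : ∀ {β} N → Positive ℓ β → Lowering (geom N β)
  geom-lowering {β} N pos = Allₚ.applyUpTo⁺₂ (λ n → 1ℤ , (+ n) · root β) (suc N)
    (λ n → ℤₚ.≤-trans (ht-multiple n pos) (ℤₚ.neg-mono-≤ (ℤ.+≤+ z≤n)))

  low-lowering : ∀ {z} → z < ℓ → Lowering (low z)
  low-lowering {z} z<ℓ =
    ℤₚ.≤-reflexive (trans (ht-· 0ℤ (unit z)) refl)
    ∷ ℤₚ.≤-trans (ℤₚ.≤-reflexive (ht--ε z<ℓ)) (ℤₚ.neg-mono-≤ (ℤ.+≤+ z≤n)) ∷ []

  katalanOps-lowering : ∀ N {Φ Ψ} → All (λ β → proj₂ β < ℓ) Φ → All (Positive ℓ) Ψ →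
    All Lowering (katalanOps N Φ Ψ)
  katalanOps-lowering N Φ<ℓ Ψ-pos =
    Allₚ.++⁺ (Allₚ.map⁺ (All.map low-lowering Φ<ℓ)) (Allₚ.map⁺ (All.map (geom-lowering N) Ψ-pos))

  -- Each application of R_β costs at least one unit of height, so `suc N` of them leave the
  -- support.
  past-support : ∀ {N β γ} → Positive ℓ β → ht γ ℤ.+ + C ℤ.≤ + N →
    ht (γ ∔ (+ suc N) · root β) ℤ.+ + C ℤ.< 0ℤ
  past-support {N} {β} {γ} β-pos bound = begin-strict
    ht (γ ∔ (+ suc N) · root β) ℤ.+ + C
      ≡⟨ cong (ℤ._+ + C) (ht-∔ γ ((+ suc N) · root β)) ⟩
    ht γ ℤ.+ ht ((+ suc N) · root β) ℤ.+ + C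
      ≤⟨ ℤₚ.+-monoˡ-≤ (+ C) (ℤₚ.+-monoʳ-≤ (ht γ) (ht-multiple (suc N) β-pos)) ⟩
    ht γ ℤ.+ ℤ.- (+ suc N) ℤ.+ + C
      ≡⟨ lemma (ht γ) (ℤ.- (+ suc N)) (+ C) ⟩
    (ht γ ℤ.+ + C) ℤ.+ ℤ.- (+ suc N)
      ≤⟨ ℤₚ.+-monoˡ-≤ (ℤ.- (+ suc N)) bound ⟩
    + N ℤ.+ ℤ.- (+ suc N)
      ≡⟨ lemma′ (+ N) ⟩
    -1ℤ
      <⟨ ℤ.-<+ ⟩
    0ℤ ∎
    where
    open ℤₚ.≤-Reasoning
    lemma : ∀ x y z → x ℤ.+ y ℤ.+ z ≡ (x ℤ.+ z) ℤ.+ y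
    lemma = solve-∀
    lemma′ : ∀ x → x ℤ.+ ℤ.- (1ℤ ℤ.+ x) ≡ -1ℤ
    lemma′ = solve-∀

  -- Splitting off the root β keeps the same `N` everywhere, because the height bound removes the
  -- boundary term of `geom-unfold`.
  katalan-raise : ∀ {N G β Φ Ψ γ} → Supported G →
    All (λ β → proj₂ β < ℓ) Φ → All (Positive ℓ) Ψ → Positive ℓ β → ht γ ℤ.+ + C ℤ.≤ + N →
    ap (katalan N G Φ (β ∷ Ψ)) γ ≡ ap (katalan N G Φ Ψ) γ ℤ.+ ap (katalan N G Φ (β ∷ Ψ)) (γ ∔ root β)
  katalan-raise {N} {G} {β} {Φ} {Ψ} {γ} supp Φ<ℓ Ψ-pos β-pos bound = begin
    ap (katalan N G Φ (β ∷ Ψ)) γ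
      ≡⟨ prod-↭ G front γ ⟩
    opValue (geom N β) (katalan N G Φ Ψ) γ
      ≡⟨ geom-unfold N β (katalan N G Φ Ψ) γ
           (prod-supported (katalanOps-lowering N Φ<ℓ Ψ-pos) supp _ (past-support {γ = γ} β-pos bound)) ⟩
    ap (katalan N G Φ Ψ) γ ℤ.+ opValue (geom N β) (katalan N G Φ Ψ) (γ ∔ root β)
      ≡⟨ cong (ℤ._+_ (ap (katalan N G Φ Ψ) γ)) (sym (prod-↭ G front (γ ∔ root β))) ⟩
    ap (katalan N G Φ Ψ) γ ℤ.+ ap (katalan N G Φ (β ∷ Ψ)) (γ ∔ root β) ∎
    where
    open ≡-Reasoning
    front : katalanOps N Φ (β ∷ Ψ) ↭ geom N β ∷ katalanOps N Φ Ψ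
    front = Permₚ.shift (geom N β) (map (low ∘ proj₂) Φ) (map (geom N) Ψ)

  geom-stable : ∀ {N β F γ} → Supported F → Positive ℓ β → ht γ ℤ.+ + C ℤ.≤ + N →
    opValue (geom (suc N) β) F γ ≡ opValue (geom N β) F γ
  geom-stable {N = N} {β} {F} {γ} supp β-pos bound = begin
    opValue (geom (suc N) β) F γ                            ≡⟨ geom-value (suc N) β F γ ⟩
    sumTo (λ n → ap F (γ ∔ (+ n) · root β)) (suc (suc N))   ≡⟨ sumTo-suc (λ n → ap F (γ ∔ (+ n) · root β)) (suc N) ⟩
    sumTo (λ n → ap F (γ ∔ (+ n) · root β)) (suc N) ℤ.+ ap F (γ ∔ (+ suc N) · root β)
      ≡⟨ cong₂ ℤ._+_ (sym (geom-value N β F γ)) (supp _ (past-support {γ = γ} β-pos bound)) ⟩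
    opValue (geom N β) F γ ℤ.+ 0ℤ                           ≡⟨ ℤₚ.+-identityʳ _ ⟩
    opValue (geom N β) F γ ∎
    where open ≡-Reasoning

  -- Operators only look at weights of smaller height, so agreement below a height is preserved.
  AgreeBelow : ℤ → Fn → Fn → Set
  AgreeBelow b F G = ∀ γ → ht γ ℤ.≤ b → ap F γ ≡ ap G γ

  op-agree : ∀ {b P F G} → Lowering P → AgreeBelow b F G → AgreeBelow b (op P F) (op P G)
  op-agree [] agree γ γ≤b = refl
  op-agree {b} {(c , d) ∷ P} (d≤0 ∷ P≤0) agree γ γ≤b =
    cong₂ (λ x y → c ℤ.* x ℤ.+ y)
      (agree (γ ∔ d) (begin
        ht (γ ∔ d)         ≡⟨ ht-∔ γ d ⟩
        ht γ ℤ.+ ht d    ≤⟨ ℤₚ.+-monoʳ-≤ (ht γ) d≤0 ⟩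
        ht γ ℤ.+ 0ℤ        ≡⟨ ℤₚ.+-identityʳ (ht γ) ⟩
        ht γ               ≤⟨ γ≤b ⟩
        b ∎))
      (op-agree P≤0 agree γ γ≤b)
    where open ℤₚ.≤-Reasoning

  -- Agreement is claimed at all weights below a height at once, since the outer series evaluate the
  -- inner ones at lower weights.
  geoms-stable : ∀ {N G Ψ b} → Supported G → All (Positive ℓ) Ψ → b ℤ.+ + C ℤ.≤ + N →
    AgreeBelow b (prod (map (geom (suc N)) Ψ) G) (prod (map (geom N) Ψ) G)
  geoms-stable {Ψ = []} supp [] bound γ γ≤b = refl
  geoms-stable {N} {G} {β ∷ Ψ} supp (β-pos ∷ Ψ-pos) bound γ γ≤b =
    trans (op-agree (geom-lowering (suc N) β-pos) (geoms-stable supp Ψ-pos bound) γ γ≤b)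
          (geom-stable (prod-supported (katalanOps-lowering N {Φ = []} [] Ψ-pos) supp) β-pos
                       (ℤₚ.≤-trans (ℤₚ.+-monoˡ-≤ (+ C) γ≤b) bound))

  lows-agree : ∀ {b F G} {Φ : List (ℕ × ℕ)} → All (λ β → proj₂ β < ℓ) Φ → AgreeBelow b F G →
    AgreeBelow b (prod (map (low ∘ proj₂) Φ) F) (prod (map (low ∘ proj₂) Φ) G)
  lows-agree []           agree = agree
  lows-agree {F = F} {G} {β ∷ Φ} (β<ℓ ∷ Φ<ℓ) agree =
    op-agree {F = prod (map (low ∘ proj₂) Φ) F} {prod (map (low ∘ proj₂) Φ) G} (low-lowering β<ℓ) (lows-agree Φ<ℓ agree)

  katalan-suc : ∀ {N G Φ Ψ γ} → Supported G →
    All (λ β → proj₂ β < ℓ) Φ → All (Positive ℓ) Ψ → ht γ ℤ.+ + C ℤ.≤ + N →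
    ap (katalan (suc N) G Φ Ψ) γ ≡ ap (katalan N G Φ Ψ) γ
  katalan-suc {N = N} {G} {Φ} {Ψ} {γ} supp Φ<ℓ Ψ-pos bound
    rewrite katalan-split (suc N) G Φ Ψ | katalan-split N G Φ Ψ =
      lows-agree Φ<ℓ (geoms-stable supp Ψ-pos bound) γ ℤₚ.≤-refl

  katalan-stable : ∀ {N G Φ Ψ γ} → Supported G →
    All (λ β → proj₂ β < ℓ) Φ → All (Positive ℓ) Ψ → ht γ ℤ.+ + C ℤ.≤ + N →
    ∀ m → ap (katalan (m ℕ.+ N) G Φ Ψ) γ ≡ ap (katalan N G Φ Ψ) γ
  katalan-stable supp Φ<ℓ Ψ-pos bound zero    = refl
  katalan-stable {N = N} supp Φ<ℓ Ψ-pos bound (suc m) =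
    trans (katalan-suc supp Φ<ℓ Ψ-pos (ℤₚ.≤-trans bound (ℤ.+≤+ (ℕₚ.m≤n+m N m))))
          (katalan-stable supp Φ<ℓ Ψ-pos bound m)

-- Root sets given by the first column of each row

unique-↭ : ∀ {A : Set} {xs ys : List A} → Unique xs → Unique ys →
  (∀ {v} → v ∈ xs → v ∈ ys) → (∀ {v} → v ∈ ys → v ∈ xs) → xs ↭ ys
unique-↭ u u′ to from = ∼bag⇒↭ (unique∧set⇒bag u u′ (mk⇔ to from))

involution-↭ : ∀ {A : Set} {xs : List A} (f : A → A) → (∀ v → f (f v) ≡ v) → Unique xs →
  (∀ {v} → v ∈ xs → f v ∈ xs) → map f xs ↭ xs
involution-↭ {xs = xs} f invol u closed =
  unique-↭ (Uniqueₚ.map⁺ (λ {x} {y} eq → trans (sym (invol x)) (trans (cong f eq) (invol y))) u) u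
    (λ v∈ → let (w , w∈ , eq) = ∈-map⁻ f v∈ in subst (_∈ xs) (sym eq) (closed w∈))
    (λ {v} v∈ → subst (_∈ map f xs) (invol v) (∈-map⁺ f (closed v∈)))

-- Row i starts in column `d i`. Besides root ideals this also encodes multisets of lowering
-- factors, as the columns of such a set.
roots : ℕ → (ℕ → ℕ) → List (ℕ × ℕ)
roots ℓ d = filter (λ β → d (proj₁ β) ℕ.≤? proj₂ β) (cartesianProduct (upTo ℓ) (upTo ℓ))

roots-unique : ∀ ℓ d → Unique (roots ℓ d)
roots-unique ℓ d = Uniqueₚ.filter⁺ _ (Uniqueₚ.cartesianProduct⁺ (Uniqueₚ.upTo⁺ ℓ) (Uniqueₚ.upTo⁺ ℓ))

∈-roots⁺ : ∀ {ℓ d i j} → i < ℓ → j < ℓ → d i ≤ j → (i , j) ∈ roots ℓ d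
∈-roots⁺ i<ℓ j<ℓ d≤j = ∈-filter⁺ _ (∈-cartesianProduct⁺ (∈-upTo⁺ i<ℓ) (∈-upTo⁺ j<ℓ)) d≤j

∈-roots⁻ : ∀ {ℓ d i j} → (i , j) ∈ roots ℓ d → i < ℓ × j < ℓ × d i ≤ j
∈-roots⁻ {ℓ} {d} β∈ =
  let (β∈′ , d≤j) = ∈-filter⁻ (λ β → d (proj₁ β) ℕ.≤? proj₂ β) {xs = cartesianProduct (upTo ℓ) (upTo ℓ)} β∈
      (i∈ , j∈) = ∈-cartesianProduct⁻ (upTo ℓ) (upTo ℓ) β∈′
  in ∈-upTo⁻ i∈ , ∈-upTo⁻ j∈ , d≤j

roots-column : ∀ ℓ d → All (λ β → proj₂ β < ℓ) (roots ℓ d)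
roots-column ℓ d = All.tabulate (λ β∈ → proj₁ (proj₂ (∈-roots⁻ {ℓ} {d} β∈)))

roots-positive : ∀ ℓ {d} → (∀ i → i < d i) → All (Positive ℓ) (roots ℓ d)
roots-positive ℓ {d} i<d = All.tabulate
  (λ β∈ → let (_ , j<ℓ , d≤j) = ∈-roots⁻ {ℓ} {d} β∈ in ℕₚ.<-≤-trans (i<d _) d≤j , j<ℓ)

roots-↭ : ∀ {ℓ d d′} → (∀ {i j} → i < ℓ → j < ℓ → d i ≤ j → d′ i ≤ j) →
  (∀ {i j} → i < ℓ → j < ℓ → d′ i ≤ j → d i ≤ j) →
  roots ℓ d ↭ roots ℓ d′
roots-↭ {ℓ} {d} {d′} to from = unique-↭ (roots-unique ℓ d) (roots-unique ℓ d′)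
  (λ β∈ → let (i<ℓ , j<ℓ , d≤j) = ∈-roots⁻ {ℓ} {d} β∈ in ∈-roots⁺ i<ℓ j<ℓ (to i<ℓ j<ℓ d≤j))
  (λ β∈ → let (i<ℓ , j<ℓ , d≤j) = ∈-roots⁻ {ℓ} {d′} β∈ in ∈-roots⁺ i<ℓ j<ℓ (from i<ℓ j<ℓ d≤j))

record RemovesFrom (d : ℕ → ℕ) (i j : ℕ) (d′ : ℕ → ℕ) : Set where
  constructor removes
  field
    before : d i ≡ j
    after  : d′ i ≡ suc j
    other  : ∀ a → a ≢ i → d′ a ≡ d a

roots-remove : ∀ {ℓ d d′ i j} → RemovesFrom d i j d′ → i < ℓ → j < ℓ → roots ℓ d ↭ (i , j) ∷ roots ℓ d′
roots-remove {ℓ} {d} {d′} {i} {j} (removes before after other) i<ℓ j<ℓ =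
  unique-↭ (roots-unique ℓ d)
    (All.tabulate (λ { β∈ refl → let (_ , _ , d≤) = ∈-roots⁻ {ℓ} {d′} β∈ in
                                 ℕₚ.<⇒≱ (ℕₚ.n<1+n j) (subst (_≤ j) after d≤) })
     ∷ roots-unique ℓ d′)
    to from
  where
  to : ∀ {v} → v ∈ roots ℓ d → v ∈ (i , j) ∷ roots ℓ d′
  to {a , b} v∈ with (a<ℓ , b<ℓ , d≤b) ← ∈-roots⁻ {ℓ} {d} v∈ | a ℕ.≟ i
  ... | no a≢i = there (∈-roots⁺ a<ℓ b<ℓ (subst (_≤ b) (sym (other a a≢i)) d≤b))
  ... | yes refl with b ℕ.≟ j
  ...   | yes refl = here refl
  ...   | no b≢j = there (∈-roots⁺ a<ℓ b<ℓ
            (subst (_≤ b) (sym after) (ℕₚ.≤∧≢⇒< (subst (_≤ b) before d≤b) (λ j≡b → b≢j (sym j≡b)))))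
  from : ∀ {v} → v ∈ (i , j) ∷ roots ℓ d′ → v ∈ roots ℓ d
  from (here refl) = ∈-roots⁺ i<ℓ j<ℓ (ℕₚ.≤-reflexive before)
  from {a , b} (there v∈) with (a<ℓ , b<ℓ , d≤b) ← ∈-roots⁻ {ℓ} {d′} v∈ | a ℕ.≟ i
  ... | no a≢i = ∈-roots⁺ a<ℓ b<ℓ (subst (_≤ b) (other a a≢i) d≤b)
  ... | yes refl = ∈-roots⁺ a<ℓ b<ℓ
          (subst (_≤ b) (sym before) (ℕₚ.<⇒≤ (subst (_≤ b) after d≤b)))

roots-remove-outside : ∀ {ℓ d d′ i j} → RemovesFrom d i j d′ → ℓ ≤ j → roots ℓ d ↭ roots ℓ d′
roots-remove-outside {ℓ} {d} {d′} {i} {j} (removes before after other) ℓ≤j = roots-↭ to from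
  where
  to : ∀ {a b} → a < ℓ → b < ℓ → d a ≤ b → d′ a ≤ b
  to {a} {b} _ b<ℓ d≤b with a ℕ.≟ i
  ... | no a≢i   = subst (_≤ b) (sym (other a a≢i)) d≤b
  ... | yes refl = contradiction (ℕₚ.≤-trans ℓ≤j (subst (_≤ b) before d≤b)) (ℕₚ.<⇒≱ b<ℓ)
  from : ∀ {a b} → a < ℓ → b < ℓ → d′ a ≤ b → d a ≤ b
  from {a} {b} _ b<ℓ d≤b with a ℕ.≟ i
  ... | no a≢i   = subst (_≤ b) (other a a≢i) d≤b
  ... | yes refl = ℕₚ.≤-trans (ℕₚ.≤-trans (ℕₚ.≤-reflexive before) (ℕₚ.n≤1+n j)) (subst (_≤ b) after d≤b)

-- Reflections

transpose : ℕ → ℕ → ℕ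
transpose zero    zero          = 1
transpose zero    (suc zero)    = 0
transpose zero    (suc (suc i)) = suc (suc i)
transpose (suc c) zero          = zero
transpose (suc c) (suc i)       = suc (transpose c i)

transpose-invol : ∀ c i → transpose c (transpose c i) ≡ i
transpose-invol zero    zero          = refl
transpose-invol zero    (suc zero)    = refl
transpose-invol zero    (suc (suc i)) = refl
transpose-invol (suc c) zero          = refl
transpose-invol (suc c) (suc i)       = cong suc (transpose-invol c i)

data Transposed (c i : ℕ) : ℕ → Set where
  lower : i ≡ c     → Transposed c i (suc c)
  upper : i ≡ suc c → Transposed c i c
  fixed : i ≢ c → i ≢ suc c → Transposed c i i

transposed : ∀ c i → Transposed c i (transpose c i)
transposed zero    zero          = lower refl
transposed zero    (suc zero)    = upper refl
transposed zero    (suc (suc i)) = fixed (λ ()) (λ ())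
transposed (suc c) zero          = fixed (λ ()) (λ ())
transposed (suc c) (suc i) with transpose c i | transposed c i
... | _ | lower i≡c = lower (cong suc i≡c)
... | _ | upper i≡c = upper (cong suc i≡c)
... | _ | fixed p q = fixed (λ eq → p (ℕₚ.suc-injective eq)) (λ eq → q (ℕₚ.suc-injective eq))

-- The form δ - ⟨δ, α⟩ α for the simple root α, rather than cases on the index, turns additivity and
-- the action on roots into ring identities plus the case of unit vectors.
linear-reflection : ℕ → Weight → Weight
linear-reflection c δ = δ ∔ (δ (suc c) ℤ.- δ c) · root (c , suc c)

-- The action of the transposition of c and c + 1 centred so that g changes sign: it swaps
-- γ_c − c and γ_{c+1} − (c + 1).
reflection : ℕ → Weight → Weight
reflection c γ = γ ∔ (γ (suc c) ℤ.- γ c ℤ.- 1ℤ) · root (c , suc c)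

reflection-∔ : ∀ c γ δ → reflection c (γ ∔ δ) ≗ reflection c γ ∔ linear-reflection c δ
reflection-∔ c γ δ a = lemma (γ a) (δ a) (γ (suc c)) (δ (suc c)) (γ c) (δ c) (root (c , suc c) a)
  where
  lemma : ∀ x d x₁ d₁ x₀ d₀ r → (x ℤ.+ d) ℤ.+ ((x₁ ℤ.+ d₁) ℤ.- (x₀ ℤ.+ d₀) ℤ.- 1ℤ) ℤ.* r
        ≡ (x ℤ.+ (x₁ ℤ.- x₀ ℤ.- 1ℤ) ℤ.* r) ℤ.+ (d ℤ.+ (d₁ ℤ.- d₀) ℤ.* r)
  lemma = solve-∀

linear-reflection-unit : ∀ c i → linear-reflection c (unit i) ≗ unit (transpose c i)
linear-reflection-unit zero    zero          zero          = refl
linear-reflection-unit zero    zero          (suc zero)    = refl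
linear-reflection-unit zero    zero          (suc (suc a)) = refl
linear-reflection-unit zero    (suc zero)    zero          = refl
linear-reflection-unit zero    (suc zero)    (suc zero)    = refl
linear-reflection-unit zero    (suc zero)    (suc (suc a)) = refl
linear-reflection-unit zero    (suc (suc i)) zero          = refl
linear-reflection-unit zero    (suc (suc i)) (suc zero)    = refl
linear-reflection-unit zero    (suc (suc i)) (suc (suc a)) = ℤₚ.+-identityʳ (unit i a)
linear-reflection-unit (suc c) zero          zero          = refl
linear-reflection-unit (suc c) zero          (suc a)       = refl
linear-reflection-unit (suc c) (suc i)       zero          =
  trans (ℤₚ.+-identityˡ _) (ℤₚ.*-zeroʳ (unit i (suc c) ℤ.- unit i c))
linear-reflection-unit (suc c) (suc i)       (suc a)       = linear-reflection-unit c i a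

linear-reflection-root : ∀ c i j n →
  linear-reflection c (n · root (i , j)) ≗ n · root (transpose c i , transpose c j)
linear-reflection-root c i j n a =
  trans (lemma n (unit i a) (unit j a) (unit i (suc c)) (unit j (suc c)) (unit i c) (unit j c) (root (c , suc c) a))
        (cong₂ (λ x y → n ℤ.* (x ℤ.- y)) (linear-reflection-unit c i a) (linear-reflection-unit c j a))
  where
  lemma : ∀ n u v u₁ v₁ u₀ v₀ r →
    n ℤ.* (u ℤ.- v) ℤ.+ (n ℤ.* (u₁ ℤ.- v₁) ℤ.- n ℤ.* (u₀ ℤ.- v₀)) ℤ.* r
      ≡ n ℤ.* ((u ℤ.+ (u₁ ℤ.- u₀) ℤ.* r) ℤ.- (v ℤ.+ (v₁ ℤ.- v₀) ℤ.* r))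
  lemma = solve-∀

linear-reflection-multiple : ∀ c i n → linear-reflection c (n · unit i) ≗ n · unit (transpose c i)
linear-reflection-multiple c i n a =
  trans (lemma n (unit i a) (unit i (suc c)) (unit i c) (root (c , suc c) a))
        (cong (n ℤ.*_) (linear-reflection-unit c i a))
  where
  lemma : ∀ n u u₁ u₀ r → n ℤ.* u ℤ.+ (n ℤ.* u₁ ℤ.- n ℤ.* u₀) ℤ.* r ≡ n ℤ.* (u ℤ.+ (u₁ ℤ.- u₀) ℤ.* r)
  lemma = solve-∀

Reflected : ℕ → Op → Op → Set
Reflected c = Pointwise (λ t u → proj₁ t ≡ proj₁ u × proj₂ t ≗ linear-reflection c (proj₂ u))

-- Two functions occur because reflecting the weight replaces every operator by its mirror image;
-- mirrored and original lists are identified only afterwards, by a permutation.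
Antisymmetric : ℕ → Fn → Fn → Set
Antisymmetric c F F′ = ∀ γ → ap F (reflection c γ) ≡ ℤ.- ap F′ γ

op-antisymmetric : ∀ {c P P′ F F′} → Reflected c P P′ → Antisymmetric c F F′ →
  Antisymmetric c (op P F) (op P′ F′)
op-antisymmetric [] anti γ = refl
op-antisymmetric {c} {(x , d) ∷ P} {(_ , d′) ∷ P′} {F} {F′} ((refl , d≗) ∷ refl-P) anti γ =
  trans (cong₂ (λ u v → x ℤ.* u ℤ.+ v)
          (trans (ext F (λ a → trans (cong (λ u → reflection c γ a ℤ.+ u) (d≗ a))
                                     (sym (reflection-∔ c γ d′ a))))
                 (anti (γ ∔ d′)))
          (op-antisymmetric refl-P anti γ))
        (lemma x (ap F′ (γ ∔ d′)) (opValue P′ F′ γ))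
  where
  lemma : ∀ x u v → x ℤ.* (ℤ.- u) ℤ.+ ℤ.- v ≡ ℤ.- (x ℤ.* u ℤ.+ v)
  lemma = solve-∀

prod-antisymmetric : ∀ {c Ps Ps′ F F′} → Pointwise (Reflected c) Ps Ps′ → Antisymmetric c F F′ →
  Antisymmetric c (prod Ps F) (prod Ps′ F′)
prod-antisymmetric []       anti = anti
prod-antisymmetric (r ∷ rs) anti = op-antisymmetric r (prod-antisymmetric rs anti)

transposeRoot : ℕ → ℕ × ℕ → ℕ × ℕ
transposeRoot c (i , j) = transpose c i , transpose c j

-- For the marked set: a lowering factor sees only the column of its root.
transposeColumn : ℕ → ℕ × ℕ → ℕ × ℕ
transposeColumn c (i , j) = i , transpose c j

applyUpTo-pointwise : ∀ {A : Set} {R : A → A → Set} {f g : ℕ → A} n → (∀ i → R (f i) (g i)) →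
  Pointwise R (applyUpTo f n) (applyUpTo g n)
applyUpTo-pointwise zero    r = []
applyUpTo-pointwise (suc n) r = r 0 ∷ applyUpTo-pointwise n (r ∘ suc)

geom-reflected : ∀ c N β → Reflected c (geom N (transposeRoot c β)) (geom N β)
geom-reflected c N (i , j) =
  applyUpTo-pointwise {f = λ n → 1ℤ , (+ n) · root (transposeRoot c (i , j))} {λ n → 1ℤ , (+ n) · root (i , j)}
    (suc N) (λ n → refl , λ a → sym (linear-reflection-root c i j (+ n) a))

-- Since the identity term of `low z` is stored as the shift `0ℤ · unit z`, both terms are multiples
-- of a unit vector and one lemma covers them.
low-reflected : ∀ c z → Reflected c (low (transpose c z)) (low z)
low-reflected c z = (refl , λ a → sym (linear-reflection-multiple c z 0ℤ a))
                  ∷ (refl , λ a → sym (linear-reflection-multiple c z -1ℤ a)) ∷ []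

katalanOps-reflected : ∀ c N Φ Ψ →
  Pointwise (Reflected c) (katalanOps N (map (transposeColumn c) Φ) (map (transposeRoot c) Ψ)) (katalanOps N Φ Ψ)
katalanOps-reflected c N ((i , j) ∷ Φ) Ψ       = low-reflected c j ∷ katalanOps-reflected c N Φ Ψ
katalanOps-reflected c N []            (β ∷ Ψ) = geom-reflected c N β ∷ katalanOps-reflected c N [] Ψ
katalanOps-reflected c N []            []      = []

self-negative : ∀ {x : ℤ} → x ≡ ℤ.- x → x ≡ 0ℤ
self-negative {+ zero} eq = refl

transpose-< : ∀ {ℓ c} i → suc c < ℓ → i < ℓ → transpose c i < ℓ
transpose-< {c = c} i c<ℓ i<ℓ with transpose c i | transposed c i
... | _ | lower _   = c<ℓ
... | _ | upper _   = ℕₚ.<⇒≤ c<ℓ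
... | _ | fixed _ _ = i<ℓ

-- The columns from `d` onwards are stable under exchanging c and c + 1 unless the cut falls between
-- the two.
transpose-≤ : ∀ {c d} j → d ≢ suc c → d ≤ j → d ≤ transpose c j
transpose-≤ {c} j d≢ d≤j with transpose c j | transposed c j
... | _ | lower refl = ℕₚ.m≤n⇒m≤1+n d≤j
... | _ | upper refl = ℕ.s≤s⁻¹ (ℕₚ.≤∧≢⇒< d≤j d≢)
... | _ | fixed _ _  = d≤j

transpose-fixes : ∀ {c} (d : ℕ → ℕ) → d c ≡ d (suc c) → ∀ i → d (transpose c i) ≡ d i
transpose-fixes {c} d eq i with transpose c i | transposed c i
... | _ | lower refl = sym eq
... | _ | upper refl = eq
... | _ | fixed _ _  = refl

-- The first condition, a wall, makes rows c and c + 1 equally long; the second, a ceiling, makes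
-- columns c and c + 1 alike.
roots-transposeRoot : ∀ {ℓ c d} → suc c < ℓ → d c ≡ d (suc c) → (∀ i → d i ≢ suc c) →
  map (transposeRoot c) (roots ℓ d) ↭ roots ℓ d
roots-transposeRoot {ℓ} {c} {d} c<ℓ wall ceiling =
  involution-↭ (transposeRoot c) (λ β → cong₂ _,_ (transpose-invol c (proj₁ β)) (transpose-invol c (proj₂ β)))
    (roots-unique ℓ d) closed
  where
  closed : ∀ {β} → β ∈ roots ℓ d → transposeRoot c β ∈ roots ℓ d
  closed {i , j} β∈ with (i<ℓ , j<ℓ , d≤j) ← ∈-roots⁻ {ℓ} {d} β∈ =
    ∈-roots⁺ (transpose-< i c<ℓ i<ℓ) (transpose-< j c<ℓ j<ℓ)
      (subst (_≤ transpose c j) (sym (transpose-fixes d wall i)) (transpose-≤ j (ceiling i) d≤j))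

roots-transposeColumn : ∀ {ℓ c d} → suc c < ℓ → (∀ i → d i ≢ suc c) →
  map (transposeColumn c) (roots ℓ d) ↭ roots ℓ d
roots-transposeColumn {ℓ} {c} {d} c<ℓ ceiling =
  involution-↭ (transposeColumn c) (λ β → cong (proj₁ β ,_) (transpose-invol c (proj₂ β)))
    (roots-unique ℓ d) closed
  where
  closed : ∀ {β} → β ∈ roots ℓ d → transposeColumn c β ∈ roots ℓ d
  closed {i , j} β∈ with (i<ℓ , j<ℓ , d≤j) ← ∈-roots⁻ {ℓ} {d} β∈ =
    ∈-roots⁺ i<ℓ (transpose-< j c<ℓ j<ℓ) (transpose-≤ j (ceiling i) d≤j)

bump : ℕ → (ℕ → ℕ) → ℕ → ℕ
bump i d a with a ℕ.≟ i
... | yes _ = suc (d a)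
... | no  _ = d a

bump-removes : ∀ i d → RemovesFrom d i (d i) (bump i d)
bump-removes i d = removes refl same other
  where
  same : bump i d i ≡ suc (d i)
  same with i ℕ.≟ i
  ... | yes _  = refl
  ... | no i≢i = contradiction refl i≢i
  other : ∀ a → a ≢ i → bump i d a ≡ d a
  other a a≢i with a ℕ.≟ i
  ... | yes a≡i = contradiction a≡i a≢i
  ... | no _    = refl

-- Rows c, c+1 of the root set and its columns c, c+1 are alike, and (1 − L_{c+1}) is the only
-- factor without a mirror image; since (1 − L_{c+1}) g is antisymmetric, the value is its own negative
-- at a weight fixed by the reflection.
katalan-vanishes : ∀ {ℓ N G d e a c γ} → Antisymmetric c (op (low (suc c)) G) (op (low (suc c)) G) →
  suc c < ℓ → a < ℓ → d c ≡ d (suc c) → (∀ i → d i ≢ suc c) →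
  e a ≡ suc c → (∀ i → i ≢ a → e i ≢ suc c) → γ (suc c) ≡ γ c ℤ.+ 1ℤ →
  ap (katalan N G (roots ℓ e) (roots ℓ d)) γ ≡ 0ℤ
katalan-vanishes {ℓ} {N} {G} {d} {e} {a} {c} {γ} anti c<ℓ a<ℓ wall ceiling e-a e-other γ-eq = begin
  ap (katalan N G (roots ℓ e) (roots ℓ d)) γ
    ≡⟨ katalan-↭ N G (roots-remove (bump-removes a e) a<ℓ (subst (_< ℓ) (sym e-a) c<ℓ)) Perm.refl γ ⟩
  ap (katalan N G ((a , e a) ∷ roots ℓ e′) (roots ℓ d)) γ
    ≡⟨ cong (λ x → ap (katalan N G ((a , x) ∷ roots ℓ e′) (roots ℓ d)) γ) e-a ⟩
  ap (prod (low (suc c) ∷ ops) G) γ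
    -- The unpaired factor moves innermost, because antisymmetry is available for
    -- `op (low (suc c)) G` and not for `G`.
    ≡⟨ prod-↭ G (Permₚ.∷↭∷ʳ (low (suc c)) ops) γ ⟩
  ap (prod (ops List.∷ʳ low (suc c)) G) γ
    ≡⟨ cong (λ F → ap F γ) (Listₚ.foldr-++ op G ops (low (suc c) ∷ [])) ⟩
  ap (prod ops G′) γ
    ≡⟨ self-negative own-negative ⟩
  0ℤ ∎
  where
  open ≡-Reasoning
  e′ = bump a e
  ops = katalanOps N (roots ℓ e′) (roots ℓ d)
  G′ = op (low (suc c)) G
  e′-ceiling : ∀ i → e′ i ≢ suc c
  e′-ceiling i eq with i ℕ.≟ a
  ... | yes refl = ℕₚ.1+n≢n (trans eq (sym e-a))
  ... | no i≢a   = e-other i i≢a eq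
  fixed-weight : reflection c γ ≗ γ
  fixed-weight b rewrite γ-eq = lemma (γ b) (γ c) (root (c , suc c) b)
    where
    lemma : ∀ x y r → x ℤ.+ (y ℤ.+ 1ℤ ℤ.- y ℤ.- 1ℤ) ℤ.* r ≡ x
    lemma = solve-∀
  own-negative : ap (prod ops G′) γ ≡ ℤ.- ap (prod ops G′) γ
  own-negative = begin
    ap (prod ops G′) γ
      ≡⟨ ext (prod ops G′) (λ b → sym (fixed-weight b)) ⟩
    ap (prod ops G′) (reflection c γ)
      ≡⟨ sym (katalan-↭ N G′ (roots-transposeColumn c<ℓ e′-ceiling) (roots-transposeRoot c<ℓ wall ceiling)
                         (reflection c γ)) ⟩
    ap (katalan N G′ (map (transposeColumn c) (roots ℓ e′)) (map (transposeRoot c) (roots ℓ d))) (reflection c γ)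
      ≡⟨ prod-antisymmetric (katalanOps-reflected c N (roots ℓ e′) (roots ℓ d)) anti γ ⟩
    ℤ.- ap (prod ops G′) γ ∎

-- Partitions and marked root sets

VanishesBelow : ℕ → Fn → Set
VanishesBelow c F = ∀ γ → γ c ℤ.< 0ℤ → ap F γ ≡ 0ℤ

NonRaising : ℕ → Op → Set
NonRaising c = All (λ t → proj₂ t c ℤ.≤ 0ℤ)

op-vanishesBelow : ∀ {c P F} → NonRaising c P → VanishesBelow c F → VanishesBelow c (op P F)
op-vanishesBelow [] vanish γ γ<0 = refl
op-vanishesBelow {c} {(x , d) ∷ P} {F} (d≤0 ∷ P≤0) vanish γ γ<0 =
  trans (cong₂ (λ u v → x ℤ.* u ℤ.+ v)
          (vanish (γ ∔ d) (ℤₚ.+-mono-<-≤ γ<0 d≤0))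
          (op-vanishesBelow P≤0 vanish γ γ<0))
        (trans (ℤₚ.+-identityʳ _) (ℤₚ.*-zeroʳ x))

prod-vanishesBelow : ∀ {c Ps F} → All (NonRaising c) Ps → VanishesBelow c F → VanishesBelow c (prod Ps F)
prod-vanishesBelow []           vanish = vanish
prod-vanishesBelow (P≤0 ∷ Ps≤0) vanish = op-vanishesBelow P≤0 (prod-vanishesBelow Ps≤0 vanish)

unit-nonneg : ∀ i a → 0ℤ ℤ.≤ unit i a
unit-nonneg zero    zero    = ℤ.+≤+ z≤n
unit-nonneg zero    (suc a) = ℤ.+≤+ z≤n
unit-nonneg (suc i) zero    = ℤ.+≤+ z≤n
unit-nonneg (suc i) (suc a) = unit-nonneg i a

low-nonRaising : ∀ c z → NonRaising c (low z)
low-nonRaising c z = ℤₚ.≤-refl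
  ∷ ℤₚ.≤-trans (ℤₚ.≤-reflexive (ℤₚ.-1*i≡-i (unit z c))) (ℤₚ.neg-mono-≤ (unit-nonneg z c)) ∷ []

geom-nonRaising : ∀ {c i j} N → i ≢ c → NonRaising c (geom N (i , j))
geom-nonRaising {c} {i} {j} N i≢c = Allₚ.applyUpTo⁺₂ (λ n → 1ℤ , (+ n) · root (i , j)) (suc N) (λ n → begin
  + n ℤ.* (unit i c ℤ.- unit j c)   ≡⟨ cong (λ x → + n ℤ.* (x ℤ.- unit j c)) (unit-diff i≢c) ⟩
  + n ℤ.* (0ℤ ℤ.- unit j c)         ≡⟨ cong (+ n ℤ.*_) (ℤₚ.+-identityˡ (ℤ.- unit j c)) ⟩
  + n ℤ.* (ℤ.- unit j c)            ≤⟨ ℤₚ.*-monoˡ-≤-nonNeg (+ n) (ℤₚ.neg-mono-≤ (unit-nonneg j c)) ⟩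
  + n ℤ.* 0ℤ                        ≡⟨ ℤₚ.*-zeroʳ (+ n) ⟩
  0ℤ ∎)
  where open ℤₚ.≤-Reasoning

-- Only a root in row c could raise coordinate c; without one, a negative entry stays negative until
-- `G` is evaluated.
katalan-vanishesBelow : ∀ {c N G Φ Ψ} → All (λ β → proj₁ β ≢ c) Ψ → VanishesBelow c G →
  VanishesBelow c (katalan N G Φ Ψ)
katalan-vanishesBelow {c} {N} {Φ = Φ} Ψ≢c = prod-vanishesBelow
  (Allₚ.++⁺ (Allₚ.map⁺ (All.universal (λ β → low-nonRaising c (proj₂ β)) Φ))
            (Allₚ.map⁺ (All.map (λ {β} β≢c → geom-nonRaising {j = proj₂ β} N β≢c) Ψ≢c)))

record Partition (k ℓ : ℕ) : Set where
  field
    part       : ℕ → ℕ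
    decreasing : ∀ i → part (suc i) ≤ part i
    bounded    : ∀ i → part i ≤ k
    finite     : ∀ i → ℓ ≤ i → part i ≡ 0

  antitone : ∀ {i j} → i ≤ j → part j ≤ part i
  antitone i≤j = go (ℕₚ.≤⇒≤′ i≤j)
    where
    go : ∀ {i j} → i ℕ.≤′ j → part j ≤ part i
    go ℕ.≤′-refl       = ℕₚ.≤-refl
    go (ℕ.≤′-step i≤j) = ℕₚ.≤-trans (decreasing _) (go i≤j)

  -- down_λ of the paper, with rows and columns numbered from 0.
  first : ℕ → ℕ
  first i = suc (k ℕ.∸ part i ℕ.+ i)

  above : ∀ i → i < first i
  above i = s≤s (ℕₚ.m≤n+m i _)

  first-mono : ∀ {i j} → i < j → first i < first j
  first-mono {i} {j} i<j = s≤s (ℕₚ.+-mono-≤-< (ℕₚ.∸-monoʳ-≤ k (antitone (ℕₚ.<⇒≤ i<j))) i<j)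

  first-injective : ∀ {i j} → first i ≡ first j → i ≡ j
  first-injective {i} {j} eq with ℕₚ.<-cmp i j
  ... | tri< i<j _ _ = contradiction eq (ℕₚ.<⇒≢ (first-mono i<j))
  ... | tri≈ _ i≡j _ = i≡j
  ... | tri> _ _ i>j = contradiction (sym eq) (ℕₚ.<⇒≢ (first-mono i>j))

  -- A strictly increasing function takes consecutive values only at consecutive arguments.
  first-next : ∀ {i a} → first i ≡ suc (first a) → i ≡ suc a
  first-next {i} {a} eq with ℕₚ.<-cmp i (suc a)
  ... | tri≈ _ i≡ _ = i≡
  ... | tri> _ _ i> = contradiction (ℕₚ.<-≤-trans (s≤s (first-mono {a} ℕₚ.≤-refl)) (first-mono i>))
                                        (ℕₚ.<-irrefl (sym eq))
  ... | tri< (s≤s i≤a) _ _ with ℕₚ.m≤n⇒m<n∨m≡n i≤a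
  ...   | inj₁ i<a  = contradiction eq (ℕₚ.<⇒≢ (ℕₚ.m≤n⇒m≤1+n (first-mono i<a)))
  ...   | inj₂ refl = contradiction (sym eq) ℕₚ.1+n≢n

  flat⇒first-suc : ∀ {a} → part (suc a) ≡ part a → first (suc a) ≡ suc (first a)
  flat⇒first-suc {a} eq = cong suc (trans (cong (λ x → k ℕ.∸ x ℕ.+ suc a) eq) (ℕₚ.+-suc _ a))

  first-suc⇒flat : ∀ {a} → first (suc a) ≡ suc (first a) → part (suc a) ≡ part a
  first-suc⇒flat {a} eq = ℕₚ.∸-cancelˡ-≡ (bounded (suc a)) (bounded a)
    (ℕₚ.+-cancelʳ-≡ (suc a) _ _ (trans (ℕₚ.suc-injective eq) (sym (ℕₚ.+-suc _ a))))

  weight : Weight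
  weight i = + part i

sumℕ : (ℕ → ℕ) → ℕ → ℕ
sumℕ f zero    = 0
sumℕ f (suc n) = f 0 ℕ.+ sumℕ (λ i → f (suc i)) n

-- L(Δ^k(λ)) ∖ {down(x) : x > z} (rows x numbered from 1) is the multiset of columns of the roots (i , j)
-- with marks z d i ≤ j.
marks : ℕ → (ℕ → ℕ) → ℕ → ℕ
marks z d i with i ℕ.<? z
... | yes _ = d i
... | no  _ = suc (d i)

marks-< : ∀ {z d i} → i < z → marks z d i ≡ d i
marks-< {z} {d} {i} i<z with i ℕ.<? z
... | yes _  = refl
... | no i≮z = contradiction i<z i≮z

marks-≥ : ∀ {z d i} → z ≤ i → marks z d i ≡ suc (d i)
marks-≥ {z} {d} {i} z≤i with i ℕ.<? z
... | yes i<z = contradiction z≤i (ℕₚ.<⇒≱ i<z)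
... | no _    = refl

-- The two multisets differ by the single column `d z`, which is the source of the subtraction in
-- the induction on z.
marks-next : ∀ z d → RemovesFrom (marks (suc z) d) z (d z) (marks z d)
marks-next z d = removes (marks-< {suc z} {d} (ℕₚ.n<1+n z)) (marks-≥ {z} {d} ℕₚ.≤-refl) other
  where
  other : ∀ a → a ≢ z → marks z d a ≡ marks (suc z) d a
  other a a≢z with ℕₚ.<-cmp a z
  ... | tri< a<z _ _ = trans (marks-< a<z) (sym (marks-< (ℕₚ.m≤n⇒m≤1+n a<z)))
  ... | tri≈ _ a≡z _ = contradiction a≡z a≢z
  ... | tri> _ _ a>z = trans (marks-≥ (ℕₚ.<⇒≤ a>z)) (sym (marks-≥ a>z))

-- From row z on, marks start one column to the right of the roots, so losing the root in column j
-- means losing the mark in column j + 1.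
marks-removes : ∀ {z d d′ c j} → z ≤ c → RemovesFrom d c j d′ →
  RemovesFrom (marks z d) c (suc j) (marks z d′)
marks-removes {z} {d} {d′} {c} z≤c (removes before after other) =
  removes (trans (marks-≥ z≤c) (cong suc before)) (trans (marks-≥ z≤c) (cong suc after)) other′
  where
  other′ : ∀ a → a ≢ c → marks z d′ a ≡ marks z d a
  other′ a a≢c with a ℕ.<? z
  ... | yes _ = other a a≢c
  ... | no _  = cong suc (other a a≢c)

-- The down-orbit of z: the defect -ε_c moves forward along it when roots are split off, and
-- `mirror` walks it back.
data Orbit (d : ℕ → ℕ) (z : ℕ) : ℕ → Set where
  start : Orbit d z z
  step  : ∀ {a} → Orbit d z a → Orbit d z (d a)

orbit-≥ : ∀ {d z a} → (∀ i → i < d i) → Orbit d z a → z ≤ a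
orbit-≥ i<d start    = ℕₚ.≤-refl
orbit-≥ i<d (step o) = ℕₚ.≤-trans (orbit-≥ i<d o) (ℕₚ.<⇒≤ (i<d _))

-- Every step strictly increases the index, so a point a ≤ c is reached using only the starts of
-- rows before c.
orbit-transport : ∀ {d d′ z a c} → (∀ i → i < d i) → (∀ i → i < c → d′ i ≡ d i) →
  Orbit d z a → a ≤ c → Orbit d′ z a
orbit-transport i<d agree start a≤c = start
orbit-transport {d} {d′} {z} i<d agree (step {a} o) a≤c =
  subst (Orbit d′ z) (agree a a<c) (step (orbit-transport i<d agree o (ℕₚ.<⇒≤ a<c)))
  where a<c = ℕₚ.<-≤-trans (i<d a) a≤c

-- All that the expansion uses about g and the truncation. It is instantiated once for every linear
-- functional and every `N`.
record Environment (ℓ C : ℕ) : Set where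
  open Truncation ℓ C
  field
    N          : ℕ
    G          : Fn
    supported  : Supported G
    reflected  : ∀ c → suc c < ℓ → Antisymmetric c (op (low (suc c)) G) (op (low (suc c)) G)
    vanishing  : ∀ c → suc c ≡ ℓ → VanishesBelow c G

-- The alternating expansion

update : ℕ → ℕ → (ℕ → ℕ) → ℕ → ℕ
update i v d a with a ℕ.≟ i
... | yes _ = v
... | no  _ = d a

update-same : ∀ i v d → update i v d i ≡ v
update-same i v d with i ℕ.≟ i
... | yes _  = refl
... | no i≢i = contradiction refl i≢i

update-other : ∀ i v d {a} → a ≢ i → update i v d a ≡ d a
update-other i v d {a} a≢i with a ℕ.≟ i
... | yes a≡i = contradiction a≡i a≢i
... | no _    = refl

sumℕ-cong : ∀ {f g} n → (∀ i → f i ≡ g i) → sumℕ f n ≡ sumℕ g n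
sumℕ-cong zero    eq = refl
sumℕ-cong (suc n) eq = cong₂ ℕ._+_ (eq 0) (sumℕ-cong n (λ i → eq (suc i)))

sumℕ-removes : ∀ {f g : ℕ → ℕ} {c} n → c < n → f c ≡ suc (g c) → (∀ i → i ≢ c → f i ≡ g i) →
  sumℕ f n ≡ suc (sumℕ g n)
sumℕ-removes {c = zero} (suc n) _ eq other =
  cong₂ ℕ._+_ eq (sumℕ-cong n (λ i → other (suc i) (λ ())))
sumℕ-removes {g = g} {suc c} (suc n) (s≤s c<n) eq other =
  trans (cong₂ ℕ._+_ (other 0 (λ ()))
          (sumℕ-removes n c<n eq (λ i i≢c → other (suc i) (λ e → i≢c (ℕₚ.suc-injective e)))))
        (ℕₚ.+-suc (g 0) _)

signZ-involutive : ∀ n → signZ (suc (suc n)) ≡ signZ n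
signZ-involutive n = ℤₚ.neg-involutive (signZ n)

signZ-double : ∀ n → signZ (n ℕ.+ n) ≡ 1ℤ
signZ-double zero    = refl
signZ-double (suc n) rewrite ℕₚ.+-suc n n = trans (signZ-involutive (n ℕ.+ n)) (signZ-double n)

module Alternation (k ℓ C : ℕ) where

  open Truncation ℓ C
  open Partition
  open Environment

  degree : Partition k ℓ → ℕ
  degree p = sumℕ (part p) ℓ

  value : Environment ℓ C → (ℕ → ℕ) → (ℕ → ℕ) → Weight → ℤ
  value env e d γ = ap (katalan (N env) (G env) (roots ℓ e) (roots ℓ d)) γ

  -- Up to truncation, weighted p z is 𝔤^{(k)}_{λ,z+1}; for z = 0 it is the K-k-Schur function g^{(k)}_λ.
  weighted : Partition k ℓ → ℕ → Environment ℓ C → ℤ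
  weighted p z env = value env (marks z (first p)) (first p) (weight p)

  lowered : Partition k ℓ → ℕ → ℕ → Environment ℓ C → ℤ
  lowered p z c env = value env (marks z (first p)) (first p) (weight p ∔ -ε c)

  combination : ℕ → List (Partition k ℓ) → Environment ℓ C → ℤ
  combination s []       env = 0ℤ
  combination s (p ∷ ps) env = signZ (s ℕ.+ degree p) ℤ.* weighted p 0 env ℤ.+ combination s ps env

  combination-++ : ∀ s ps qs env →
    combination s (ps ++ qs) env ≡ combination s ps env ℤ.+ combination s qs env
  combination-++ s []       qs env = sym (ℤₚ.+-identityˡ _)
  combination-++ s (p ∷ ps) qs env =
    trans (cong (λ x → signZ (s ℕ.+ degree p) ℤ.* weighted p 0 env ℤ.+ x) (combination-++ s ps qs env))
          (sym (ℤₚ.+-assoc (signZ (s ℕ.+ degree p) ℤ.* weighted p 0 env) _ _))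

  combination-suc : ∀ s ps env → combination (suc s) ps env ≡ ℤ.- combination s ps env
  combination-suc s []       env = refl
  combination-suc s (p ∷ ps) env =
    trans (cong (λ x → signZ (suc s ℕ.+ degree p) ℤ.* weighted p 0 env ℤ.+ x) (combination-suc s ps env))
          (lemma (signZ (s ℕ.+ degree p)) (weighted p 0 env) (combination s ps env))
    where
    lemma : ∀ x y z → (ℤ.- x) ℤ.* y ℤ.+ ℤ.- z ≡ ℤ.- (x ℤ.* y ℤ.+ z)
    lemma = solve-∀

  module _ (B : ℕ) where

    -- Multiplicities are repetitions in the list, so nonnegativity up to sign is built in and only
    -- the parity of `s` has to be followed. The list comes before `env`, hence is uniform in it.
    Alternating : ℕ → (Environment ℓ C → ℤ) → Set
    Alternating s X = Σ (List (Partition k ℓ)) λ ps → ∀ env → B ≤ N env → X env ≡ combination s ps env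

    alternating-cong : ∀ {s X Y} → (∀ env → B ≤ N env → Y env ≡ X env) → Alternating s X → Alternating s Y
    alternating-cong eq (ps , X≡) = ps , λ env B≤N → trans (eq env B≤N) (X≡ env B≤N)

    alternating-0 : ∀ {s} → Alternating s (λ _ → 0ℤ)
    alternating-0 = [] , λ _ _ → refl

    alternating-+ : ∀ {s X Y} → Alternating s X → Alternating s Y → Alternating s (λ env → X env ℤ.+ Y env)
    alternating-+ {s} (ps , X≡) (qs , Y≡) =
      ps ++ qs , λ env B≤N → trans (cong₂ ℤ._+_ (X≡ env B≤N) (Y≡ env B≤N)) (sym (combination-++ s ps qs env))

    alternating-neg : ∀ {s X} → Alternating s X → Alternating (suc s) (λ env → ℤ.- X env)
    alternating-neg {s} (ps , X≡) =
      ps , λ env B≤N → trans (cong ℤ.-_ (X≡ env B≤N)) (sym (combination-suc s ps env))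

    alternating-2+ : ∀ {s X} → Alternating s X → Alternating (suc (suc s)) X
    alternating-2+ {s} {X} alt =
      alternating-cong (λ env _ → sym (ℤₚ.neg-involutive (X env))) (alternating-neg (alternating-neg alt))

    alternating-weighted-0 : ∀ p → Alternating (degree p) (weighted p 0)
    alternating-weighted-0 p = p ∷ [] , λ env _ →
      sym (trans (ℤₚ.+-identityʳ _)
                 (trans (cong (ℤ._* weighted p 0 env) (signZ-double (degree p))) (ℤₚ.*-identityˡ _)))

    Bounded : Weight → Set
    Bounded γ = ht γ ℤ.+ + C ℤ.≤ + B

    bounded-∔ : ∀ {γ δ} → ht δ ℤ.≤ 0ℤ → Bounded γ → Bounded (γ ∔ δ)
    bounded-∔ {γ} {δ} δ≤0 γ≤B = begin
      ht (γ ∔ δ) ℤ.+ + C         ≡⟨ cong (ℤ._+ + C) (ht-∔ γ δ) ⟩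
      ht γ ℤ.+ ht δ ℤ.+ + C      ≤⟨ ℤₚ.+-monoˡ-≤ (+ C) (ℤₚ.+-monoʳ-≤ (ht γ) δ≤0) ⟩
      ht γ ℤ.+ 0ℤ ℤ.+ + C        ≡⟨ cong (ℤ._+ + C) (ℤₚ.+-identityʳ (ht γ)) ⟩
      ht γ ℤ.+ + C               ≤⟨ γ≤B ⟩
      + B ∎
      where open ℤₚ.≤-Reasoning

    bounded--ε : ∀ {γ c} → c < ℓ → Bounded γ → Bounded (γ ∔ -ε c)
    bounded--ε {γ} {c} c<ℓ =
      bounded-∔ {γ} { -ε c} (ℤₚ.≤-trans (ℤₚ.≤-reflexive (ht--ε c<ℓ)) (ℤₚ.neg-mono-≤ (ℤ.+≤+ z≤n)))

    bounded-root : ∀ {γ β} → Positive ℓ β → Bounded γ → Bounded (γ ∔ root β)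
    bounded-root {γ} {β@(i , j)} (i<j , j<ℓ) =
      bounded-∔ {γ} {root β} (ℤₚ.≤-trans (ℤₚ.≤-reflexive (ht-root (ℕₚ.<-trans i<j j<ℓ) j<ℓ))
                             (ℤₚ.i≤j⇒i-j≤0 (ℤ.+≤+ (ℕₚ.<⇒≤ i<j))))

    bounded-cong : ∀ {γ δ} → γ ≗ δ → Bounded γ → Bounded δ
    bounded-cong γ≗δ = subst (λ h → h ℤ.+ + C ℤ.≤ + B) (sumTo-cong ℓ (λ i _ → cong (+ i ℤ.*_) (γ≗δ i)))

    value-raise : ∀ env {e d d′ i j γ} → B ≤ N env → Bounded γ → RemovesFrom d i j d′ →
      (∀ a → a < d′ a) → i < j → j < ℓ →
      value env e d γ ≡ value env e d′ γ ℤ.+ value env e d (γ ∔ root (i , j))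
    value-raise env {e} {d} {d′} {i} {j} {γ} B≤N γ≤B rem pos i<j j<ℓ = begin
      value env e d γ
        ≡⟨ katalan-↭ (N env) (G env) {roots ℓ e} Perm.refl d↭ γ ⟩
      ap (katalan (N env) (G env) (roots ℓ e) ((i , j) ∷ roots ℓ d′)) γ
        ≡⟨ katalan-raise {N env} {G env} {i , j} {roots ℓ e} {roots ℓ d′} {γ} (supported env)
             (roots-column ℓ e) (roots-positive ℓ pos) (i<j , j<ℓ)
             (ℤₚ.≤-trans γ≤B (ℤ.+≤+ B≤N)) ⟩
      value env e d′ γ ℤ.+ ap (katalan (N env) (G env) (roots ℓ e) ((i , j) ∷ roots ℓ d′)) (γ ∔ root (i , j))
        ≡⟨ cong (ℤ._+_ (value env e d′ γ)) (sym (katalan-↭ (N env) (G env) {roots ℓ e} Perm.refl d↭ (γ ∔ root (i , j)))) ⟩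
      value env e d′ γ ℤ.+ value env e d (γ ∔ root (i , j)) ∎
      where
      open ≡-Reasoning
      d↭ = roots-remove rem (ℕₚ.<-trans i<j j<ℓ) j<ℓ

    value-raise-outside : ∀ env {e d d′ i j} γ → RemovesFrom d i j d′ → ℓ ≤ j →
      value env e d γ ≡ value env e d′ γ
    value-raise-outside env {e} γ rem ℓ≤j = katalan-↭ (N env) (G env) {roots ℓ e} Perm.refl (roots-remove-outside rem ℓ≤j) γ

    value-lower : ∀ env {e e′ d i j} γ → RemovesFrom e i j e′ → i < ℓ → j < ℓ →
      value env e d γ ≡ value env e′ d γ ℤ.- value env e′ d (γ ∔ -ε j)
    value-lower env {e} {e′} {d} {i} {j} γ rem i<ℓ j<ℓ =
      trans (katalan-↭ (N env) (G env) (roots-remove rem i<ℓ j<ℓ) Perm.refl γ)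
            (katalan-lower (N env) (G env) (i , j) (roots ℓ e′) (roots ℓ d) γ)

    value-lower-outside : ∀ env {e e′ d i j} γ → RemovesFrom e i j e′ → ℓ ≤ j →
      value env e d γ ≡ value env e′ d γ
    value-lower-outside env γ rem ℓ≤j = katalan-↭ (N env) (G env) (roots-remove-outside rem ℓ≤j) Perm.refl γ

    -- The hypothesis of the theorem for z + 1, with rows counted from 0. The exception z + 1 = b_λ
    -- is phrased as row z + 1 having no roots, a condition that survives the removal of cells.
    record Strict (p : Partition k ℓ) (z : ℕ) : Set where
      field
        strict : ∀ i → i < z → part p (suc i) < part p i
        last   : part p (suc z) < part p z ⊎ ℓ ≤ first p (suc z)
    open Strict

    module _ (p : Partition k ℓ) {z : ℕ} (p-strict : Strict p z) (env : Environment ℓ C) (B≤N : B ≤ N env) where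

      -- A row i < z keeps its start, which could be `suc (first p a)` only for i = a + 1 > z; from
      -- z on all starts are shifted alike and `first` is injective.
      no-mark : ∀ {a} → z ≤ a → ∀ i → i ≢ a → marks z (first p) i ≢ suc (first p a)
      no-mark {a} z≤a i i≢a eq with i ℕ.<? z
      ... | yes i<z = contradiction (subst (_< z) (first-next p eq) i<z) (ℕₚ.≤⇒≯ (ℕₚ.m≤n⇒m≤1+n z≤a))
      ... | no _    = i≢a (first-injective p (ℕₚ.suc-injective eq))

      -- Either columns c, c + 1 look alike and reflection symmetry applies, or rows a, a + 1 are the
      -- mirror image of rows c, c + 1.  In the latter case adding the root (a + 1, c) makes
      -- the columns alike, at the cost of a term in which the defect has moved up to rows a, a + 1.
      mirror : ∀ {a} → Orbit (first p) z a → (d : ℕ → ℕ) (γ : Weight) → let c = first p a in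
        suc c < ℓ → (∀ i → i < c → d i ≡ first p i) → d c ≡ d (suc c) → suc c < d c → (∀ i → i < d i) →
        (∀ i → i < c → γ i ≡ weight p i) → γ (suc c) ≡ γ c ℤ.+ 1ℤ → Bounded γ →
        value env (marks z (first p)) d γ ≡ 0ℤ
      mirror {a} o d γ c<ℓ d-agree wall c<d pos γ-agree γ-eq γ≤B = go o (first p (suc a) ℕ.≟ suc c)
        where
        c = first p a
        z≤a = orbit-≥ (above p) o
        a<ℓ = ℕₚ.<-trans (above p a) (ℕₚ.<-trans (ℕₚ.n<1+n c) c<ℓ)

        vanishes : ∀ d′ → d′ c ≡ d′ (suc c) → (∀ i → d′ i ≢ suc c) → value env (marks z (first p)) d′ γ ≡ 0ℤ
        vanishes d′ wall′ ceiling = katalan-vanishes {γ = γ} (reflected env c c<ℓ) c<ℓ a<ℓ wall′ ceiling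
          (marks-≥ z≤a) (no-mark z≤a) γ-eq

        -- Rows before c still have the starts of λ, rows c and c + 1 start beyond column c + 1, and
        -- later rows start past their own index; this leaves only row a + 1.
        ceiling-at : ∀ i → i ≢ suc a → d i ≢ suc c
        ceiling-at i i≢ eq with ℕₚ.<-cmp i c
        ... | tri< i<c _ _  = i≢ (first-next p (trans (sym (d-agree i i<c)) eq))
        ... | tri≈ _ refl _ = contradiction (sym eq) (ℕₚ.<⇒≢ c<d)
        ... | tri> _ _ c<i with ℕₚ.m≤n⇒m<n∨m≡n c<i
        ...   | inj₁ sc<i = contradiction (sym eq) (ℕₚ.<⇒≢ (ℕₚ.<-trans sc<i (pos i)))
        ...   | inj₂ refl = contradiction (trans (sym eq) (sym wall)) (ℕₚ.<⇒≢ c<d)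

        go : Orbit (first p) z a → Dec (first p (suc a) ≡ suc c) → value env (marks z (first p)) d γ ≡ 0ℤ
        go o (no ≢sc) = vanishes d wall (λ i eq → ceiling i eq (i ℕ.≟ suc a))
          where
          ceiling : ∀ i → d i ≡ suc c → Dec (i ≡ suc a) → ⊥
          ceiling i eq (no i≢)    = ceiling-at i i≢ eq
          ceiling i eq (yes refl) with ℕₚ.m≤n⇒m<n∨m≡n (above p a)
          ... | inj₁ sa<c = ≢sc (trans (sym (d-agree (suc a) sa<c)) eq)
          ... | inj₂ sa≡c = contradiction (trans (sym eq) (cong d sa≡c)) (ℕₚ.<⇒≢ c<d)
        -- Here the hypothesis on z enters: either λ_z = λ_{z+1} is excluded, or row z + 1 starts
        -- outside and cannot start in column c + 1.
        go start (yes ≡sc) with last p-strict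
        ... | inj₁ λ<   = contradiction (first-suc⇒flat p ≡sc) (ℕₚ.<⇒≢ λ<)
        ... | inj₂ ℓ≤d  = contradiction (subst (_< ℓ) (sym ≡sc) c<ℓ) (ℕₚ.≤⇒≯ ℓ≤d)
        go (step {a′} o′) (yes ≡sc) = begin
          value env E d γ
            ≡⟨ sym (ℤₚ.+-identityʳ _) ⟩
          value env E d γ ℤ.+ 0ℤ
            ≡⟨ cong (ℤ._+_ (value env E d γ)) (sym moved) ⟩
          value env E d γ ℤ.+ value env E d″ (γ ∔ root (suc a , c))
            ≡⟨ sym (value-raise env B≤N γ≤B removal pos sa<c (ℕₚ.<-trans (ℕₚ.n<1+n c) c<ℓ)) ⟩
          value env E d″ γ
            ≡⟨ vanishes d″ wall″ ceiling″ ⟩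
          0ℤ ∎
          where
          open ≡-Reasoning
          E = marks z (first p)
          flat = first-suc⇒flat p ≡sc
          z<a : z < a
          z<a = ℕₚ.≤-<-trans (orbit-≥ (above p) o′) (above p a′)
          -- This puts column c strictly beyond a + 1, so that (a + 1 , c) is a positive root.
          part<k : part p a < k
          part<k with last p-strict
          ... | inj₁ λ<  = ℕₚ.≤-<-trans (antitone p z<a) (ℕₚ.<-≤-trans λ< (bounded p z))
          ... | inj₂ ℓ≤d with ℕₚ.m≤n⇒m<n∨m≡n z<a
          ...   | inj₁ sz<a = contradiction (ℕₚ.≤-trans ℓ≤d (ℕₚ.<⇒≤ (first-mono p sz<a)))
                                            (ℕₚ.<⇒≱ (ℕₚ.<-trans (ℕₚ.n<1+n c) c<ℓ))
          ...   | inj₂ sz≡a = contradiction (ℕₚ.≤-trans ℓ≤d (ℕₚ.≤-reflexive (cong (first p) sz≡a)))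
                                            (ℕₚ.<⇒≱ (ℕₚ.<-trans (ℕₚ.n<1+n c) c<ℓ))
          sa<c : suc a < c
          sa<c = s≤s (ℕₚ.+-monoˡ-≤ a (ℕₚ.m<n⇒0<n∸m part<k))
          d″ = update (suc a) c d
          removal : RemovesFrom d″ (suc a) c d
          removal = removes (update-same (suc a) c d) (trans (d-agree (suc a) sa<c) ≡sc)
                            (λ i i≢ → sym (update-other (suc a) c d i≢))
          wall″ : d″ c ≡ d″ (suc c)
          wall″ = trans (update-other (suc a) c d (λ eq → ℕₚ.<⇒≢ sa<c (sym eq)))
                        (trans wall (sym (update-other (suc a) c d
                          (λ eq → ℕₚ.<⇒≢ (above p a) (sym (ℕₚ.suc-injective eq))))))
          ceiling″ : ∀ i → d″ i ≢ suc c
          ceiling″ i eq with i ℕ.≟ suc a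
          ... | yes _ = ℕₚ.1+n≢n (sym eq)
          ... | no i≢ = ceiling-at i i≢ eq
          pos″ : ∀ i → i < d″ i
          pos″ i with i ℕ.≟ suc a
          ... | yes refl = sa<c
          ... | no _     = pos i
          off : ∀ i → i < suc a → root (suc a , c) i ≡ 0ℤ
          off i i<sa = cong₂ ℤ._-_ (unit-diff (λ eq → ℕₚ.<⇒≢ i<sa (sym eq)))
                                   (unit-diff (λ eq → ℕₚ.<⇒≢ (ℕₚ.<-trans i<sa sa<c) (sym eq)))
          on : root (suc a , c) (suc a) ≡ 1ℤ
          on = cong₂ ℤ._-_ (unit-same (suc a)) (unit-diff (λ eq → ℕₚ.<⇒≢ sa<c (sym eq)))
          moved-agree : ∀ i → i < suc a → (γ ∔ root (suc a , c)) i ≡ weight p i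
          moved-agree i i<sa = trans (cong₂ ℤ._+_ (γ-agree i (ℕₚ.<-trans i<sa sa<c)) (off i i<sa))
                                     (ℤₚ.+-identityʳ _)
          -- As λ_a = λ_{a+1}, the added root leaves an excess of one in row a + 1, and rows a and a
          -- + 1 both start in column c: the same situation one step earlier on the orbit.
          moved : value env E d″ (γ ∔ root (suc a , c)) ≡ 0ℤ
          moved = mirror o′ d″ (γ ∔ root (suc a , c)) (ℕₚ.<-trans sa<c (ℕₚ.<-trans (ℕₚ.n<1+n c) c<ℓ))
            (λ i i<a → trans (update-other (suc a) c d (ℕₚ.<⇒≢ (ℕₚ.m≤n⇒m≤1+n i<a)))
                             (d-agree i (ℕₚ.<-trans i<a (above p a))))
            d″-wall
            (subst (suc a <_) (sym d″-a) sa<c)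
            pos″
            (λ i i<a → moved-agree i (ℕₚ.m≤n⇒m≤1+n i<a))
            (trans (cong₂ ℤ._+_ (γ-agree (suc a) sa<c) on)
                   (trans (cong (λ x → + x ℤ.+ 1ℤ) flat)
                          (cong (ℤ._+ 1ℤ) (sym (moved-agree a (ℕₚ.n<1+n a))))))
            (bounded-root (sa<c , ℕₚ.<-trans (ℕₚ.n<1+n c) c<ℓ) γ≤B)
            where
            d″-a : d″ a ≡ c
            d″-a = trans (update-other (suc a) c d (ℕₚ.<⇒≢ (ℕₚ.n<1+n a))) (d-agree a (above p a))
            d″-wall : d″ a ≡ d″ (suc a)
            d″-wall = trans d″-a (sym (update-same (suc a) c d))

    -- Removing a cell from a partition

    module _ (p : Partition k ℓ) (c : ℕ) (drop : part p (suc c) < part p c) where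

      pred-part : suc (ℕ.pred (part p c)) ≡ part p c
      pred-part = ℕₚ.suc-pred (part p c) {{ℕ.>-nonZero (ℕₚ.≤-<-trans z≤n drop)}}

      private
        part′ = update c (ℕ.pred (part p c)) (part p)

        part′-c : part′ c ≡ ℕ.pred (part p c)
        part′-c = update-same c _ (part p)

        part′≤part : ∀ i → part′ i ≤ part p i
        part′≤part i with i ℕ.≟ c
        ... | yes refl = ℕₚ.pred[n]≤n
        ... | no _     = ℕₚ.≤-refl

      removeCell : Partition k ℓ
      removeCell = record
        { part       = part′
        ; decreasing = decreasing′
        ; bounded    = λ i → ℕₚ.≤-trans (part′≤part i) (bounded p i)
        ; finite     = λ i ℓ≤i → ℕₚ.n≤0⇒n≡0 (subst (part′ i ≤_) (finite p i ℓ≤i) (part′≤part i))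
        }
        where
        decreasing′ : ∀ i → part′ (suc i) ≤ part′ i
        decreasing′ i = helper (i ℕ.≟ c)
          where
          helper : Dec (i ≡ c) → part′ (suc i) ≤ part′ i
          helper (yes refl) = ℕₚ.≤-trans (part′≤part (suc c))
            (ℕ.s≤s⁻¹ (subst (part p (suc c) <_) (sym (trans (cong suc part′-c) pred-part)) drop))
          helper (no i≢c) = ℕₚ.≤-trans (part′≤part (suc i))
            (ℕₚ.≤-trans (decreasing p i) (ℕₚ.≤-reflexive (sym (update-other c _ (part p) i≢c))))

      removeCell-other : ∀ {i} → i ≢ c → part removeCell i ≡ part p i
      removeCell-other i≢c = update-other c _ (part p) i≢c

      removeCell-≤ : ∀ i → part removeCell i ≤ part p i
      removeCell-≤ = part′≤part

      removeCell-degree : c < ℓ → degree p ≡ suc (degree removeCell)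
      removeCell-degree c<ℓ = sumℕ-removes ℓ c<ℓ (sym (trans (cong suc part′-c) pred-part))
                                          (λ i i≢c → sym (removeCell-other i≢c))

      removeCell-weight : weight p ∔ -ε c ≗ weight removeCell
      removeCell-weight i = helper (i ℕ.≟ c)
        where
        helper : Dec (i ≡ c) → (weight p ∔ -ε c) i ≡ weight removeCell i
        helper (no i≢c) = trans (cong (λ x → + part p i ℤ.+ -1ℤ ℤ.* x) (unit-diff (λ c≡i → i≢c (sym c≡i))))
          (trans (ℤₚ.+-identityʳ _) (cong +_ (sym (removeCell-other i≢c))))
        helper (yes refl) rewrite unit-same c | part′-c =
          cong (λ x → + x ℤ.+ -1ℤ) (sym pred-part)

      -- A row with one cell less starts one column later, so the root split off in T is exactly
      -- what separates the root set of λ from that of μ = λ - ε_c.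
      removeCell-removes : RemovesFrom (first p) c (first p c) (first removeCell)
      removeCell-removes = removes refl
        (cong (λ x → suc (x ℕ.+ c))
          (trans (cong (k ℕ.∸_) part′-c)
                 (trans (ℕₚ.+-∸-assoc 1 (subst (_≤ k) (sym pred-part) (bounded p c)))
                        (cong (λ x → suc (k ℕ.∸ x)) pred-part))))
        (λ i i≢c → cong (λ x → suc (k ℕ.∸ x ℕ.+ i)) (removeCell-other i≢c))

    -- Rows up to z are untouched, while row z + 1 can only shrink and then starts later.
    removeCell-strict : ∀ {p z c} (drop : part p (suc c) < part p c) → z < c → Strict p z →
      Strict (removeCell p c drop) z
    removeCell-strict {p} {z} {c} drop z<c p-strict = record
      { strict = λ i i<z → smaller (ℕₚ.<-trans i<z z<c) (strict p-strict i i<z)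
      ; last   = last′ (last p-strict)
      }
      where
      q = removeCell p c drop
      smaller : ∀ {i} → i < c → part p (suc i) < part p i → part q (suc i) < part q i
      smaller {i} i<c λ< = ℕₚ.≤-<-trans (removeCell-≤ p c drop (suc i))
        (subst (part p (suc i) <_) (sym (removeCell-other p c drop (ℕₚ.<⇒≢ i<c))) λ<)
      last′ : part p (suc z) < part p z ⊎ ℓ ≤ first p (suc z) → part q (suc z) < part q z ⊎ ℓ ≤ first q (suc z)
      last′ (inj₁ λ<)  = inj₁ (smaller z<c λ<)
      last′ (inj₂ ℓ≤d) = inj₂ (ℕₚ.≤-trans ℓ≤d
        (s≤s (ℕₚ.+-monoˡ-≤ (suc z) (ℕₚ.∸-monoʳ-≤ k (removeCell-≤ p c drop (suc z))))))

    -- The nested inductions on z, the degree and the column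

    StrictBefore : Partition k ℓ → ℕ → Set
    StrictBefore p zero    = ⊤
    StrictBefore p (suc z) = Strict p z

    -- The exceptional alternative of `last` can concern only the largest z; smaller ones inherit a
    -- genuine descent.
    strict⇒strictBefore : ∀ {p} z → Strict p z → StrictBefore p z
    strict⇒strictBefore zero    p-strict = tt
    strict⇒strictBefore (suc z) p-strict = record
      { strict = λ i i<z → strict p-strict i (ℕₚ.m≤n⇒m≤1+n i<z)
      ; last   = inj₁ (strict p-strict z (ℕₚ.n<1+n z))
      }

    WeightedAlternating : ℕ → Set
    WeightedAlternating z = ∀ p → StrictBefore p z → Bounded (weight p) → Alternating (degree p) (weighted p z)

    -- Splitting off the first root of row c trades -ε_c for -ε_{down(c)}. The remaining row starts
    -- are a parameter: they come from a smaller partition if λ_c > λ_{c+1}, and from `bump`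
    -- otherwise.
    lowered-peel : ∀ p z {c d′} → let d = first p in c < ℓ → Bounded (weight p) →
      RemovesFrom d c (d c) d′ → (∀ i → i < d′ i) →
      Alternating (suc (degree p)) (λ env → value env (marks z d) d′ (weight p ∔ -ε c)) →
      (d c < ℓ → Alternating (suc (degree p)) (lowered p z (d c))) →
      Alternating (suc (degree p)) (lowered p z c)
    lowered-peel p z {c} {d′} c<ℓ p≤B removal pos alt-here alt-next with first p c ℕ.<? ℓ
    ... | no d≮ℓ = alternating-cong
      (λ env _ → value-raise-outside env {marks z (first p)} (weight p ∔ -ε c) removal (ℕₚ.≮⇒≥ d≮ℓ)) alt-here
    ... | yes d<ℓ = alternating-cong
      (λ env B≤N → trans
        (value-raise env {marks z (first p)} {γ = weight p ∔ -ε c} B≤N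
          (bounded--ε {weight p} c<ℓ p≤B) removal pos (above p c) d<ℓ)
        (cong (ℤ._+_ (value env (marks z (first p)) d′ (weight p ∔ -ε c)))
          (ext (katalan (N env) (G env) (roots ℓ (marks z (first p))) (roots ℓ (first p)))
            (λ a → telescope (weight p a) (unit c a) (unit (first p c) a)))))
      (alternating-+ alt-here (alt-next d<ℓ))
      where
      telescope : ∀ x u v → (x ℤ.+ -1ℤ ℤ.* u) ℤ.+ (u ℤ.- v) ≡ x ℤ.+ -1ℤ ℤ.* v
      telescope = solve-∀

    -- n bounds the degree and m the distance from c = first p a to ℓ.
    lowered-alternating : ∀ {z} → WeightedAlternating z → ∀ n m p {a} → Strict p z → Orbit (first p) z a →
      degree p ≤ n → ℓ ≤ m ℕ.+ first p a → first p a < ℓ → Bounded (weight p) →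
      Alternating (suc (degree p)) (lowered p z (first p a))
    lowered-alternating ih n zero p p-strict o degree≤n ℓ≤c c<ℓ p≤B = contradiction ℓ≤c (ℕₚ.<⇒≱ c<ℓ)
    lowered-alternating {z} ih n (suc m) p {a} p-strict o degree≤n ℓ≤ c<ℓ p≤B =
      split (part p (suc c) ℕ.<? part p c) (suc c ℕ.<? ℓ)
      where
      c = first p a
      z<c : z < c
      z<c = ℕₚ.≤-<-trans (orbit-≥ (above p) o) (above p a)

      next : first p c < ℓ → Alternating (suc (degree p)) (lowered p z (first p c))
      next d<ℓ = lowered-alternating ih n m p p-strict (step o) degree≤n
        (ℕₚ.≤-trans ℓ≤ (ℕₚ.≤-trans (ℕₚ.≤-reflexive (sym (ℕₚ.+-suc m c))) (ℕₚ.+-monoʳ-≤ m (above p c)))) d<ℓ p≤B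

      split : Dec (part p (suc c) < part p c) → Dec (suc c < ℓ) → Alternating (suc (degree p)) (lowered p z c)
      split (yes drop) _ = lowered-peel p z c<ℓ p≤B (removeCell-removes p c drop) (above q) here′ next
        where
        q = removeCell p c drop
        degree-eq = removeCell-degree p c drop c<ℓ
        q-strict = removeCell-strict drop z<c p-strict
        q≤B : Bounded (weight q)
        q≤B = bounded-cong (removeCell-weight p c drop) (bounded--ε {weight p} c<ℓ p≤B)
        marks-removal : RemovesFrom (marks z (first p)) c (suc (first p c)) (marks z (first q))
        marks-removal = marks-removes (ℕₚ.<⇒≤ z<c) (removeCell-removes p c drop)
        first-q-c : first q c ≡ suc (first p c)
        first-q-c = RemovesFrom.after (removeCell-removes p c drop)
        reweigh : ∀ env → value env (marks z (first p)) (first q) (weight p ∔ -ε c)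
                        ≡ value env (marks z (first p)) (first q) (weight q)
        reweigh env = ext (katalan (N env) (G env) (roots ℓ (marks z (first p))) (roots ℓ (first q)))
                          (removeCell-weight p c drop)
        -- With |μ| = |λ| - 1 the target index is |μ| + 2, of the same parity as |μ|; the other term
        -- has index |μ| + 1 before its negation.
        weighted-q : Alternating (suc (degree p)) (weighted q z)
        weighted-q = subst (λ s → Alternating (suc s) (weighted q z)) (sym degree-eq)
          (alternating-2+ (ih q (strict⇒strictBefore z q-strict) q≤B))
        lowered-q : ∀ n → degree p ≤ n → first q c < ℓ →
          Alternating (suc (degree p)) (λ env → ℤ.- lowered q z (first q c) env)
        lowered-q zero     degree≤0 _ = contradiction (subst (_≤ 0) degree-eq degree≤0) (λ ())
        lowered-q (suc n′) degree≤n d<ℓ =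
          subst (λ s → Alternating (suc s) (λ env → ℤ.- lowered q z (first q c) env)) (sym degree-eq)
            -- The degree bound has dropped, so the bound on the distance may be reset to ℓ.
            (alternating-neg (lowered-alternating ih n′ ℓ q q-strict
              (orbit-transport (above p) (λ i i<c → RemovesFrom.other (removeCell-removes p c drop) i (ℕₚ.<⇒≢ i<c))
                               (step o) ℕₚ.≤-refl)
              (ℕ.s≤s⁻¹ (subst (_≤ suc n′) degree-eq degree≤n)) (ℕₚ.m≤m+n ℓ _) d<ℓ q≤B))
        here′ : Alternating (suc (degree p)) (λ env → value env (marks z (first p)) (first q) (weight p ∔ -ε c))
        here′ with first q c ℕ.<? ℓ
        ... | no d≮ℓ = alternating-cong
          (λ env _ → trans (reweigh env)
            (value-lower-outside env (weight q) marks-removal (subst (ℓ ≤_) first-q-c (ℕₚ.≮⇒≥ d≮ℓ))))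
          weighted-q
        ... | yes d<ℓ = alternating-cong
          (λ env _ → trans (reweigh env)
            (subst (λ j → value env (marks z (first p)) (first q) (weight q)
                        ≡ weighted q z env ℤ.- lowered q z j env) (sym first-q-c)
              (value-lower env (weight q) marks-removal c<ℓ (subst (_< ℓ) first-q-c d<ℓ))))
          (alternating-+ weighted-q (lowered-q n degree≤n d<ℓ))
      -- Delaying row c by one column makes rows c and c + 1 equally long, and the weight λ - ε_c is
      -- fixed by the reflection; this is the input of `mirror`.
      split (no flat) (yes sc<ℓ) =
        lowered-peel p z c<ℓ p≤B (bump-removes c (first p)) pos′
          (alternating-cong (λ env B≤N → mirror p p-strict env B≤N o d′ (weight p ∔ -ε c) sc<ℓ agree wall
              (subst (suc c <_) (sym (trans wall d′-sc)) (above p (suc c))) pos′ weight-agree weight-eq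
              (bounded--ε {weight p} c<ℓ p≤B))
            alternating-0)
          next
        where
        d′ = bump c (first p)
        removal = bump-removes c (first p)
        part-eq : part p (suc c) ≡ part p c
        part-eq = ℕₚ.≤-antisym (decreasing p c) (ℕₚ.≮⇒≥ flat)
        agree : ∀ i → i < c → d′ i ≡ first p i
        agree i i<c = RemovesFrom.other removal i (ℕₚ.<⇒≢ i<c)
        d′-sc : d′ (suc c) ≡ first p (suc c)
        d′-sc = RemovesFrom.other removal (suc c) ℕₚ.1+n≢n
        wall : d′ c ≡ d′ (suc c)
        wall = trans (RemovesFrom.after removal) (trans (sym (flat⇒first-suc p part-eq)) (sym d′-sc))
        pos′ : ∀ i → i < d′ i
        pos′ i with i ℕ.≟ c
        ... | yes _ = ℕₚ.m≤n⇒m≤1+n (above p i)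
        ... | no _  = above p i
        off : ∀ i → c ≢ i → (weight p ∔ -ε c) i ≡ weight p i
        off i c≢i = trans (cong (λ x → + part p i ℤ.+ -1ℤ ℤ.* x) (unit-diff c≢i)) (ℤₚ.+-identityʳ _)
        weight-agree : ∀ i → i < c → (weight p ∔ -ε c) i ≡ weight p i
        weight-agree i i<c = off i (λ eq → ℕₚ.<⇒≢ i<c (sym eq))
        weight-eq : (weight p ∔ -ε c) (suc c) ≡ (weight p ∔ -ε c) c ℤ.+ 1ℤ
        weight-eq = trans (off (suc c) (λ eq → ℕₚ.1+n≢n (sym eq)))
          (trans (cong +_ part-eq)
            (trans (lemma (+ part p c)) (cong (λ x → (+ part p c ℤ.+ -1ℤ ℤ.* x) ℤ.+ 1ℤ) (sym (unit-same c)))))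
          where
          lemma : ∀ x → x ≡ (x ℤ.+ -1ℤ ℤ.* 1ℤ) ℤ.+ 1ℤ
          lemma = solve-∀
      -- Now c is the last row and λ_c = λ_{c+1} = 0, so the weight ends in -1, and the last row
      -- contains no root that could raise it.
      split (no flat) (no sc≮ℓ) = alternating-cong
        (λ env _ → katalan-vanishesBelow {Φ = roots ℓ (marks z (first p))}
          (All.map (λ { (i<j , j<ℓ) refl → ℕₚ.<⇒≱ (ℕₚ.≤-<-trans i<j j<ℓ) (ℕₚ.≮⇒≥ sc≮ℓ) })
                   (roots-positive ℓ (above p)))
          (vanishing env c (ℕₚ.≤-antisym c<ℓ (ℕₚ.≮⇒≥ sc≮ℓ))) (weight p ∔ -ε c) negative)
        alternating-0
        where
        empty : part p c ≡ 0
        empty = ℕₚ.n≤0⇒n≡0 (ℕₚ.≤-trans (ℕₚ.≮⇒≥ flat)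
                                        (ℕₚ.≤-reflexive (finite p (suc c) (ℕₚ.≮⇒≥ sc≮ℓ))))
        negative : (weight p ∔ -ε c) c ℤ.< 0ℤ
        negative rewrite empty | unit-same c = ℤ.-<+

    weighted-alternating : ∀ z → WeightedAlternating z
    weighted-alternating zero    p _        p≤B = alternating-weighted-0 p
    weighted-alternating (suc z) p p-strict p≤B with first p z ℕ.<? ℓ
    ... | no d≮ℓ = alternating-cong
      (λ env _ → value-lower-outside env (weight p) (marks-next z (first p)) (ℕₚ.≮⇒≥ d≮ℓ))
      (weighted-alternating z p (strict⇒strictBefore z p-strict) p≤B)
    ... | yes d<ℓ = alternating-cong
      (λ env _ → value-lower env (weight p) (marks-next z (first p)) (ℕₚ.<-trans (above p z) d<ℓ) d<ℓ)
      (alternating-+ (weighted-alternating z p (strict⇒strictBefore z p-strict) p≤B)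
        (alternating-neg′ (lowered-alternating (weighted-alternating z) (degree p) ℓ p p-strict start
          ℕₚ.≤-refl (ℕₚ.m≤m+n ℓ _) d<ℓ p≤B)))
      where
      alternating-neg′ : ∀ {s X} → Alternating (suc s) X → Alternating s (λ env → ℤ.- X env)
      alternating-neg′ {s} {X} (ps , X≡) = ps , λ env B≤N →
        trans (cong ℤ.-_ (trans (X≡ env B≤N) (combination-suc s ps env))) (ℤₚ.neg-involutive _)

-- Evaluation of symmetric functions and determinants

ev : (Mono → ℤ) → Sym → ℤ
ev φ []            = 0ℤ
ev φ ((m , c) ∷ p) = c ℤ.* φ m ℤ.+ ev φ p

ev-cong : ∀ {φ ψ} → φ ≗ ψ → ∀ p → ev φ p ≡ ev ψ p
ev-cong eq []            = refl
ev-cong eq ((m , c) ∷ p) = cong₂ (λ x y → c ℤ.* x ℤ.+ y) (eq m) (ev-cong eq p)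

ev-++ : ∀ φ p q → ev φ (p ++ q) ≡ ev φ p ℤ.+ ev φ q
ev-++ φ []            q = sym (ℤₚ.+-identityˡ _)
ev-++ φ ((m , c) ∷ p) q = trans (cong (λ x → c ℤ.* φ m ℤ.+ x) (ev-++ φ p q)) (sym (ℤₚ.+-assoc (c ℤ.* φ m) _ _))

ev-scale : ∀ φ c p → ev φ (scaleS c p) ≡ c ℤ.* ev φ p
ev-scale φ c []            = sym (ℤₚ.*-zeroʳ c)
ev-scale φ c ((m , x) ∷ p) =
  trans (cong (λ y → c ℤ.* x ℤ.* φ m ℤ.+ y) (ev-scale φ c p)) (lemma c x (φ m) (ev φ p))
  where
  lemma : ∀ c x y z → c ℤ.* x ℤ.* y ℤ.+ c ℤ.* z ≡ c ℤ.* (x ℤ.* y ℤ.+ z)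
  lemma = solve-∀

ev-sub : ∀ φ ψ p → ev (λ m → φ m ℤ.- ψ m) p ≡ ev φ p ℤ.- ev ψ p
ev-sub φ ψ []            = refl
ev-sub φ ψ ((m , c) ∷ p) =
  trans (cong (λ y → c ℤ.* (φ m ℤ.- ψ m) ℤ.+ y) (ev-sub φ ψ p)) (lemma c (φ m) (ψ m) (ev φ p) (ev ψ p))
  where
  lemma : ∀ c x y u v → c ℤ.* (x ℤ.- y) ℤ.+ (u ℤ.- v) ≡ (c ℤ.* x ℤ.+ u) ℤ.- (c ℤ.* y ℤ.+ v)
  lemma = solve-∀

ev-linear : ∀ c φ ψ p → ev (λ m → c ℤ.* φ m ℤ.+ ψ m) p ≡ c ℤ.* ev φ p ℤ.+ ev ψ p
ev-linear c φ ψ []            = sym (trans (ℤₚ.+-identityʳ _) (ℤₚ.*-zeroʳ c))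
ev-linear c φ ψ ((m , x) ∷ p) =
  trans (cong (λ y → x ℤ.* (c ℤ.* φ m ℤ.+ ψ m) ℤ.+ y) (ev-linear c φ ψ p))
        (lemma c x (φ m) (ψ m) (ev φ p) (ev ψ p))
  where
  lemma : ∀ c x a b u v → x ℤ.* (c ℤ.* a ℤ.+ b) ℤ.+ (c ℤ.* u ℤ.+ v) ≡ c ℤ.* (x ℤ.* a ℤ.+ u) ℤ.+ (x ℤ.* b ℤ.+ v)
  lemma = solve-∀

ev-zero : ∀ p → ev (λ _ → 0ℤ) p ≡ 0ℤ
ev-zero []            = refl
ev-zero ((m , c) ∷ p) = trans (cong₂ ℤ._+_ (ℤₚ.*-zeroʳ c) (ev-zero p)) refl

ev-swap : ∀ (F : Mono → Mono → ℤ) p q → ev (λ a → ev (F a) q) p ≡ ev (λ b → ev (λ a → F a b) p) q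
ev-swap F []            q = sym (ev-zero q)
ev-swap F ((m , c) ∷ p) q =
  trans (cong (λ y → c ℤ.* ev (F m) q ℤ.+ y) (ev-swap F p q))
        (sym (ev-linear c (F m) (λ b → ev (λ a → F a b) p) q))

ev-sumS : ∀ {A : Set} φ (f : A → Sym) (as : List A) →
  ev φ (sumS (map f as)) ≡ foldr (λ a x → ev φ (f a) ℤ.+ x) 0ℤ as
ev-sumS φ f []       = refl
ev-sumS φ f (a ∷ as) = trans (ev-++ φ (f a) _) (cong (ℤ._+_ (ev φ (f a))) (ev-sumS φ f as))

sumTo-applyUpTo : ∀ {A : Set} (g : A → ℤ) (f : ℕ → A) n →
  foldr (λ a x → g a ℤ.+ x) 0ℤ (applyUpTo f n) ≡ sumTo (g ∘ f) n
sumTo-applyUpTo g f zero    = refl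
sumTo-applyUpTo g f (suc n) = cong (ℤ._+_ (g (f 0))) (sumTo-applyUpTo g (f ∘ suc) n)

ev-sumTo : ∀ φ (f : ℕ → Sym) n → ev φ (sumS (map f (upTo n))) ≡ sumTo (λ i → ev φ (f i)) n
ev-sumTo φ f n = trans (ev-sumS φ f (upTo n)) (sumTo-applyUpTo (λ i → ev φ (f i)) (λ i → i) n)

-- Multiplication by x, transposed.
act : Sym → (Mono → ℤ) → Mono → ℤ
act x φ b = ev (λ a → φ (mulMono a b)) x

act-cong : ∀ x {φ ψ} → φ ≗ ψ → act x φ ≗ act x ψ
act-cong x eq b = ev-cong (λ a → eq (mulMono a b)) x

-- The left factor is absorbed into the functional, so determinants over symmetric functions can be
-- handled by integer computations.
ev-*S : ∀ φ p q → ev φ (p *S q) ≡ ev (act p φ) q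
ev-*S φ p q = trans (go p) (ev-swap (λ a b → φ (mulMono a b)) p q)
  where
  row : ∀ m c q → ev φ (map (λ u → mulMono m (proj₁ u) , c ℤ.* proj₂ u) q) ≡ c ℤ.* ev (λ b → φ (mulMono m b)) q
  row m c []            = sym (ℤₚ.*-zeroʳ c)
  row m c ((m′ , x) ∷ q) = trans (cong (λ y → c ℤ.* x ℤ.* φ (mulMono m m′) ℤ.+ y) (row m c q))
                                 (lemma c x (φ (mulMono m m′)) (ev (λ b → φ (mulMono m b)) q))
    where
    lemma : ∀ c x y z → c ℤ.* x ℤ.* y ℤ.+ c ℤ.* z ≡ c ℤ.* (x ℤ.* y ℤ.+ z)
    lemma = solve-∀
  go : ∀ p → ev φ (p *S q) ≡ ev (λ a → ev (λ b → φ (mulMono a b)) q) p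
  go []            = refl
  go ((m , c) ∷ p) = trans (ev-++ φ (map (λ u → mulMono m (proj₁ u) , c ℤ.* proj₂ u) q) (p *S q))
                           (cong₂ ℤ._+_ (row m c q) (go p))

insertM-≤ : ∀ {a x} m → x ≤ a → insertM a (x ∷ m) ≡ a ∷ x ∷ m
insertM-≤ {a} {x} m x≤a with x ℕ.≤? a
... | yes _  = refl
... | no x≰a = contradiction x≤a x≰a

insertM-≰ : ∀ {a x} m → ¬ x ≤ a → insertM a (x ∷ m) ≡ x ∷ insertM a m
insertM-≰ {a} {x} m x≰a with x ℕ.≤? a
... | yes x≤a = contradiction x≤a x≰a
... | no _    = refl

insertM-comm-≤ : ∀ {a b} m → a ≤ b → insertM a (insertM b m) ≡ insertM b (insertM a m)
insertM-comm-≤ {a} {b} m a≤b with ℕₚ.m≤n⇒m<n∨m≡n a≤b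
... | inj₂ refl = refl
insertM-comm-≤ {a} {b} []      a≤b | inj₁ a<b =
  trans (insertM-≰ [] (ℕₚ.<⇒≱ a<b)) (sym (insertM-≤ [] a≤b))
insertM-comm-≤ {a} {b} (x ∷ m) a≤b | inj₁ a<b with x ℕ.≤? a | x ℕ.≤? b
... | yes x≤a | no x≰b = contradiction (ℕₚ.≤-trans x≤a a≤b) x≰b
... | yes x≤a | yes x≤b = trans (insertM-≰ (x ∷ m) (ℕₚ.<⇒≱ a<b))
  (trans (cong (b ∷_) (insertM-≤ m x≤a)) (sym (insertM-≤ (x ∷ m) a≤b)))
... | no x≰a | yes x≤b = trans (insertM-≰ (x ∷ m) (ℕₚ.<⇒≱ a<b))
  (trans (cong (b ∷_) (insertM-≰ m x≰a)) (sym (insertM-≤ (insertM a m) x≤b)))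
... | no x≰a | no x≰b = trans (insertM-≰ (insertM b m) x≰a)
  (trans (cong (x ∷_) (insertM-comm-≤ m a≤b)) (sym (insertM-≰ (insertM a m) x≰b)))

-- This holds for arbitrary lists, so no sortedness invariant accompanies the monomials.
insertM-comm : ∀ a b m → insertM a (insertM b m) ≡ insertM b (insertM a m)
insertM-comm a b m with ℕₚ.≤-total a b
... | inj₁ a≤b = insertM-comm-≤ m a≤b
... | inj₂ b≤a = sym (insertM-comm-≤ m b≤a)

mulMono-insertM : ∀ p a m → mulMono p (insertM a m) ≡ insertM a (mulMono p m)
mulMono-insertM []      a m = refl
mulMono-insertM (b ∷ p) a m =
  trans (cong (insertM b) (mulMono-insertM p a m)) (insertM-comm b a (mulMono p m))

mulMono-comm : ∀ p q m → mulMono p (mulMono q m) ≡ mulMono q (mulMono p m)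
mulMono-comm p []      m = refl
mulMono-comm p (a ∷ q) m =
  trans (mulMono-insertM p a (mulMono q m)) (cong (insertM a) (mulMono-comm p q m))

act-comm : ∀ x y φ → act x (act y φ) ≗ act y (act x φ)
act-comm x y φ b =
  trans (ev-swap (λ a a′ → φ (mulMono a′ (mulMono a b))) x y)
        (ev-cong (λ a′ → ev-cong (λ a → cong φ (mulMono-comm a′ a b)) x) y)

-- The signed sum Σ_j (−1)^j f c_j (c_0 … ĉ_j … c_n) of a Laplace expansion.
laplace : (ℕ → List ℕ → ℤ) → List ℕ → ℤ
laplace f []       = 0ℤ
laplace f (c ∷ cs) = f c cs ℤ.- laplace (λ c′ rest → f c′ (c ∷ rest)) cs

laplace-cong : ∀ {P : ℕ → Set} {f g cs} → All P cs → (∀ c rest → P c → All P rest → f c rest ≡ g c rest) →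
  laplace f cs ≡ laplace g cs
laplace-cong []        eq = refl
laplace-cong (pc ∷ ps) eq = cong₂ ℤ._-_ (eq _ _ pc ps) (laplace-cong ps (λ c rest pc′ ps′ → eq c _ pc′ (pc ∷ ps′)))

laplace-cong′ : ∀ {f g} cs → (∀ c rest → f c rest ≡ g c rest) → laplace f cs ≡ laplace g cs
laplace-cong′ []       eq = refl
laplace-cong′ (c ∷ cs) eq = cong₂ ℤ._-_ (eq c cs) (laplace-cong′ cs (λ c′ rest → eq c′ (c ∷ rest)))

laplace-zero : ∀ cs → laplace (λ _ _ → 0ℤ) cs ≡ 0ℤ
laplace-zero []       = refl
laplace-zero (c ∷ cs) rewrite laplace-zero cs = refl

laplace-sub : ∀ f g cs → laplace (λ c rest → f c rest ℤ.- g c rest) cs ≡ laplace f cs ℤ.- laplace g cs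
laplace-sub f g []       = refl
laplace-sub f g (c ∷ cs)
  rewrite laplace-sub (λ c′ rest → f c′ (c ∷ rest)) (λ c′ rest → g c′ (c ∷ rest)) cs =
  lemma (f c cs) (g c cs) (laplace (λ c′ rest → f c′ (c ∷ rest)) cs) (laplace (λ c′ rest → g c′ (c ∷ rest)) cs)
  where
  lemma : ∀ a b u v → (a ℤ.- b) ℤ.- (u ℤ.- v) ≡ (a ℤ.- u) ℤ.- (b ℤ.- v)
  lemma = solve-∀

laplace-neg : ∀ f cs → laplace (λ c rest → ℤ.- f c rest) cs ≡ ℤ.- laplace f cs
laplace-neg f []       = refl
laplace-neg f (c ∷ cs) rewrite laplace-neg (λ c′ rest → f c′ (c ∷ rest)) cs =
  lemma (f c cs) (laplace (λ c′ rest → f c′ (c ∷ rest)) cs)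
  where
  lemma : ∀ a u → ℤ.- a ℤ.- ℤ.- u ≡ ℤ.- (a ℤ.- u)
  lemma = solve-∀

laplace-∷ʳ : ∀ f cs x → laplace f (cs ∷ʳ x) ≡
  laplace (λ c rest → f c (rest ∷ʳ x)) cs ℤ.+ signZ (length cs) ℤ.* f x cs
laplace-∷ʳ f []       x = lemma (f x [])
  where
  lemma : ∀ a → a ℤ.- 0ℤ ≡ 0ℤ ℤ.+ 1ℤ ℤ.* a
  lemma = solve-∀
laplace-∷ʳ f (c ∷ cs) x rewrite laplace-∷ʳ (λ c′ rest → f c′ (c ∷ rest)) cs x =
  lemma (f c (cs ∷ʳ x)) (laplace (λ c′ rest → f c′ (c ∷ (rest ∷ʳ x))) cs) (signZ (length cs)) (f x (c ∷ cs))
  where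
  lemma : ∀ a u s v → a ℤ.- (u ℤ.+ s ℤ.* v) ≡ (a ℤ.- u) ℤ.+ ℤ.- s ℤ.* v
  lemma = solve-∀

laplace₂ : (ℕ → ℕ → List ℕ → ℤ) → List ℕ → ℤ
laplace₂ f = laplace (λ c → laplace (f c))

-- Each pair of columns is chosen in both orders, with opposite signs; the induction separates the
-- pairs involving the first column.
laplace₂-swap : ∀ f cs → laplace₂ (λ a b → f b a) cs ≡ ℤ.- laplace₂ f cs
laplace₂-swap f []       = refl
laplace₂-swap f (c ∷ cs) = begin
  laplace (λ b → f b c) cs ℤ.- laplace (λ a rest → laplace (λ b → f b a) (c ∷ rest)) cs
    ≡⟨ cong (λ x → laplace (λ b → f b c) cs ℤ.- x) (laplace-sub (λ a → f c a) (λ a → laplace (λ b r → f b a (c ∷ r))) cs) ⟩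
  laplace (λ b → f b c) cs ℤ.- (laplace (f c) cs ℤ.- laplace₂ (λ a b r → f b a (c ∷ r)) cs)
    ≡⟨ cong (λ x → laplace (λ b → f b c) cs ℤ.- (laplace (f c) cs ℤ.- x)) (laplace₂-swap (λ a b r → f a b (c ∷ r)) cs) ⟩
  laplace (λ b → f b c) cs ℤ.- (laplace (f c) cs ℤ.- ℤ.- laplace₂ (λ a b r → f a b (c ∷ r)) cs)
    ≡⟨ lemma (laplace (λ b → f b c) cs) (laplace (f c) cs) (laplace₂ (λ a b r → f a b (c ∷ r)) cs) ⟩
  ℤ.- (laplace (f c) cs ℤ.- (laplace (λ b → f b c) cs ℤ.- laplace₂ (λ a b r → f a b (c ∷ r)) cs))
    ≡⟨ cong (λ x → ℤ.- (laplace (f c) cs ℤ.- x)) (sym (laplace-sub (λ a → f a c) (λ a → laplace (λ b r → f a b (c ∷ r))) cs)) ⟩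
  ℤ.- (laplace (f c) cs ℤ.- laplace (λ a rest → laplace (f a) (c ∷ rest)) cs) ∎
  where
  open ≡-Reasoning
  lemma : ∀ x y z → x ℤ.- (y ℤ.- ℤ.- z) ≡ ℤ.- (y ℤ.- (x ℤ.- z))
  lemma = solve-∀

Matrix : Set
Matrix = ℕ → ℕ → Sym

-- ev φ of the determinant with rows r, …, r + n − 1 and columns cs.
minor : Matrix → ℕ → ℕ → List ℕ → (Mono → ℤ) → ℤ
minor X zero    r cs φ = φ []
minor X (suc n) r cs φ = laplace (λ c rest → minor X n (suc r) rest (act (X r c) φ)) cs

minor-cong : ∀ {X Y} n r cs {φ ψ} → (∀ r′ c χ → r ≤ r′ → act (X r′ c) χ ≗ act (Y r′ c) χ) → φ ≗ ψ →
  minor X n r cs φ ≡ minor Y n r cs ψ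
minor-cong zero    r cs X≈Y φ≗ψ = φ≗ψ []
minor-cong {X} {Y} (suc n) r cs {φ} {ψ} X≈Y φ≗ψ = laplace-cong′ cs (λ c rest →
  minor-cong n (suc r) rest (λ r′ c′ χ r<r′ → X≈Y r′ c′ χ (ℕₚ.<⇒≤ r<r′))
    (λ m → trans (act-cong (X r c) φ≗ψ m) (X≈Y r c ψ ℕₚ.≤-refl m)))

minor-sub : ∀ X n r cs φ ψ → minor X n r cs (λ m → φ m ℤ.- ψ m) ≡ minor X n r cs φ ℤ.- minor X n r cs ψ
minor-sub X zero    r cs φ ψ = refl
minor-sub X (suc n) r cs φ ψ = trans
  (laplace-cong′ cs (λ c rest → trans
    (minor-cong {X} {X} n (suc r) rest (λ _ _ _ _ _ → refl)
      (λ b → ev-sub (λ a → φ (mulMono a b)) (λ a → ψ (mulMono a b)) (X r c)))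
    (minor-sub X n (suc r) rest (act (X r c) φ) (act (X r c) ψ))))
  (laplace-sub _ _ cs)

minor-row-sub : ∀ {X Y Z s} n r cs φ → r ≤ s → s < r ℕ.+ n →
  (∀ r′ c → r′ ≢ s → X r′ c ≡ Z r′ c) → (∀ r′ c → r′ ≢ s → Y r′ c ≡ Z r′ c) →
  (∀ c ψ → ev ψ (Z s c) ≡ ev ψ (X s c) ℤ.- ev ψ (Y s c)) →
  minor Z n r cs φ ≡ minor X n r cs φ ℤ.- minor Y n r cs φ
minor-row-sub zero r cs φ r≤s s<r _ _ _ =
  contradiction (subst (_ <_) (ℕₚ.+-identityʳ r) s<r) (ℕₚ.≤⇒≯ r≤s)
minor-row-sub {X} {Y} {Z} {s} (suc n) r cs φ r≤s s<r+n X≡Z Y≡Z Z-row with ℕₚ.m≤n⇒m<n∨m≡n r≤s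
... | inj₁ r<s = trans
  (laplace-cong′ cs (λ c rest → trans
    (minor-row-sub n (suc r) rest (act (Z r c) φ) r<s (subst (s <_) (ℕₚ.+-suc r n) s<r+n) X≡Z Y≡Z Z-row)
    (cong₂ (λ x y → minor X n (suc r) rest (act x φ) ℤ.- minor Y n (suc r) rest (act y φ))
           (sym (X≡Z r c (ℕₚ.<⇒≢ r<s))) (sym (Y≡Z r c (ℕₚ.<⇒≢ r<s))))))
  (laplace-sub _ _ cs)
... | inj₂ refl = trans
  (laplace-cong′ cs (λ c rest → trans
    (minor-cong {Z} {Z} n (suc r) rest (λ _ _ _ _ _ → refl) (λ b → Z-row c (λ a → φ (mulMono a b))))
    (trans (minor-sub Z n (suc r) rest (act (X r c) φ) (act (Y r c) φ))
      (cong₂ ℤ._-_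
        (minor-cong n (suc r) rest (λ r′ c′ χ r<r′ m → cong (λ x → act x χ m) (sym (X≡Z r′ c′ (λ eq → ℕₚ.<⇒≢ r<r′ (sym eq))))) (λ _ → refl))
        (minor-cong n (suc r) rest (λ r′ c′ χ r<r′ m → cong (λ x → act x χ m) (sym (Y≡Z r′ c′ (λ eq → ℕₚ.<⇒≢ r<r′ (sym eq))))) (λ _ → refl))))))
  (laplace-sub _ _ cs)

-- Once the expansion reaches row s the two rows are its outermost pair. Their entries act on φ one
-- after the other, which is why `act-comm` enters.
minor-swap : ∀ {X Y s} n r cs φ → r ≤ s → suc s < r ℕ.+ n →
  (∀ r′ c → r′ ≢ s → r′ ≢ suc s → X r′ c ≡ Y r′ c) →
  (∀ c → X s c ≡ Y (suc s) c) → (∀ c → X (suc s) c ≡ Y s c) →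
  minor X n r cs φ ≡ ℤ.- minor Y n r cs φ
minor-swap zero r cs φ r≤s s<r _ _ _ =
  contradiction (subst (_ <_) (ℕₚ.+-identityʳ r) s<r) (ℕₚ.≤⇒≯ (ℕₚ.m≤n⇒m≤1+n r≤s))
minor-swap {X} {Y} {s} (suc n) r cs φ r≤s s<r+n other at-s at-ss with ℕₚ.m≤n⇒m<n∨m≡n r≤s
... | inj₁ r<s = trans
  (laplace-cong′ cs (λ c rest → trans
    (cong (λ x → minor X n (suc r) rest (act x φ)) (other r c (ℕₚ.<⇒≢ r<s) (ℕₚ.<⇒≢ (ℕₚ.m≤n⇒m≤1+n r<s))))
    (minor-swap n (suc r) rest (act (Y r c) φ) r<s (subst (suc s <_) (ℕₚ.+-suc r n) s<r+n) other at-s at-ss)))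
  (laplace-neg _ cs)
minor-swap {s = s} (suc zero) r cs φ r≤s s<r+n other at-s at-ss | inj₂ refl =
  contradiction s<r+n (ℕₚ.<-irrefl (ℕₚ.+-comm 1 s))
minor-swap {X} {Y} {s} (suc (suc n)) r cs φ r≤s s<r+n other at-s at-ss | inj₂ refl = trans
  (laplace-cong′ cs (λ c rest → laplace-cong′ rest (λ c′ rest′ →
    minor-cong n (suc (suc s)) rest′
      (λ r′ c″ χ ss<r′ m → cong (λ x → act x χ m)
        (other r′ c″ (λ eq → ℕₚ.<⇒≢ (ℕₚ.<⇒≤ ss<r′) (sym eq)) (λ eq → ℕₚ.<⇒≢ ss<r′ (sym eq))))
      (λ m → trans (cong₂ (λ x y → act x (act y φ) m) (at-ss c′) (at-s c))
                   (act-comm (Y s c′) (Y (suc s) c) φ m)))))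
  (laplace₂-swap (λ c c′ rest → minor Y n (suc (suc s)) rest (act (Y (suc s) c′) (act (Y s c) φ))) cs)

minor-zero-row : ∀ {X s} {P : ℕ → Set} n r {cs} φ → r ≤ s → s < r ℕ.+ n → All P cs →
  (∀ c → P c → X s c ≡ 0S) → minor X n r cs φ ≡ 0ℤ
minor-zero : ∀ X n r cs {φ} → (∀ m → φ m ≡ 0ℤ) → minor X n r cs φ ≡ 0ℤ
minor-zero X zero    r cs φ≡0 = φ≡0 []
minor-zero X (suc n) r cs φ≡0 = trans
  (laplace-cong′ cs (λ c rest → minor-zero X n (suc r) rest
    (λ b → trans (ev-cong (λ a → φ≡0 (mulMono a b)) (X r c)) (ev-zero (X r c)))))
  (laplace-zero cs)
minor-zero-row zero r φ r≤s s<r _ _ =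
  contradiction (subst (_ <_) (ℕₚ.+-identityʳ r) s<r) (ℕₚ.≤⇒≯ r≤s)
minor-zero-row {X} {s} (suc n) r {cs} φ r≤s s<r+n P-cs zero-row with ℕₚ.m≤n⇒m<n∨m≡n r≤s
... | inj₁ r<s = trans
  (laplace-cong P-cs (λ c rest _ P-rest →
    minor-zero-row n (suc r) (act (X r c) φ) r<s (subst (s <_) (ℕₚ.+-suc r n) s<r+n) P-rest zero-row))
  (laplace-zero cs)
... | inj₂ refl = trans
  (laplace-cong P-cs (λ c rest P-c _ → minor-zero X n (suc r) rest
    (λ m → cong (λ x → act x φ m) (zero-row c P-c))))
  (laplace-zero cs)

-- Removal of a last row (0, ..., 0, 1) by expanding from the top: using up column `e` in an earlier
-- row leaves a zero row at the bottom.
minor-last-row : ∀ {X e} {P : ℕ → Set} n r cs φ → All P cs → length cs ≡ n →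
  (∀ c → P c → X (r ℕ.+ n) c ≡ 0S) → (∀ χ → act (X (r ℕ.+ n) e) χ ≗ χ) →
  minor X (suc n) r (cs ∷ʳ e) φ ≡ minor X n r cs φ
minor-last-row {X} {e} zero r [] φ [] refl zero-row unit-entry =
  trans (ℤₚ.+-identityʳ _) (subst (λ s → act (X s e) φ [] ≡ φ []) (ℕₚ.+-identityʳ r) (unit-entry φ []))
minor-last-row {X} {e} {P} (suc n) r cs φ P-cs len zero-row unit-entry = begin
  laplace (λ c rest → minor X (suc n) (suc r) rest (act (X r c) φ)) (cs ∷ʳ e)
    ≡⟨ laplace-∷ʳ _ cs e ⟩
  laplace (λ c rest → minor X (suc n) (suc r) (rest ∷ʳ e) (act (X r c) φ)) cs
    ℤ.+ signZ (length cs) ℤ.* minor X (suc n) (suc r) cs (act (X r e) φ)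
    ≡⟨ cong₂ (λ x y → x ℤ.+ signZ (length cs) ℤ.* y) expand
         (minor-zero-row (suc n) (suc r) (act (X r e) φ) (ℕₚ.m≤m+n (suc r) n) (ℕₚ.≤-reflexive (sym (cong suc (ℕₚ.+-suc r n)))) P-cs
           (λ c P-c → zero-row′ c P-c)) ⟩
  laplace (λ c rest → minor X n (suc r) rest (act (X r c) φ)) cs ℤ.+ signZ (length cs) ℤ.* 0ℤ
    ≡⟨ trans (cong (λ y → laplace (λ c rest → minor X n (suc r) rest (act (X r c) φ)) cs ℤ.+ y)
                   (ℤₚ.*-zeroʳ (signZ (length cs))))
             (ℤₚ.+-identityʳ _) ⟩
  laplace (λ c rest → minor X n (suc r) rest (act (X r c) φ)) cs ∎
  where
  open ≡-Reasoning
  zero-row′ : ∀ c → P c → X (suc r ℕ.+ n) c ≡ 0S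
  zero-row′ c P-c = subst (λ s → X s c ≡ 0S) (ℕₚ.+-suc r n) (zero-row c P-c)
  unit-entry′ : ∀ χ → act (X (suc r ℕ.+ n) e) χ ≗ χ
  unit-entry′ = subst (λ s → ∀ χ → act (X s e) χ ≗ χ) (ℕₚ.+-suc r n) unit-entry
  sized-cong : ∀ {f g : ℕ → List ℕ → ℤ} cs n → All P cs → length cs ≡ suc n →
    (∀ c rest → All P rest → length rest ≡ n → f c rest ≡ g c rest) → laplace f cs ≡ laplace g cs
  sized-cong (c ∷ []) n (P-c ∷ []) len eq = cong (ℤ._- 0ℤ) (eq c [] [] (ℕₚ.suc-injective len))
  sized-cong (c ∷ cs@(_ ∷ _)) (suc n) (P-c ∷ P-cs) len eq =
    cong₂ ℤ._-_ (eq c cs P-cs (ℕₚ.suc-injective len))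
      (sized-cong cs n P-cs (ℕₚ.suc-injective len)
        (λ c′ rest P-rest len′ → eq c′ (c ∷ rest) (P-c ∷ P-rest) (cong suc len′)))
  expand : laplace (λ c rest → minor X (suc n) (suc r) (rest ∷ʳ e) (act (X r c) φ)) cs
         ≡ laplace (λ c rest → minor X n (suc r) rest (act (X r c) φ)) cs
  expand = sized-cong cs n P-cs len (λ c rest P-rest len′ →
    minor-last-row n (suc r) rest (act (X r c) φ) P-rest len′ zero-row′ unit-entry′)

-- The functions g_γ

-- The generating series of k^(r) is (1 - t)^(-r) Σ h_m t^m, and multiplication by 1 - t lowers r by
-- one; on coefficients this is Pascal's rule.
kS-difference : ∀ φ r m → ev φ (kS (suc r) m) ℤ.- ev φ (kS (suc r) (m ℤ.+ -1ℤ)) ≡ ev φ (kS r m)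
kS-difference φ r -[1+ m ]  = refl
kS-difference φ r (+ zero)  = ℤₚ.+-identityʳ _
kS-difference φ r (+ suc m) = begin
  ev φ (kS (suc r) (+ suc m)) ℤ.- ev φ (kS (suc r) (+ m))
    ≡⟨ cong₂ ℤ._-_ (kS-value (suc r) (suc m)) (kS-value (suc r) m) ⟩
  (top ℤ.+ sumTo (λ i → + ((r ℕ.+ suc i) C suc i) ℤ.* h i) (suc m))
    ℤ.- sumTo (λ i → + ((r ℕ.+ i) C i) ℤ.* h i) (suc m)
    ≡⟨ cong (λ x → (top ℤ.+ x) ℤ.- sumTo (λ i → + ((r ℕ.+ i) C i) ℤ.* h i) (suc m))
         (trans (sumTo-cong (suc m) (λ i _ → pascal i)) (sumTo-+ (λ i → + ((r ℕ.+ i) C i) ℤ.* h i) (λ i → + ((r ℕ.+ i) C suc i) ℤ.* h i) (suc m))) ⟩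
  (top ℤ.+ (sumTo (λ i → + ((r ℕ.+ i) C i) ℤ.* h i) (suc m) ℤ.+ sumTo (λ i → + ((r ℕ.+ i) C suc i) ℤ.* h i) (suc m)))
    ℤ.- sumTo (λ i → + ((r ℕ.+ i) C i) ℤ.* h i) (suc m)
    ≡⟨ cancel top (sumTo (λ i → + ((r ℕ.+ i) C i) ℤ.* h i) (suc m)) _ ⟩
  top ℤ.+ sumTo (λ i → + ((r ℕ.+ i) C suc i) ℤ.* h i) (suc m)
    ≡⟨ cong (ℤ._+_ top) (sumTo-cong (suc m) (λ i _ →
         cong (λ x → + ((x ℕ.∸ 1) C suc i) ℤ.* h i) (sym (ℕₚ.+-suc r i)))) ⟩
  top ℤ.+ sumTo (λ i → + ((r ℕ.+ suc i ℕ.∸ 1) C suc i) ℤ.* h i) (suc m)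
    ≡⟨ sym (kS-value r (suc m)) ⟩
  ev φ (kS r (+ suc m)) ∎
  where
  open ≡-Reasoning
  h : ℕ → ℤ
  h i = ev φ (hS (+ (m ℕ.∸ i)))
  top = 1ℤ ℤ.* ev φ (hS (+ suc m))
  kS-value : ∀ r m → ev φ (kS r (+ m)) ≡ sumTo (λ i → + ((r ℕ.+ i ℕ.∸ 1) C i) ℤ.* ev φ (hS (+ (m ℕ.∸ i)))) (suc m)
  kS-value r m = trans
    (ev-sumTo φ (λ i → scaleS (+ ((r ℕ.+ i ℕ.∸ 1) C i)) (hS (+ (m ℕ.∸ i)))) (suc m))
    (sumTo-cong (suc m) (λ i _ → ev-scale φ (+ ((r ℕ.+ i ℕ.∸ 1) C i)) (hS (+ (m ℕ.∸ i)))))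
  pascal : ∀ i → + ((r ℕ.+ suc i) C suc i) ℤ.* h i ≡ + ((r ℕ.+ i) C i) ℤ.* h i ℤ.+ + ((r ℕ.+ i) C suc i) ℤ.* h i
  pascal i = trans
    (cong (λ x → + x ℤ.* h i)
      (trans (cong (_C suc i) (ℕₚ.+-suc r i)) (sym (nCk+nC[k+1]≡[n+1]C[k+1] (r ℕ.+ i) i))))
    (ℤₚ.*-distribʳ-+ (h i) (+ ((r ℕ.+ i) C i)) (+ ((r ℕ.+ i) C suc i)))
  cancel : ∀ t x y → (t ℤ.+ (x ℤ.+ y)) ℤ.- x ≡ t ℤ.+ y
  cancel = solve-∀

kS-negative : ∀ r {m} → m ℤ.< 0ℤ → kS r m ≡ 0S
kS-negative r { -[1+ m ]} _ = refl
kS-negative r {+ m} (ℤ.+<+ ())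

entry : Weight → Matrix
entry γ r c = kS r (γ r ℤ.+ + suc c ℤ.- + suc r)

gFn : (Mono → ℤ) → ℕ → Fn
gFn φ ℓ = record
  { ap  = λ γ → minor (entry γ) ℓ 0 (upTo ℓ) φ
  ; ext = λ γ≗δ → minor-cong ℓ 0 (upTo ℓ)
            (λ r c χ _ m → cong (λ x → act (kS r (x ℤ.+ + suc c ℤ.- + suc r)) χ m) (γ≗δ r)) (λ _ → refl)
  }

upTo-< : ∀ n → All (_< n) (upTo n)
upTo-< n = Allₚ.applyUpTo⁺₁ (λ i → i) n (λ i<n → i<n)

gFn-zero-row : ∀ φ ℓ γ {s} → s < ℓ → (∀ c → c < ℓ → γ s ℤ.+ + suc c ℤ.- + suc s ℤ.< 0ℤ) → ap (gFn φ ℓ) γ ≡ 0ℤ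
gFn-zero-row φ ℓ γ {s} s<ℓ neg =
  minor-zero-row ℓ 0 φ z≤n s<ℓ (upTo-< ℓ) (λ c c<ℓ → kS-negative s (neg c c<ℓ))

-- In the last row no entry has an index above γ_c, so the row is zero.
gFn-vanishing : ∀ φ ℓ c → suc c ≡ ℓ → VanishesBelow c (gFn φ ℓ)
gFn-vanishing φ ℓ c refl γ γ<0 = gFn-zero-row φ ℓ γ ℕₚ.≤-refl (λ c′ c′≤c → begin-strict
  γ c ℤ.+ + suc c′ ℤ.- + suc c    ≡⟨ ℤₚ.+-assoc (γ c) (+ suc c′) (ℤ.- + suc c) ⟩
  γ c ℤ.+ (+ suc c′ ℤ.- + suc c)  <⟨ ℤₚ.+-mono-<-≤ γ<0 (ℤₚ.i≤j⇒i-j≤0 (ℤ.+≤+ c′≤c)) ⟩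
  0ℤ ∎)
  where open ℤₚ.≤-Reasoning

sumTo-mono : ∀ {f} n → (∀ i → i < n → 0ℤ ℤ.≤ f i) → 0ℤ ℤ.≤ sumTo f n
sumTo-mono zero    f≥0 = ℤₚ.≤-refl
sumTo-mono (suc n) f≥0 = ℤₚ.+-mono-≤ (f≥0 0 (s≤s z≤n)) (sumTo-mono n (λ i i<n → f≥0 (suc i) (s≤s i<n)))

sumTo-pos : ∀ f n → sumTo (λ i → + f i) n ≡ + sumℕ f n
sumTo-pos f zero    = refl
sumTo-pos f (suc n) = cong (ℤ._+_ (+ f 0)) (sumTo-pos (λ i → f (suc i)) n)

-- g_γ ≠ 0 forces γ_i ≥ −ℓ for all i < ℓ, hence a height of at least −depth ℓ.
depth : ℕ → ℕ
depth ℓ = sumℕ (λ i → i ℕ.* ℓ) ℓ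

gFn-supported : ∀ φ ℓ → Truncation.Supported ℓ (depth ℓ) (gFn φ ℓ)
gFn-supported φ ℓ γ h<0 with ℕₚ.anyUpTo? (λ i → γ i ℤ.<? ℤ.- (+ ℓ)) ℓ
... | yes (s , s<ℓ , γ<-ℓ) = gFn-zero-row φ ℓ γ s<ℓ (λ c c<ℓ → begin-strict
  γ s ℤ.+ + suc c ℤ.- + suc s   ≤⟨ ℤₚ.i-j≤i _ (+ suc s) ⟩
  γ s ℤ.+ + suc c               <⟨ ℤₚ.+-mono-<-≤ γ<-ℓ (ℤ.+≤+ c<ℓ) ⟩
  ℤ.- (+ ℓ) ℤ.+ + ℓ             ≡⟨ ℤₚ.+-inverseˡ (+ ℓ) ⟩
  0ℤ ∎)
  where open ℤₚ.≤-Reasoning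
... | no none = contradiction h<0 (ℤₚ.≤⇒≯ (begin
  0ℤ                                              ≤⟨ sumTo-mono ℓ nonneg ⟩
  sumTo (λ i → + i ℤ.* γ i ℤ.+ + (i ℕ.* ℓ)) ℓ     ≡⟨ sumTo-+ (λ i → + i ℤ.* γ i) (λ i → + (i ℕ.* ℓ)) ℓ ⟩
  Truncation.ht ℓ (depth ℓ) γ ℤ.+ sumTo (λ i → + (i ℕ.* ℓ)) ℓ
    ≡⟨ cong (ℤ._+_ (Truncation.ht ℓ (depth ℓ) γ)) (sumTo-pos (λ i → i ℕ.* ℓ) ℓ) ⟩
  Truncation.ht ℓ (depth ℓ) γ ℤ.+ + depth ℓ ∎))
  where
  open ℤₚ.≤-Reasoning
  nonneg : ∀ i → i < ℓ → 0ℤ ℤ.≤ + i ℤ.* γ i ℤ.+ + (i ℕ.* ℓ)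
  nonneg i i<ℓ = begin
    0ℤ                                   ≡⟨ sym (ℤₚ.*-zeroʳ (+ i)) ⟩
    + i ℤ.* 0ℤ                           ≡⟨ cong (+ i ℤ.*_) (sym (ℤₚ.+-inverseˡ (+ ℓ))) ⟩
    + i ℤ.* (ℤ.- (+ ℓ) ℤ.+ + ℓ)          ≤⟨ ℤₚ.*-monoˡ-≤-nonNeg (+ i)
                                              (ℤₚ.+-monoˡ-≤ (+ ℓ) (ℤₚ.≮⇒≥ (λ γ< → none (i , i<ℓ , γ<)))) ⟩
    + i ℤ.* (γ i ℤ.+ + ℓ)                ≡⟨ ℤₚ.*-distribˡ-+ (+ i) (γ i) (+ ℓ) ⟩
    + i ℤ.* γ i ℤ.+ + i ℤ.* + ℓ          ≡⟨ cong (ℤ._+_ (+ i ℤ.* γ i)) (sym (ℤₚ.pos-* i ℓ)) ⟩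
    + i ℤ.* γ i ℤ.+ + (i ℕ.* ℓ) ∎

-- The matrix of (1 − L_{s+1}) g_γ: row s + 1 now consists of the same functions k^{(s)} as row s.
lowered-entry : ℕ → Weight → Matrix
lowered-entry s γ r c with r ℕ.≟ suc s
... | yes _ = kS s (γ r ℤ.+ + suc c ℤ.- + suc r)
... | no  _ = entry γ r c

lowered-entry-at : ∀ s γ c → lowered-entry s γ (suc s) c ≡ kS s (γ (suc s) ℤ.+ + suc c ℤ.- + suc (suc s))
lowered-entry-at s γ c with suc s ℕ.≟ suc s
... | yes _ = refl
... | no ne = contradiction refl ne

lowered-entry-other : ∀ s γ {r} c → r ≢ suc s → lowered-entry s γ r c ≡ entry γ r c
lowered-entry-other s γ {r} c r≢ with r ℕ.≟ suc s
... | yes r≡ = contradiction r≡ r≢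
... | no _   = refl

-- The determinant is additive in row s + 1, where `kS-difference` turns k^(s+1) into k^(s).
gFn-lower : ∀ φ ℓ γ s → suc s < ℓ →
  opValue (low (suc s)) (gFn φ ℓ) γ ≡ minor (lowered-entry s γ) ℓ 0 (upTo ℓ) φ
gFn-lower φ ℓ γ s s<ℓ = trans (low-value (suc s) (gFn φ ℓ) γ) (sym
  (minor-row-sub ℓ 0 (upTo ℓ) φ z≤n s<ℓ
    (λ r c r≢ → sym (lowered-entry-other s γ c r≢))
    (λ r c r≢ → trans (cong (λ x → kS r (x ℤ.+ + suc c ℤ.- + suc r))
                        (trans (cong (λ u → γ r ℤ.+ -1ℤ ℤ.* u) (unit-diff (λ eq → r≢ (sym eq)))) (ℤₚ.+-identityʳ (γ r))))
                      (sym (lowered-entry-other s γ c r≢)))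
    row))
  where
  row : ∀ c ψ → ev ψ (lowered-entry s γ (suc s) c)
              ≡ ev ψ (entry γ (suc s) c) ℤ.- ev ψ (entry (γ ∔ -ε (suc s)) (suc s) c)
  row c ψ = trans (cong (ev ψ) (lowered-entry-at s γ c))
    (trans (sym (kS-difference ψ s (γ (suc s) ℤ.+ + suc c ℤ.- + suc (suc s))))
      (cong (λ x → ev ψ (entry γ (suc s) c) ℤ.- ev ψ (kS (suc s) x))
        (trans (lemma (γ (suc s)) (+ suc c) (+ suc (suc s)))
          (cong (λ u → (γ (suc s) ℤ.+ -1ℤ ℤ.* u) ℤ.+ + suc c ℤ.- + suc (suc s)) (sym (unit-same (suc s)))))))
    where
    lemma : ∀ x c r → x ℤ.+ c ℤ.- r ℤ.+ -1ℤ ≡ x ℤ.+ -1ℤ ℤ.* 1ℤ ℤ.+ c ℤ.- r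
    lemma = solve-∀

-- Rows s and s + 1 are now built from the same functions and depend on γ_s - s and γ_{s+1} - (s +
-- 1), which the reflection exchanges; so it swaps two rows of a determinant.
gFn-reflected : ∀ φ ℓ s → suc s < ℓ →
  Antisymmetric s (op (low (suc s)) (gFn φ ℓ)) (op (low (suc s)) (gFn φ ℓ))
gFn-reflected φ ℓ s s<ℓ γ = begin
  opValue (low (suc s)) (gFn φ ℓ) (reflection s γ)
    ≡⟨ gFn-lower φ ℓ (reflection s γ) s s<ℓ ⟩
  minor (lowered-entry s (reflection s γ)) ℓ 0 (upTo ℓ) φ
    ≡⟨ minor-swap ℓ 0 (upTo ℓ) φ z≤n s<ℓ other at-s at-ss ⟩
  ℤ.- minor (lowered-entry s γ) ℓ 0 (upTo ℓ) φ
    ≡⟨ cong ℤ.-_ (sym (gFn-lower φ ℓ γ s s<ℓ)) ⟩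
  ℤ.- opValue (low (suc s)) (gFn φ ℓ) γ ∎
  where
  open ≡-Reasoning
  t = γ (suc s) ℤ.- γ s ℤ.- 1ℤ
  other : ∀ r c → r ≢ s → r ≢ suc s → lowered-entry s (reflection s γ) r c ≡ lowered-entry s γ r c
  other r c r≢s r≢ss = trans (lowered-entry-other s (reflection s γ) c r≢ss)
    (trans (cong (λ x → kS r (x ℤ.+ + suc c ℤ.- + suc r))
             (trans (cong₂ (λ u v → γ r ℤ.+ t ℤ.* (u ℤ.- v)) (unit-diff (λ eq → r≢s (sym eq))) (unit-diff (λ eq → r≢ss (sym eq))))
                    (trans (cong (ℤ._+_ (γ r)) (ℤₚ.*-zeroʳ t)) (ℤₚ.+-identityʳ (γ r)))))
           (sym (lowered-entry-other s γ c r≢ss)))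
  s≢ss : s ≢ suc s
  s≢ss eq = ℕₚ.1+n≢n (sym eq)
  at-s : ∀ c → lowered-entry s (reflection s γ) s c ≡ lowered-entry s γ (suc s) c
  at-s c = trans (lowered-entry-other s (reflection s γ) c s≢ss)
    (trans (cong (kS s) (trans
        (cong₂ (λ u v → (γ s ℤ.+ t ℤ.* (u ℤ.- v)) ℤ.+ + suc c ℤ.- + suc s) (unit-same s) (unit-diff {suc s} {s} ℕₚ.1+n≢n))
        (lemma (γ s) (γ (suc s)) (+ suc c) (+ suc s))))
      (sym (lowered-entry-at s γ c)))
    where
    lemma : ∀ x y c r → (x ℤ.+ (y ℤ.- x ℤ.- 1ℤ) ℤ.* (1ℤ ℤ.- 0ℤ)) ℤ.+ c ℤ.- r ≡ y ℤ.+ c ℤ.- (1ℤ ℤ.+ r)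
    lemma = solve-∀
  at-ss : ∀ c → lowered-entry s (reflection s γ) (suc s) c ≡ lowered-entry s γ s c
  at-ss c = trans (lowered-entry-at s (reflection s γ) c)
    (trans (cong (kS s) (trans
        (cong₂ (λ u v → (γ (suc s) ℤ.+ t ℤ.* (u ℤ.- v)) ℤ.+ + suc c ℤ.- + suc (suc s)) (unit-diff s≢ss) (unit-same s))
        (lemma (γ s) (γ (suc s)) (+ suc c) (+ suc s))))
      (sym (lowered-entry-other s γ c s≢ss)))
    where
    lemma : ∀ x y c r → (y ℤ.+ (y ℤ.- x ℤ.- 1ℤ) ℤ.* (0ℤ ℤ.- 1ℤ)) ℤ.+ c ℤ.- (1ℤ ℤ.+ r) ≡ x ℤ.+ c ℤ.- r
    lemma = solve-∀

environment : (φ : Mono → ℤ) (ℓ N : ℕ) → Environment ℓ (depth ℓ)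
environment φ ℓ N = record
  { N         = N
  ; G         = gFn φ ℓ
  ; supported = gFn-supported φ ℓ
  ; reflected = gFn-reflected φ ℓ
  ; vanishing = gFn-vanishing φ ℓ
  }

act-kS-zero : ∀ r χ → act (kS r (+ 0)) χ ≗ χ
act-kS-zero r χ b = trans
  (ev-sumTo (λ a → χ (mulMono a b)) (λ i → scaleS (+ ((r ℕ.+ i ℕ.∸ 1) C i)) (hS (+ (0 ℕ.∸ i)))) 1)
  (lemma (χ b))
  where
  lemma : ∀ x → (1ℤ ℤ.* 1ℤ ℤ.* x ℤ.+ 0ℤ) ℤ.+ 0ℤ ≡ x
  lemma = solve-∀

-- The indices in the last row run from -ℓ up to 0, so the row is (0, ..., 0, 1).
gFn-strip : ∀ φ ℓ γ → γ ℓ ≡ 0ℤ → ap (gFn φ (suc ℓ)) γ ≡ ap (gFn φ ℓ) γ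
gFn-strip φ ℓ γ γ≡0 = trans
  (cong (λ cs → minor (entry γ) (suc ℓ) 0 cs φ) (sym (Listₚ.upTo-∷ʳ ℓ)))
  (minor-last-row ℓ 0 (upTo ℓ) φ (upTo-< ℓ) (Listₚ.length-upTo ℓ)
    (λ c c<ℓ → kS-negative ℓ (subst (λ x → x ℤ.+ + suc c ℤ.- + suc ℓ ℤ.< 0ℤ) (sym γ≡0)
      (subst (ℤ._< 0ℤ) (cong (ℤ._- + suc ℓ) (sym (ℤₚ.+-identityˡ (+ suc c)))) (subst (+ suc c ℤ.- + suc ℓ ℤ.<_) (ℤₚ.+-inverseʳ (+ suc ℓ)) (ℤₚ.+-monoˡ-< (ℤ.- + suc ℓ) (ℤ.+<+ (s≤s c<ℓ)))))))
    (λ χ m → trans (cong (λ x → act (kS ℓ x) χ m)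
                     (trans (cong (λ x → x ℤ.+ + suc ℓ ℤ.- + suc ℓ) γ≡0)
                            (trans (cong (ℤ._- + suc ℓ) (ℤₚ.+-identityˡ (+ suc ℓ))) (ℤₚ.+-inverseʳ (+ suc ℓ)))))
                   (act-kS-zero ℓ χ m)))

-- Evaluation of truncated Katalan functions

sumFin : ∀ {n} → (Fin n → ℤ) → ℤ
sumFin {zero}  t = 0ℤ
sumFin {suc n} t = t Fin.zero ℤ.+ sumFin (t ∘ Fin.suc)

sumFin-cong : ∀ {n} {t u : Fin n → ℤ} → (∀ j → t j ≡ u j) → sumFin t ≡ sumFin u
sumFin-cong {zero}  eq = refl
sumFin-cong {suc n} eq = cong₂ ℤ._+_ (eq Fin.zero) (sumFin-cong (eq ∘ Fin.suc))

sumFin-neg : ∀ {n} (t : Fin n → ℤ) → sumFin (λ j → ℤ.- t j) ≡ ℤ.- sumFin t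
sumFin-neg {zero}  t = refl
sumFin-neg {suc n} t = trans (cong (ℤ._+_ (ℤ.- t Fin.zero)) (sumFin-neg (t ∘ Fin.suc)))
                             (sym (ℤₚ.neg-distrib-+ (t Fin.zero) (sumFin (t ∘ Fin.suc))))

foldr-tabulate : ∀ {A : Set} (g : A → ℤ) {n} (f : Fin n → A) →
  foldr (λ a x → g a ℤ.+ x) 0ℤ (tabulate f) ≡ sumFin (g ∘ f)
foldr-tabulate g {zero}  f = refl
foldr-tabulate g {suc n} f = cong (ℤ._+_ (g (f Fin.zero))) (foldr-tabulate g (f ∘ Fin.suc))

laplace-sumFin : ∀ {n} (cs : Fin (suc n) → ℕ) f →
  sumFin (λ j → signZ (toℕ j) ℤ.* f (cs j) (tabulate (cs ∘ punchIn j))) ≡ laplace f (tabulate cs)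
laplace-sumFin {zero} cs f =
  trans (ℤₚ.+-identityʳ _) (trans (ℤₚ.*-identityˡ (f (cs Fin.zero) [])) (sym (ℤₚ.+-identityʳ _)))
laplace-sumFin {suc n} cs f = cong₂ ℤ._+_ (ℤₚ.*-identityˡ (f (cs Fin.zero) (tabulate (cs ∘ Fin.suc))))
  (trans (sumFin-cong (λ j → sym (ℤₚ.neg-distribˡ-* (signZ (toℕ j)) (value j))))
    (trans (sumFin-neg (λ j → signZ (toℕ j) ℤ.* value j))
      (cong ℤ.-_ (laplace-sumFin (cs ∘ Fin.suc) (λ c rest → f c (cs Fin.zero ∷ rest))))))
  where
  value : Fin (suc n) → ℤ
  value j = f (cs (Fin.suc j)) (cs Fin.zero ∷ tabulate (cs ∘ Fin.suc ∘ punchIn j))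

ev-det : ∀ φ n {M : Fin n → Fin n → Sym} X r (cs : Fin n → ℕ) → (∀ a b → M a b ≡ X (r ℕ.+ toℕ a) (cs b)) →
  ev φ (det n M) ≡ minor X n r (tabulate cs) φ
ev-det φ zero    X r cs eq = trans (ℤₚ.+-identityʳ _) (ℤₚ.*-identityˡ (φ []))
ev-det φ (suc n) {M} X r cs eq = begin
  ev φ (det (suc n) M)
    ≡⟨ ev-sumS φ term (allFin (suc n)) ⟩
  foldr (λ j x → ev φ (term j) ℤ.+ x) 0ℤ (allFin (suc n))
    ≡⟨ foldr-tabulate (λ j → ev φ (term j)) (λ j → j) ⟩
  sumFin (λ j → ev φ (term j))
    ≡⟨ sumFin-cong (λ j → trans (ev-scale φ (signZ (toℕ j)) (product j)) (cong (signZ (toℕ j) ℤ.*_) (cofactor j))) ⟩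
  sumFin (λ j → signZ (toℕ j) ℤ.* minor X n (suc r) (tabulate (cs ∘ punchIn j)) (act (X r (cs j)) φ))
    ≡⟨ laplace-sumFin cs (λ c rest → minor X n (suc r) rest (act (X r c) φ)) ⟩
  minor X (suc n) r (tabulate cs) φ ∎
  where
  open ≡-Reasoning
  product term : Fin (suc n) → Sym
  product j = M Fin.zero j *S det n (λ a b → M (Fin.suc a) (punchIn j b))
  term j = scaleS (signZ (toℕ j)) (product j)
  cofactor : ∀ j → ev φ (product j)
                 ≡ minor X n (suc r) (tabulate (cs ∘ punchIn j)) (act (X r (cs j)) φ)
  cofactor j = trans (ev-*S φ (M Fin.zero j) (det n (λ a b → M (Fin.suc a) (punchIn j b))))
    (trans (ev-det (act (M Fin.zero j) φ) n X (suc r) (cs ∘ punchIn j)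
             (λ a b → trans (eq (Fin.suc a) (punchIn j b)) (cong (λ s → X s (cs (punchIn j b))) (ℕₚ.+-suc r (toℕ a)))))
           (cong (λ x → minor X n (suc r) (tabulate (cs ∘ punchIn j)) (act x φ))
             (trans (eq Fin.zero j) (cong (λ s → X s (cs j)) (ℕₚ.+-identityʳ r)))))

tabulate-toℕ : ∀ n (f : ℕ → ℕ) → tabulate {n = n} (f ∘ toℕ) ≡ applyUpTo f n
tabulate-toℕ zero    f = refl
tabulate-toℕ (suc n) f = cong (f 0 ∷_) (tabulate-toℕ n (f ∘ suc))

-- An `Fn` takes infinite weights, so γ′ ranges over all extensions of the ℓ given coordinates.
Represents : ∀ {ℓ} → (Mono → ℤ) → (Idx ℓ → Sym) → Fn → Set
Represents φ H F = ∀ γ γ′ → (∀ i → γ i ≡ γ′ (toℕ i)) → ev φ (H γ) ≡ ap F γ′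

gS-represents : ∀ φ ℓ → Represents φ (gS ℓ) (gFn φ ℓ)
gS-represents φ ℓ γ γ′ γ≡γ′ = trans
  (ev-det φ ℓ (entry γ′) 0 toℕ (λ a b → cong (λ x → kS (toℕ a) (x ℤ.+ + suc (toℕ b) ℤ.- + suc (toℕ a))) (γ≡γ′ a)))
  (cong (λ cs → minor (entry γ′) ℓ 0 cs φ) (tabulate-toℕ ℓ (λ i → i)))

shift-value : ∀ {ℓ} (γ : Idx ℓ) i d a → shift γ i d a ≡ γ a ℤ.+ d ℤ.* unit (toℕ i) (toℕ a)
shift-value γ i d a with a Fin.≟ i
... | yes refl = sym (trans (cong (λ u → γ a ℤ.+ d ℤ.* u) (unit-same (toℕ a))) (cong (ℤ._+_ (γ a)) (ℤₚ.*-identityʳ d)))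
... | no a≢i   = sym (trans (cong (λ u → γ a ℤ.+ d ℤ.* u) (unit-diff (λ eq → a≢i (sym (Finₚ.toℕ-injective eq)))))
                            (trans (cong (ℤ._+_ (γ a)) (ℤₚ.*-zeroʳ d)) (ℤₚ.+-identityʳ (γ a))))

toℕ² : ∀ {ℓ} → Fin ℓ × Fin ℓ → ℕ × ℕ
toℕ² (i , j) = toℕ i , toℕ j

lowerOp-represents : ∀ {ℓ φ z} {H : Idx ℓ → Sym} {F} → Represents φ H F →
  Represents φ (lowerOp z H) (op (low (toℕ z)) F)
lowerOp-represents {φ = φ} {z} {H} {F} rep γ γ′ γ≡γ′ = begin
  ev φ (H γ ++ negS (H (shift γ z -1ℤ)))
    ≡⟨ ev-++ φ (H γ) _ ⟩
  ev φ (H γ) ℤ.+ ev φ (negS (H (shift γ z -1ℤ)))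
    ≡⟨ cong₂ ℤ._+_ (rep γ γ′ γ≡γ′) (trans (ev-scale φ -1ℤ (H (shift γ z -1ℤ))) (ℤₚ.-1*i≡-i (ev φ (H (shift γ z -1ℤ))))) ⟩
  ap F γ′ ℤ.- ev φ (H (shift γ z -1ℤ))
    ≡⟨ cong (λ x → ap F γ′ ℤ.- x) (rep (shift γ z -1ℤ) (γ′ ∔ -ε (toℕ z))
         (λ a → trans (shift-value γ z -1ℤ a) (cong (ℤ._+ -1ℤ ℤ.* unit (toℕ z) (toℕ a)) (γ≡γ′ a)))) ⟩
  ap F γ′ ℤ.- ap F (γ′ ∔ -ε (toℕ z))
    ≡⟨ sym (low-value (toℕ z) F γ′) ⟩
  opValue (low (toℕ z)) F γ′ ∎
  where open ≡-Reasoning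

raiseOp-represents : ∀ {ℓ φ N β} {H : Idx ℓ → Sym} {F} → Represents φ H F →
  Represents φ (raiseOp N β H) (op (geom N (toℕ² β)) F)
raiseOp-represents {φ = φ} {N} {i , j} {H} {F} rep γ γ′ γ≡γ′ = trans
  (ev-sumTo φ (λ n → H (shift (shift γ i (+ n)) j (ℤ.- (+ n)))) (suc N))
  (trans (sumTo-cong (suc N) (λ n _ → rep _ (γ′ ∔ (+ n) · root (toℕ i , toℕ j)) (shifted n)))
         (sym (geom-value N (toℕ i , toℕ j) F γ′)))
  where
  lemma : ∀ x n u v → x ℤ.+ n ℤ.* u ℤ.+ ℤ.- n ℤ.* v ≡ x ℤ.+ n ℤ.* (u ℤ.- v)
  lemma = solve-∀
  shifted : ∀ n a → shift (shift γ i (+ n)) j (ℤ.- (+ n)) a ≡ (γ′ ∔ (+ n) · root (toℕ i , toℕ j)) (toℕ a)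
  shifted n a = trans (shift-value (shift γ i (+ n)) j (ℤ.- (+ n)) a)
    (trans (cong (ℤ._+ ℤ.- (+ n) ℤ.* unit (toℕ j) (toℕ a))
             (trans (shift-value γ i (+ n) a) (cong (ℤ._+ + n ℤ.* unit (toℕ i) (toℕ a)) (γ≡γ′ a))))
           (lemma (γ′ (toℕ a)) (+ n) (unit (toℕ i) (toℕ a)) (unit (toℕ j) (toℕ a))))

katTrunc-represents : ∀ {ℓ} φ N (Ψ : List (Fin ℓ × Fin ℓ)) M →
  Represents φ (λ γ → katTrunc Ψ M γ N) (prod (map low (map toℕ M) ++ map (geom N) (map toℕ² Ψ)) (gFn φ ℓ))
katTrunc-represents {ℓ} φ N Ψ (z ∷ M) =
  lowerOp-represents {z = z} {λ γ → katTrunc Ψ M γ N}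
    {prod (map low (map toℕ M) ++ map (geom N) (map toℕ² Ψ)) (gFn φ ℓ)} (katTrunc-represents φ N Ψ M)
katTrunc-represents {ℓ} φ N (β ∷ Ψ) [] =
  raiseOp-represents {N = N} {β} {λ γ → katTrunc Ψ [] γ N}
    {prod (map (geom N) (map toℕ² Ψ)) (gFn φ ℓ)} (katTrunc-represents φ N Ψ [])
katTrunc-represents {ℓ} φ N [] [] = gS-represents φ ℓ

katTrunc-value : ∀ {ℓ} φ N {Ψ : List (Fin ℓ × Fin ℓ)} {M Φ Ψ′} {γ γ′} →
  map toℕ M ↭ map proj₂ Φ → map toℕ² Ψ ↭ Ψ′ → (∀ i → γ i ≡ γ′ (toℕ i)) →
  ev φ (katTrunc Ψ M γ N) ≡ ap (katalan N (gFn φ ℓ) Φ Ψ′) γ′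
katTrunc-value {ℓ} φ N {Ψ} {M} {Φ} {Ψ′} {γ} {γ′} M↭ Ψ↭ γ≡γ′ = trans
  (katTrunc-represents φ N Ψ M γ γ′ γ≡γ′)
  (prod-↭ (gFn φ ℓ)
    (↭-trans (Permₚ.++⁺ (Permₚ.map⁺ low M↭) (Permₚ.map⁺ (geom N) Ψ↭))
             (Perm.↭-reflexive (cong (_++ map (geom N) Ψ′) (sym (Listₚ.map-∘ Φ))))) γ′)

allPairs-cartesian : ∀ {ℓ} (xs ys : List (Fin ℓ)) →
  concatMap (λ i → map (λ j → i , j) ys) xs ≡ cartesianProduct xs ys
allPairs-cartesian []       ys = refl
allPairs-cartesian (x ∷ xs) ys = cong (map (x ,_) ys ++_) (allPairs-cartesian xs ys)

module _ (k : ℕ) {ℓ : ℕ} (lam : Vec ℕ ℓ) (lam≤k : ∀ i → lookup lam i ≤ k)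
         (d : ℕ → ℕ) (d-lam : ∀ i → d (toℕ i) ≡ suc (k ℕ.∸ lookup lam i ℕ.+ toℕ i)) where

  first-lam : ∀ i → + k ℤ.- + lookup lam i ℤ.+ + pos i ≡ + d (toℕ i)
  first-lam i = begin
    + k ℤ.- + lookup lam i ℤ.+ + pos i       ≡⟨ cong (ℤ._+ + pos i) (trans (ℤₚ.m-n≡m⊖n k (lookup lam i)) (ℤₚ.⊖-≥ (lam≤k i))) ⟩
    + (k ℕ.∸ lookup lam i ℕ.+ suc (toℕ i))   ≡⟨ cong +_ (ℕₚ.+-suc (k ℕ.∸ lookup lam i) (toℕ i)) ⟩
    + suc (k ℕ.∸ lookup lam i ℕ.+ toℕ i)     ≡⟨ cong +_ (sym (d-lam i)) ⟩
    + d (toℕ i) ∎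
    where open ≡-Reasoning

  private
    inΔ : Fin ℓ × Fin ℓ → Bool
    inΔ p = ⌊ pos (proj₁ p) ℕ.<? pos (proj₂ p) ⌋
            ∧ ⌊ (+ k ℤ.- + lookup lam (proj₁ p) ℤ.+ + pos (proj₁ p)) ℤ.<? + pos (proj₂ p) ⌋

  ∈-Δk⁻ : ∀ {i j} → (i , j) ∈ Δk k lam → d (toℕ i) ≤ toℕ j
  ∈-Δk⁻ {i} {j} β∈ = ℕ.s≤s⁻¹ (ℤₚ.drop‿+<+ (subst (ℤ._< + pos j) (first-lam i) (toWitness
    (proj₂ (Equivalence.to (T-∧ {⌊ pos i ℕ.<? pos j ⌋}) (proj₂ (∈-filter⁻ (T? ∘ inΔ) {xs = allPairs ℓ} β∈)))))))

  ∈-Δk⁺ : ∀ {i j} → d (toℕ i) ≤ toℕ j → (i , j) ∈ Δk k lam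
  ∈-Δk⁺ {i} {j} d≤j = ∈-filter⁺ (T? ∘ inΔ)
    (subst ((i , j) ∈_) (sym (allPairs-cartesian (allFin ℓ) (allFin ℓ))) (∈-cartesianProduct⁺ (∈-allFin i) (∈-allFin j)))
    (Equivalence.from (T-∧ {⌊ pos i ℕ.<? pos j ⌋})
      ( fromWitness (s≤s (ℕₚ.≤-trans (s≤s (ℕₚ.m≤n+m (toℕ i) (k ℕ.∸ lookup lam i))) (subst (_≤ toℕ j) (d-lam i) d≤j)))
      , fromWitness (subst (ℤ._< + pos j) (sym (first-lam i)) (ℤ.+<+ (s≤s d≤j)))))

  Δk-roots : map toℕ² (Δk k lam) ↭ roots ℓ d
  Δk-roots = unique-↭ (Uniqueₚ.map⁺ toℕ²-injective Δk-unique) (roots-unique ℓ d) to from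
    where
    toℕ²-injective : ∀ {β β′ : Fin ℓ × Fin ℓ} → toℕ² β ≡ toℕ² β′ → β ≡ β′
    toℕ²-injective eq = cong₂ _,_ (Finₚ.toℕ-injective (cong proj₁ eq)) (Finₚ.toℕ-injective (cong proj₂ eq))
    Δk-unique : Unique (Δk k lam)
    Δk-unique = Uniqueₚ.filter⁺ (T? ∘ inΔ) (subst Unique (sym (allPairs-cartesian (allFin ℓ) (allFin ℓ)))
      (Uniqueₚ.cartesianProduct⁺ (Uniqueₚ.allFin⁺ ℓ) (Uniqueₚ.allFin⁺ ℓ)))
    to : ∀ {β} → β ∈ map toℕ² (Δk k lam) → β ∈ roots ℓ d
    to β∈ with ((i , j) , β′∈ , refl) ← ∈-map⁻ toℕ² β∈ = ∈-roots⁺ (Finₚ.toℕ<n i) (Finₚ.toℕ<n j) (∈-Δk⁻ β′∈)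
    from : ∀ {β} → β ∈ roots ℓ d → β ∈ map toℕ² (Δk k lam)
    from {a , b} β∈ with (a<ℓ , b<ℓ , d≤b) ← ∈-roots⁻ {ℓ} {d} β∈ =
      subst (_∈ map toℕ² (Δk k lam)) (cong₂ _,_ (Finₚ.toℕ-fromℕ< a<ℓ) (Finₚ.toℕ-fromℕ< b<ℓ))
        (∈-map⁺ toℕ² (∈-Δk⁺ {Fin.fromℕ< a<ℓ} {Fin.fromℕ< b<ℓ}
          (subst₂ (λ x y → d x ≤ y) (sym (Finₚ.toℕ-fromℕ< a<ℓ)) (sym (Finₚ.toℕ-fromℕ< b<ℓ)) d≤b)))

  Lmult-roots : map toℕ (Lmult (Δk k lam)) ↭ map proj₂ (roots ℓ d)
  Lmult-roots = ↭-trans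
    (Perm.↭-reflexive (trans (sym (Listₚ.map-∘ (Δk k lam))) (Listₚ.map-∘ (Δk k lam))))
    (Permₚ.map⁺ proj₂ Δk-roots)

  bottom-≥ : ∀ i → d (toℕ i) < ℓ → pos i ≤ bottom k lam
  bottom-≥ i d<ℓ = go (Δk k lam) (∈-Δk⁺ {i} {Fin.fromℕ< d<ℓ} (ℕₚ.≤-reflexive (sym (Finₚ.toℕ-fromℕ< d<ℓ))))
    where
    go : ∀ Ψ {j} → (i , j) ∈ Ψ → pos i ≤ foldr (λ p acc → pos (proj₁ p) ℕ.⊔ acc) 0 Ψ
    go (_ ∷ Ψ) (here refl) = ℕₚ.m≤m⊔n (pos i) (foldr (λ p acc → pos (proj₁ p) ℕ.⊔ acc) 0 Ψ)
    go (β ∷ Ψ) (there β∈)  = ℕₚ.≤-trans (go Ψ β∈) (ℕₚ.m≤n⊔m (pos (proj₁ β)) _)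

-- Weight multisets and trailing zeros

removeOne-↭ : ∀ {ℓ c} (js : List (Fin ℓ)) → c ∈ map toℕ js → map toℕ js ↭ c ∷ map toℕ (removeOne (+ suc c) js)
removeOne-↭ {c = c} (j ∷ js) c∈ with + pos j ℤ.≟ + suc c | c∈
... | yes eq | _ = Perm.↭-reflexive (cong (_∷ map toℕ js) (ℕₚ.suc-injective (ℤₚ.+-injective eq)))
... | no ne  | here refl = contradiction refl ne
... | no ne  | there c∈′ = ↭-trans (Perm.prep (toℕ j) (removeOne-↭ js c∈′)) (Perm.swap (toℕ j) c Perm.refl)

removeOne-outside : ∀ {ℓ c} (js : List (Fin ℓ)) → ℓ ≤ c → removeOne (+ suc c) js ≡ js
removeOne-outside [] ℓ≤c = refl
removeOne-outside {c = c} (j ∷ js) ℓ≤c with + pos j ℤ.≟ + suc c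
... | yes eq = contradiction (ℕₚ.suc-injective (ℤₚ.+-injective eq)) (ℕₚ.<⇒≢ (ℕₚ.<-≤-trans (Finₚ.toℕ<n j) ℓ≤c))
... | no _   = cong (j ∷_) (removeOne-outside js ℓ≤c)

bumps : ∀ {ℓ} → List (Fin ℓ) → (ℕ → ℕ) → ℕ → ℕ
bumps xs d = foldr (λ x → bump (toℕ x)) d xs

bumps-∉ : ∀ {ℓ} (xs : List (Fin ℓ)) d {x} → x ∉ xs → bumps xs d (toℕ x) ≡ d (toℕ x)
bumps-∉ []       d x∉ = refl
bumps-∉ (y ∷ xs) d x∉ = trans
  (RemovesFrom.other (bump-removes (toℕ y) (bumps xs d)) _ (λ eq → x∉ (here (Finₚ.toℕ-injective eq))))
  (bumps-∉ xs d (x∉ ∘ there))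

bumps-∈ : ∀ {ℓ} {xs : List (Fin ℓ)} d {x} → Unique xs → x ∈ xs → bumps xs d (toℕ x) ≡ suc (d (toℕ x))
bumps-∈ {xs = y ∷ xs} d (y∉ ∷ u) (here refl) = trans
  (RemovesFrom.after (bump-removes (toℕ y) (bumps xs d)))
  (cong suc (bumps-∉ xs d (λ y∈ → All.lookup y∉ y∈ refl)))
bumps-∈ {xs = y ∷ xs} d (y∉ ∷ u) (there x∈) = trans
  (RemovesFrom.other (bump-removes (toℕ y) (bumps xs d)) _ (λ eq → All.lookup y∉ x∈ (sym (Finₚ.toℕ-injective eq))))
  (bumps-∈ d u x∈)

module _ (k : ℕ) {ℓ : ℕ} (lam : Vec ℕ ℓ) (lam≤k : ∀ i → lookup lam i ≤ k)
         (d : ℕ → ℕ) (d-lam : ∀ i → d (toℕ i) ≡ suc (k ℕ.∸ lookup lam i ℕ.+ toℕ i)) where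

  down-value : ∀ x → down k lam x ≡ + suc (d (toℕ x))
  down-value x = trans (cong (ℤ._+ 1ℤ) (first-lam k lam lam≤k d d-lam x)) (cong +_ (ℕₚ.+-comm (d (toℕ x)) 1))

  -- `removeOne` deletes some entry equal to down(x), possibly one contributed by another row; as a
  -- multiset of columns this is the same as delaying row x. If down(x) lies outside, neither side
  -- changes.
  removals-roots : ∀ xs → Unique xs →
    map toℕ (foldr (λ x acc → removeOne (down k lam x) acc) (Lmult (Δk k lam)) xs) ↭ map proj₂ (roots ℓ (bumps xs d))
  removals-roots []       _        = Lmult-roots k lam lam≤k d d-lam
  removals-roots (x ∷ xs) (x∉ ∷ u) rewrite down-value x = remove (d (toℕ x) ℕ.<? ℓ)
    where
    js = foldr (λ x acc → removeOne (down k lam x) acc) (Lmult (Δk k lam)) xs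
    c = d (toℕ x)
    removal : RemovesFrom (bumps xs d) (toℕ x) c (bumps (x ∷ xs) d)
    removal = subst (λ c → RemovesFrom (bumps xs d) (toℕ x) c (bumps (x ∷ xs) d))
      (bumps-∉ xs d (λ x∈ → All.lookup x∉ x∈ refl)) (bump-removes (toℕ x) (bumps xs d))
    remove : Dec (c < ℓ) → map toℕ (removeOne (+ suc c) js) ↭ map proj₂ (roots ℓ (bumps (x ∷ xs) d))
    remove (yes c<ℓ) = Permₚ.drop-∷ (↭-trans (↭-sym (removeOne-↭ js c∈)) js↭)
      where
      js↭ : map toℕ js ↭ c ∷ map proj₂ (roots ℓ (bumps (x ∷ xs) d))
      js↭ = ↭-trans (removals-roots xs u) (Permₚ.map⁺ proj₂ (roots-remove removal (Finₚ.toℕ<n x) c<ℓ))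
      c∈ : c ∈ map toℕ js
      c∈ = Permₚ.∈-resp-↭ (↭-sym js↭) (here refl)
    remove (no c≮ℓ) = ↭-trans
      (Perm.↭-reflexive (cong (map toℕ) (removeOne-outside js (ℕₚ.≮⇒≥ c≮ℓ))))
      (↭-trans (removals-roots xs u) (Permₚ.map⁺ proj₂ (roots-remove-outside removal (ℕₚ.≮⇒≥ c≮ℓ))))

  weightMult-roots : ∀ z → map toℕ (weightMult k lam (suc z)) ↭ map proj₂ (roots ℓ (marks z d))
  weightMult-roots z = ↭-trans (removals-roots xs xs-unique) (Permₚ.map⁺ proj₂ (roots-↭ to from))
    where
    inRange : Fin ℓ → Bool
    inRange x = ⌊ suc z ℕ.≤? pos x ⌋ ∧ ⌊ pos x ℕ.≤? bottom k lam ⌋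
    xs = filterᵇ inRange (allFin ℓ)
    xs-unique : Unique xs
    xs-unique = Uniqueₚ.filter⁺ (T? ∘ inRange) (Uniqueₚ.allFin⁺ ℓ)
    bumped : ∀ x → z ≤ toℕ x → pos x ≤ bottom k lam → bumps xs d (toℕ x) ≡ suc (d (toℕ x))
    bumped x z≤x x≤b = bumps-∈ d xs-unique (∈-filter⁺ (T? ∘ inRange) (∈-allFin x)
      (Equivalence.from (T-∧ {⌊ suc z ℕ.≤? pos x ⌋}) (fromWitness (s≤s z≤x) , fromWitness x≤b)))
    unbumped : ∀ x → toℕ x < z → bumps xs d (toℕ x) ≡ d (toℕ x)
    unbumped x x<z = bumps-∉ xs d (λ x∈ → ℕₚ.<⇒≱ x<z (ℕ.s≤s⁻¹ (toWitness (proj₁ (Equivalence.to (T-∧ {⌊ suc z ℕ.≤? pos x ⌋})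
      (proj₂ (∈-filter⁻ (T? ∘ inRange) {xs = allFin ℓ} x∈)))))))
    -- Rows below the bottom are not bumped, but they contain no roots either way.
    agree : ∀ x → d (toℕ x) < ℓ → bumps xs d (toℕ x) ≡ marks z d (toℕ x)
    agree x d<ℓ with toℕ x ℕ.<? z
    ... | yes x<z = unbumped x x<z
    ... | no x≮z  = bumped x (ℕₚ.≮⇒≥ x≮z) (bottom-≥ k lam lam≤k d d-lam x d<ℓ)
    d≤bumps : ∀ xs x → d (toℕ {ℓ} x) ≤ bumps xs d (toℕ x)
    d≤bumps []       x = ℕₚ.≤-refl
    d≤bumps (y ∷ xs) x with toℕ x ℕ.≟ toℕ y
    ... | yes _ = ℕₚ.m≤n⇒m≤1+n (d≤bumps xs x)
    ... | no _  = d≤bumps xs x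
    d≤marks : ∀ i → d i ≤ marks z d i
    d≤marks i with i ℕ.<? z
    ... | yes _ = ℕₚ.≤-refl
    ... | no _  = ℕₚ.n≤1+n (d i)
    agree′ : ∀ {i} (i<ℓ : i < ℓ) → d i < ℓ → bumps xs d i ≡ marks z d i
    agree′ i<ℓ = subst (λ i → d i < ℓ → bumps xs d i ≡ marks z d i) (Finₚ.toℕ-fromℕ< i<ℓ) (agree (Fin.fromℕ< i<ℓ))
    to : ∀ {i j} → i < ℓ → j < ℓ → bumps xs d i ≤ j → marks z d i ≤ j
    to {i} {j} i<ℓ j<ℓ b≤j = subst (_≤ j) (agree′ i<ℓ (ℕₚ.≤-<-trans (ℕₚ.≤-trans
      (subst (λ i → d i ≤ bumps xs d i) (Finₚ.toℕ-fromℕ< i<ℓ) (d≤bumps xs (Fin.fromℕ< i<ℓ))) b≤j) j<ℓ)) b≤j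
    from : ∀ {i j} → i < ℓ → j < ℓ → marks z d i ≤ j → bumps xs d i ≤ j
    from {i} {j} i<ℓ j<ℓ m≤j =
      subst (_≤ j) (sym (agree′ i<ℓ (ℕₚ.≤-<-trans (ℕₚ.≤-trans (d≤marks i) m≤j) j<ℓ))) m≤j

-- At a weight with γ_ℓ = 0 every operator touching coordinate ℓ acts as the identity on functions
-- vanishing for γ_ℓ < 0.
record StripsTo (ℓ : ℕ) (F F′ : Fn) : Set where
  constructor strips
  field
    agree : ∀ γ → γ ℓ ≡ 0ℤ → ap F γ ≡ ap F′ γ
    below : VanishesBelow ℓ F

op-strip-both : ∀ {ℓ P F F′} → All (λ t → proj₂ t ℓ ≡ 0ℤ) P → StripsTo ℓ F F′ → StripsTo ℓ (op P F) (op P F′)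
op-strip-both {ℓ} {P} {F} {F′} P≡0 (strips agree below) =
  strips (go P≡0) (op-vanishesBelow (All.map (λ eq → ℤₚ.≤-reflexive eq) P≡0) below)
  where
  go : ∀ {P} → All (λ t → proj₂ t ℓ ≡ 0ℤ) P → ∀ γ → γ ℓ ≡ 0ℤ → opValue P F γ ≡ opValue P F′ γ
  go []                       γ γ≡0 = refl
  go {(c , δ) ∷ P} (δ≡0 ∷ P≡0) γ γ≡0 =
    cong₂ (λ x y → c ℤ.* x ℤ.+ y) (agree (γ ∔ δ) (cong₂ ℤ._+_ γ≡0 δ≡0)) (go P≡0 γ γ≡0)

low-strip : ∀ {ℓ F F′} → StripsTo ℓ F F′ → StripsTo ℓ (op (low ℓ) F) F′
low-strip {ℓ} {F} {F′} (strips agree below) = strips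
  (λ γ γ≡0 → trans (low-value ℓ F γ)
    (trans (cong₂ ℤ._-_ (agree γ γ≡0) (below (γ ∔ -ε ℓ) (negative γ γ≡0))) (ℤₚ.+-identityʳ _)))
  (op-vanishesBelow {P = low ℓ} {F} (low-nonRaising ℓ ℓ) below)
  where
  negative : ∀ γ → γ ℓ ≡ 0ℤ → (γ ∔ -ε ℓ) ℓ ℤ.< 0ℤ
  negative γ γ≡0 rewrite γ≡0 | unit-same ℓ = ℤ.-<+

geom-strip : ∀ {ℓ i F F′} N → i ≢ ℓ → StripsTo ℓ F F′ → StripsTo ℓ (op (geom N (i , ℓ)) F) F′
geom-strip {ℓ} {i} {F} {F′} N i≢ℓ (strips agree below) = strips
  (λ γ γ≡0 → trans (geom-value N (i , ℓ) F γ)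
    (trans (cong₂ ℤ._+_
             (trans (ext F (λ a → ℤₚ.+-identityʳ (γ a))) (agree γ γ≡0))
             (trans (sumTo-cong N (λ n _ → below (γ ∔ (+ suc n) · root (i , ℓ)) (negative γ γ≡0 n))) (sumTo-zero N)))
           (ℤₚ.+-identityʳ _)))
  (op-vanishesBelow {P = geom N (i , ℓ)} (geom-nonRaising {j = ℓ} N i≢ℓ) below)
  where
  negative : ∀ γ → γ ℓ ≡ 0ℤ → ∀ n → (γ ∔ (+ suc n) · root (i , ℓ)) ℓ ℤ.< 0ℤ
  negative γ γ≡0 n rewrite γ≡0 | unit-same ℓ | unit-diff i≢ℓ =
    subst (ℤ._< 0ℤ) (sym (trans (ℤₚ.+-identityˡ _) (trans (ℤₚ.*-comm (+ suc n) -1ℤ) (ℤₚ.-1*i≡-i (+ suc n))))) ℤ.-<+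

leftOf : ℕ → List (ℕ × ℕ) → List (ℕ × ℕ)
leftOf ℓ = filter (λ β → proj₂ β ℕ.<? ℓ)

geoms-strip : ∀ {ℓ N Ψ F F′} → All (Positive (suc ℓ)) Ψ → StripsTo ℓ F F′ →
  StripsTo ℓ (prod (map (geom N) Ψ) F) (prod (map (geom N) (leftOf ℓ Ψ)) F′)
geoms-strip [] st = st
geoms-strip {ℓ} {N} {(i , j) ∷ Ψ} {F} {F′} ((i<j , j≤ℓ) ∷ pos) st with j ℕ.<? ℓ
... | yes j<ℓ rewrite Listₚ.filter-accept (λ β → proj₂ β ℕ.<? ℓ) {x = i , j} {xs = Ψ} j<ℓ =
  op-strip-both {P = geom N (i , j)} (Allₚ.applyUpTo⁺₂ (λ n → 1ℤ , (+ n) · root (i , j)) (suc N)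
    (λ n → trans (cong₂ (λ u v → + n ℤ.* (u ℤ.- v)) (unit-diff (ℕₚ.<⇒≢ (ℕₚ.<-trans i<j j<ℓ))) (unit-diff (ℕₚ.<⇒≢ j<ℓ)))
                 (ℤₚ.*-zeroʳ (+ n))))
    (geoms-strip pos st)
... | no j≮ℓ rewrite Listₚ.filter-reject (λ β → proj₂ β ℕ.<? ℓ) {x = i , j} {xs = Ψ} j≮ℓ
  with refl ← ℕₚ.≤-antisym (ℕ.s≤s⁻¹ j≤ℓ) (ℕₚ.≮⇒≥ j≮ℓ) = geom-strip N (ℕₚ.<⇒≢ i<j) (geoms-strip pos st)

lows-strip : ∀ {ℓ Φ F F′} → All (λ β → proj₂ β < suc ℓ) Φ → StripsTo ℓ F F′ →
  StripsTo ℓ (prod (map (low ∘ proj₂) Φ) F) (prod (map (low ∘ proj₂) (leftOf ℓ Φ)) F′)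
lows-strip [] st = st
lows-strip {ℓ} {(i , j) ∷ Φ} {F} {F′} (j≤ℓ ∷ Φ≤) st with j ℕ.<? ℓ
... | yes j<ℓ rewrite Listₚ.filter-accept (λ β → proj₂ β ℕ.<? ℓ) {x = i , j} {xs = Φ} j<ℓ =
  op-strip-both {P = low j} (refl ∷ cong (-1ℤ ℤ.*_) (unit-diff (ℕₚ.<⇒≢ j<ℓ)) ∷ []) (lows-strip Φ≤ st)
... | no j≮ℓ rewrite Listₚ.filter-reject (λ β → proj₂ β ℕ.<? ℓ) {x = i , j} {xs = Φ} j≮ℓ
  with refl ← ℕₚ.≤-antisym (ℕ.s≤s⁻¹ j≤ℓ) (ℕₚ.≮⇒≥ j≮ℓ) = low-strip (lows-strip Φ≤ st)

leftOf-roots : ∀ {ℓ d} → (∀ i → i < d i) → leftOf ℓ (roots (suc ℓ) d) ↭ roots ℓ d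
leftOf-roots {ℓ} {d} i<d = unique-↭ (Uniqueₚ.filter⁺ _ (roots-unique (suc ℓ) d)) (roots-unique ℓ d)
  (λ {β} β∈ → let (β∈′ , j<ℓ) = ∈-filter⁻ (λ β → proj₂ β ℕ.<? ℓ) {xs = roots (suc ℓ) d} β∈
                  (_ , _ , d≤j) = ∈-roots⁻ {suc ℓ} {d} β∈′
              in ∈-roots⁺ (ℕₚ.<-trans (ℕₚ.<-≤-trans (i<d (proj₁ β)) d≤j) j<ℓ) j<ℓ d≤j)
  (λ β∈ → let (i<ℓ , j<ℓ , d≤j) = ∈-roots⁻ {ℓ} {d} β∈
          in ∈-filter⁺ (λ β → proj₂ β ℕ.<? ℓ) (∈-roots⁺ {d = d} (ℕₚ.m≤n⇒m≤1+n i<ℓ) (ℕₚ.m≤n⇒m≤1+n j<ℓ) d≤j) j<ℓ)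

-- This removes one zero of the padding that separates the partitions of the expansion from their
-- lists of positive parts.
katalan-strip : ∀ φ N ℓ {e d γ} → (∀ i → i < e i) → (∀ i → i < d i) → γ ℓ ≡ 0ℤ →
  ap (katalan N (gFn φ (suc ℓ)) (roots (suc ℓ) e) (roots (suc ℓ) d)) γ
  ≡ ap (katalan N (gFn φ ℓ) (roots ℓ e) (roots ℓ d)) γ
katalan-strip φ N ℓ {e} {d} {γ} i<e i<d γ≡0 = begin
  ap (katalan N (gFn φ (suc ℓ)) (roots (suc ℓ) e) (roots (suc ℓ) d)) γ
    ≡⟨ cong (λ F → ap F γ) (katalan-split N (gFn φ (suc ℓ)) (roots (suc ℓ) e) (roots (suc ℓ) d)) ⟩
  ap (prod (map (low ∘ proj₂) (roots (suc ℓ) e)) (prod (map (geom N) (roots (suc ℓ) d)) (gFn φ (suc ℓ)))) γ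
    ≡⟨ StripsTo.agree (lows-strip (roots-column (suc ℓ) e) (geoms-strip {N = N} (roots-positive (suc ℓ) i<d)
         (strips (gFn-strip φ ℓ) (gFn-vanishing φ (suc ℓ) ℓ refl)))) γ γ≡0 ⟩
  ap (prod (map (low ∘ proj₂) (leftOf ℓ (roots (suc ℓ) e))) (prod (map (geom N) (leftOf ℓ (roots (suc ℓ) d))) (gFn φ ℓ))) γ
    ≡⟨ cong (λ F → ap F γ) (sym (katalan-split N (gFn φ ℓ) (leftOf ℓ (roots (suc ℓ) e)) (leftOf ℓ (roots (suc ℓ) d)))) ⟩
  ap (katalan N (gFn φ ℓ) (leftOf ℓ (roots (suc ℓ) e)) (leftOf ℓ (roots (suc ℓ) d))) γ
    ≡⟨ katalan-↭ N (gFn φ ℓ) (leftOf-roots i<e) (leftOf-roots i<d) γ ⟩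
  ap (katalan N (gFn φ ℓ) (roots ℓ e) (roots ℓ d)) γ ∎
  where open ≡-Reasoning

-- The K-k-Schur expansion

entryAt : List ℕ → ℕ → ℕ
entryAt []       _       = 0
entryAt (a ∷ as) zero    = a
entryAt (a ∷ as) (suc n) = entryAt as n

entryAt-unique : (f : List ℕ → ℕ → ℕ) → (∀ n → f [] n ≡ 0) → (∀ a as → f (a ∷ as) 0 ≡ a) →
  (∀ a as n → f (a ∷ as) (suc n) ≡ f as n) → ∀ as n → f as n ≡ entryAt as n
entryAt-unique f nil head tail []       n       = nil n
entryAt-unique f nil head tail (a ∷ as) zero    = head a as
entryAt-unique f nil head tail (a ∷ as) (suc n) = trans (tail a as n) (entryAt-unique f nil head tail as n)

-- The local function of ent has no name of its own; it is recovered here by unification.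
mutual
  ent-local : ∀ {ℓ} → Vec ℕ ℓ → ℕ → List ℕ → ℕ → ℕ
  ent-local = _

  ent-unfold : ∀ {ℓ} (lam : Vec ℕ ℓ) x → ent lam x ≡ ent-local lam x (toList lam) (x ℕ.∸ 1)
  ent-unfold lam x with toList lam | x ℕ.∸ 1
  ... | as | n = refl

ent-entryAt : ∀ {ℓ} (lam : Vec ℕ ℓ) x → ent lam x ≡ entryAt (toList lam) (x ℕ.∸ 1)
ent-entryAt lam x = trans (ent-unfold lam x)
  (entryAt-unique (ent-local lam x) (λ _ → refl) (λ _ _ → refl) (λ _ _ _ → refl) (toList lam) (x ℕ.∸ 1))

entryAt-lookup : ∀ {ℓ} (lam : Vec ℕ ℓ) i → entryAt (toList lam) (toℕ i) ≡ lookup lam i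
entryAt-lookup (a Vec.∷ lam) Fin.zero    = refl
entryAt-lookup (a Vec.∷ lam) (Fin.suc i) = entryAt-lookup lam i

entryAt-fromList : ∀ (μ : List ℕ) i → entryAt μ (toℕ i) ≡ lookup (fromList μ) i
entryAt-fromList (a ∷ μ) Fin.zero    = refl
entryAt-fromList (a ∷ μ) (Fin.suc i) = entryAt-fromList μ i

entryAt-outside : ∀ {ℓ} (lam : Vec ℕ ℓ) {i} → ℓ ≤ i → entryAt (toList lam) i ≡ 0
entryAt-outside Vec.[]        _         = refl
entryAt-outside (a Vec.∷ lam) (s≤s ℓ≤i) = entryAt-outside lam ℓ≤i

entryAt-applyUpTo : ∀ (f : ℕ → ℕ) n {i} → i < n → entryAt (applyUpTo f n) i ≡ f i
entryAt-applyUpTo f (suc n) {zero}  _         = refl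
entryAt-applyUpTo f (suc n) {suc i} (s≤s i<n) = entryAt-applyUpTo (f ∘ suc) n i<n

sum-entryAt : ∀ {ℓ} (lam : Vec ℕ ℓ) → size lam ≡ sumℕ (entryAt (toList lam)) ℓ
sum-entryAt Vec.[]        = refl
sum-entryAt (a Vec.∷ lam) = cong (ℕ._+_ a) (sum-entryAt lam)

sum-applyUpTo : ∀ f n → sum (applyUpTo f n) ≡ sumℕ f n
sum-applyUpTo f zero    = refl
sum-applyUpTo f (suc n) = cong (ℕ._+_ (f 0)) (sum-applyUpTo (f ∘ suc) n)

sumℕ-suc : ∀ f n → sumℕ f (suc n) ≡ sumℕ f n ℕ.+ f n
sumℕ-suc f zero    = ℕₚ.+-comm (f 0) 0
sumℕ-suc f (suc n) = trans (cong (ℕ._+_ (f 0)) (sumℕ-suc (f ∘ suc) n)) (sym (ℕₚ.+-assoc (f 0) _ _))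

open Partition

vectorPartition : ∀ {k ℓ} (lam : Vec ℕ ℓ) → InP k ℓ lam → Partition k ℓ
vectorPartition {k} {ℓ} lam (lam≤k , lam-dec) = record
  { part       = entryAt (toList lam)
  ; decreasing = decreasing′
  ; bounded    = bounded′
  ; finite     = λ i ℓ≤i → entryAt-outside lam ℓ≤i
  }
  where
  at : ∀ {i} (i<ℓ : i < ℓ) → entryAt (toList lam) i ≡ lookup lam (Fin.fromℕ< i<ℓ)
  at i<ℓ = trans (cong (entryAt (toList lam)) (sym (Finₚ.toℕ-fromℕ< i<ℓ))) (entryAt-lookup lam (Fin.fromℕ< i<ℓ))
  bounded′ : ∀ i → entryAt (toList lam) i ≤ k
  bounded′ i with i ℕ.<? ℓ
  ... | yes i<ℓ = subst (_≤ k) (sym (at i<ℓ)) (lam≤k _)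
  ... | no i≮ℓ  = subst (_≤ k) (sym (entryAt-outside lam (ℕₚ.≮⇒≥ i≮ℓ))) z≤n
  decreasing′ : ∀ i → entryAt (toList lam) (suc i) ≤ entryAt (toList lam) i
  decreasing′ i with suc i ℕ.<? ℓ
  ... | no si≮ℓ  = subst (_≤ entryAt (toList lam) i) (sym (entryAt-outside lam (ℕₚ.≮⇒≥ si≮ℓ))) z≤n
  ... | yes si<ℓ = subst₂ _≤_ (sym (at si<ℓ)) (sym (at i<ℓ)) (lam-dec _ _
    (subst₂ _≤_ (sym (Finₚ.toℕ-fromℕ< i<ℓ)) (sym (Finₚ.toℕ-fromℕ< si<ℓ)) (ℕₚ.n≤1+n i)))
    where i<ℓ = ℕₚ.<-trans (ℕₚ.n<1+n i) si<ℓ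

module _ {k : ℕ} where

  schur : ∀ {ℓ} → Partition k ℓ → (Mono → ℤ) → ℕ → ℤ
  schur {ℓ} q φ N = Alternation.weighted k ℓ (depth ℓ) q 0 (environment φ ℓ N)

  -- A truncation bound computed from μ alone, so that the limit can be chosen as a function of μ.
  threshold : List ℕ → ℕ
  threshold μ = ℤ.∣ Truncation.ht (length μ) 0 (λ i → + entryAt μ i) ℤ.+ + depth (length μ) ∣

  i≤+∣i∣ : ∀ i → i ℤ.≤ + ℤ.∣ i ∣
  i≤+∣i∣ (+ n)    = ℤₚ.≤-refl
  i≤+∣i∣ -[1+ n ] = ℤ.-≤+

  marks-above : ∀ {ℓ} (q : Partition k ℓ) z i → i < marks z (first q) i
  marks-above q z i with i ℕ.<? z
  ... | yes _ = above q i
  ... | no _  = ℕₚ.m≤n⇒m≤1+n (above q i)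

  record Stripped {ℓ : ℕ} (q : Partition k ℓ) : Set where
    field
      parts      : List ℕ
      kbounded   : KBddPartition k parts
      total      : sum parts ≡ sumℕ (part q) ℓ
      schur-kk   : ∀ φ N → ev φ (KkSchurTrunc k parts N) ≡ schur q φ N
      stable     : ∀ φ N → threshold parts ≤ N →
                   ev φ (KkSchurTrunc k parts N) ≡ ev φ (KkSchurTrunc k parts (threshold parts))

  KkSchur-schur : ∀ {ℓ} (q : Partition k ℓ) μ → length μ ≡ ℓ → (∀ i → i < ℓ → entryAt μ i ≡ part q i) →
    ∀ φ N → ev φ (KkSchurTrunc k μ N) ≡ schur q φ N
  KkSchur-schur {ℓ} q μ refl μ-q φ N =
    katTrunc-value φ N {Φ = roots ℓ (marks 0 (first q))}
      (Lmult-roots (suc k) v (λ i → ℕₚ.m≤n⇒m≤1+n (v≤k i)) (marks 0 (first q)) marked)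
      (Δk-roots k v v≤k (first q) (λ i → cong (λ x → suc (k ℕ.∸ x ℕ.+ toℕ i)) (v-q i)))
      (λ i → cong +_ (sym (v-q i)))
    where
    v = fromList μ
    v-q : ∀ i → part q (toℕ i) ≡ lookup v i
    v-q i = trans (sym (μ-q (toℕ i) (Finₚ.toℕ<n i))) (entryAt-fromList μ i)
    v≤k : ∀ i → lookup v i ≤ k
    v≤k i = subst (_≤ k) (v-q i) (bounded q (toℕ i))
    -- Raising k by one delays every row by one column, just as `marks 0` does; hence L(Δ^{k+1}(μ))
    -- is the multiset for z = 0.
    marked : ∀ i → marks 0 (first q) (toℕ i) ≡ suc (suc k ℕ.∸ lookup v i ℕ.+ toℕ i)
    marked i = trans (marks-≥ {0} {first q} {toℕ i} z≤n)
      (cong suc (trans (cong (λ x → suc (k ℕ.∸ x ℕ.+ toℕ i)) (v-q i))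
                       (cong (ℕ._+ toℕ i) (sym (ℕₚ.+-∸-assoc 1 (v≤k i))))))

  strip-full : ∀ {ℓ} (q : Partition k ℓ) → (∀ i → i < ℓ → 1 ≤ part q i) → Stripped q
  strip-full {ℓ} q q≥1 = record
    { parts    = μ
    ; kbounded = Allₚ.applyUpTo⁺₁ (part q) ℓ (λ {i} i<ℓ → q≥1 i i<ℓ , bounded q i)
               , Linkedₚ.applyUpTo⁺₂ (part q) ℓ (decreasing q)
    ; total    = sum-applyUpTo (part q) ℓ
    ; schur-kk = schur-kk
    ; stable   = λ φ N N≥ → trans (schur-kk φ N) (trans (stable φ N N≥) (sym (schur-kk φ (threshold μ))))
    }
    where
    μ = applyUpTo (part q) ℓ
    len : length μ ≡ ℓ
    len = Listₚ.length-applyUpTo (part q) ℓ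
    schur-kk : ∀ φ N → ev φ (KkSchurTrunc k μ N) ≡ schur q φ N
    schur-kk = KkSchur-schur q μ len (λ i i<ℓ → entryAt-applyUpTo (part q) ℓ i<ℓ)
    bound : Truncation.ht ℓ (depth ℓ) (weight q) ℤ.+ + depth ℓ ℤ.≤ + threshold μ
    bound = subst (ℤ._≤ + threshold μ)
      (trans (cong (λ n → Truncation.ht n 0 (λ i → + entryAt μ i) ℤ.+ + depth n) len)
             (cong (ℤ._+ + depth ℓ) (sumTo-cong ℓ (λ i i<ℓ → cong (λ x → + i ℤ.* + x) (entryAt-applyUpTo (part q) ℓ i<ℓ)))))
      (i≤+∣i∣ _)
    stable : ∀ φ N → threshold μ ≤ N → schur q φ N ≡ schur q φ (threshold μ)
    stable φ N N≥ = subst (λ M → schur q φ M ≡ schur q φ (threshold μ)) (ℕₚ.m∸n+n≡m N≥)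
      (Truncation.katalan-stable ℓ (depth ℓ) {Φ = roots ℓ (marks 0 (first q))} {γ = weight q} (gFn-supported φ ℓ)
        (roots-column ℓ (marks 0 (first q)))
        (roots-positive ℓ (above q)) bound (N ℕ.∸ threshold μ))

  strip : ∀ {ℓ} (q : Partition k ℓ) → Stripped q
  strip {zero}  q = strip-full q (λ _ ())
  strip {suc ℓ} q with part q ℓ ℕ.≟ 0
  ... | no q≢0  = strip-full q (λ i i≤ℓ → ℕₚ.≤-trans (ℕₚ.n≢0⇒n>0 q≢0) (antitone q (ℕ.s≤s⁻¹ i≤ℓ)))
  ... | yes q≡0 = record
    { parts    = parts
    ; kbounded = kbounded
    ; total    = trans total (sym (trans (sumℕ-suc (part q) ℓ)
                   (trans (cong (ℕ._+_ (sumℕ (part q) ℓ)) q≡0) (ℕₚ.+-identityʳ _))))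
    ; schur-kk = λ φ N → trans (schur-kk φ N)
                   (sym (katalan-strip φ N ℓ (marks-above q 0) (above q) (cong +_ q≡0)))
    ; stable   = stable
    }
    where
    q⁻ : Partition k ℓ
    q⁻ = record
      { part       = part q
      ; decreasing = decreasing q
      ; bounded    = bounded q
      ; finite     = λ i ℓ≤i → ℕₚ.n≤0⇒n≡0 (subst (part q i ≤_) q≡0 (antitone q ℓ≤i))
      }
    open Stripped (strip q⁻)

-- Collecting equal partitions into one coefficient

pairing : (List ℕ → ℤ) → List (List ℕ × ℤ) → ℤ
pairing X bs = foldr (λ t acc → proj₂ t ℤ.* X (proj₁ t) ℤ.+ acc) 0ℤ bs

ev-linComb : ∀ φ G bs → ev φ (linComb G bs) ≡ pairing (λ μ → ev φ (G μ)) bs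
ev-linComb φ G []             = refl
ev-linComb φ G ((μ , c) ∷ bs) =
  trans (ev-++ φ (scaleS c (G μ)) (linComb G bs)) (cong₂ ℤ._+_ (ev-scale φ c (G μ)) (ev-linComb φ G bs))

_≟ᴸ_ : (μ ν : List ℕ) → Dec (μ ≡ ν)
_≟ᴸ_ = Listₚ.≡-dec ℕ._≟_

-- Merging keeps the indices distinct. In `collect` all terms with the same μ carry the sign
-- determined by |μ|, so nothing cancels.
addTerm : List ℕ → ℤ → List (List ℕ × ℤ) → List (List ℕ × ℤ)
addTerm μ c []             = (μ , c) ∷ []
addTerm μ c ((ν , x) ∷ bs) with μ ≟ᴸ ν
... | yes _ = (ν , c ℤ.+ x) ∷ bs
... | no  _ = (ν , x) ∷ addTerm μ c bs

addTerm-pairing : ∀ X μ c bs → pairing X (addTerm μ c bs) ≡ c ℤ.* X μ ℤ.+ pairing X bs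
addTerm-pairing X μ c []             = refl
addTerm-pairing X μ c ((ν , x) ∷ bs) with μ ≟ᴸ ν
... | yes refl = lemma c x (X μ) (pairing X bs)
  where
  lemma : ∀ c x y p → (c ℤ.+ x) ℤ.* y ℤ.+ p ≡ c ℤ.* y ℤ.+ (x ℤ.* y ℤ.+ p)
  lemma = solve-∀
... | no _ = trans (cong (λ p → x ℤ.* X ν ℤ.+ p) (addTerm-pairing X μ c bs))
                   (lemma (x ℤ.* X ν) (c ℤ.* X μ) (pairing X bs))
  where
  lemma : ∀ a b p → a ℤ.+ (b ℤ.+ p) ≡ b ℤ.+ (a ℤ.+ p)
  lemma = solve-∀

addTerm-all : ∀ {P : List ℕ × ℤ → Set} {μ c bs} → (∀ {x} → P (μ , x) → P (μ , c ℤ.+ x)) → P (μ , c) →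
  All P bs → All P (addTerm μ c bs)
addTerm-all {bs = []} add new [] = new ∷ []
addTerm-all {μ = μ} {bs = (ν , x) ∷ bs} add new (old ∷ olds) with μ ≟ᴸ ν
... | yes refl = add old ∷ olds
... | no _     = old ∷ addTerm-all add new olds

addTerm-unique : ∀ {μ c bs} → Unique (map proj₁ bs) → Unique (map proj₁ (addTerm μ c bs))
addTerm-unique {bs = []} [] = [] ∷ []
addTerm-unique {μ} {bs = (ν , x) ∷ bs} (ν∉ ∷ u) with μ ≟ᴸ ν
... | yes _   = ν∉ ∷ u
... | no μ≢ν  = Allₚ.map⁺ (addTerm-all (λ old → old) (λ ν≡μ → μ≢ν (sym ν≡μ)) (Allₚ.map⁻ ν∉)) ∷ addTerm-unique u

-- Reading off a coefficient is itself a linear functional, which brings identities valid for all φ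
-- back to symmetric functions.
coeff-ev : ∀ f m → coeff f m ≡ ev (λ m′ → if ⌊ Listₚ.≡-dec ℕ._≟_ m′ m ⌋ then 1ℤ else 0ℤ) f
coeff-ev [] m = refl
coeff-ev ((m′ , c) ∷ f) m = cong₂ ℤ._+_ (choose ⌊ Listₚ.≡-dec ℕ._≟_ m′ m ⌋) (coeff-ev f m)
  where
  choose : ∀ b → (if b then c else 0ℤ) ≡ c ℤ.* (if b then 1ℤ else 0ℤ)
  choose true  = sym (ℤₚ.*-identityʳ c)
  choose false = sym (ℤₚ.*-zeroʳ c)

signZ-square : ∀ n → signZ n ℤ.* signZ n ≡ 1ℤ
signZ-square zero    = refl
signZ-square (suc n) = trans (lemma (signZ n)) (signZ-square n)
  where
  lemma : ∀ x → ℤ.- x ℤ.* ℤ.- x ≡ x ℤ.* x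
  lemma = solve-∀

module _ {k ℓ : ℕ} (s : ℕ) where

  open Stripped

  collect : List (Partition k ℓ) → List (List ℕ × ℤ)
  collect []       = []
  collect (q ∷ qs) = addTerm (parts (strip q)) (signZ (s ℕ.+ sum (parts (strip q)))) (collect qs)

  collect-all : ∀ {P : List ℕ → Set} → (∀ q → P (parts (strip {k} {ℓ} q))) → ∀ qs → All (P ∘ proj₁) (collect qs)
  collect-all p []       = []
  collect-all p (q ∷ qs) = addTerm-all (λ old → old) (p q) (collect-all p qs)

  collect-unique : ∀ qs → Unique (map proj₁ (collect qs))
  collect-unique []       = []
  collect-unique (q ∷ qs) = addTerm-unique (collect-unique qs)

  collect-sign : ∀ qs → All (λ t → + 0 ℤ.≤ signZ (s ℕ.+ sum (proj₁ t)) ℤ.* proj₂ t) (collect qs)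
  collect-sign []       = []
  collect-sign (q ∷ qs) = addTerm-all
    -- σ (σ + x) = σ σ + σ x with σ σ = 1, so merging increases the signed coefficient.
    (λ {x} old → ℤₚ.≤-trans (ℤₚ.+-mono-≤ one old) (ℤₚ.≤-reflexive (sym (ℤₚ.*-distribˡ-+ σ σ x))))
    one (collect-sign qs)
    where
    σ = signZ (s ℕ.+ sum (parts (strip q)))
    one : + 0 ℤ.≤ σ ℤ.* σ
    one = subst (+ 0 ℤ.≤_) (sym (signZ-square (s ℕ.+ sum (parts (strip q))))) (ℤ.+≤+ z≤n)

  thresholds : List (Partition k ℓ) → ℕ
  thresholds []       = 0
  thresholds (q ∷ qs) = threshold {k} (parts (strip q)) ℕ.⊔ thresholds qs

  collect-value : ∀ φ N qs → thresholds qs ≤ N →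
    Alternation.combination k ℓ (depth ℓ) s qs (environment φ ℓ N)
    ≡ pairing (λ μ → ev φ (KkSchurTrunc k μ (threshold {k} μ))) (collect qs)
  collect-value φ N []       _  = refl
  collect-value φ N (q ∷ qs) N≥ = sym (trans
    (addTerm-pairing (λ μ → ev φ (KkSchurTrunc k μ (threshold {k} μ))) μ (signZ (s ℕ.+ sum μ)) (collect qs))
    (cong₂ ℤ._+_
      (cong₂ (λ n x → signZ (s ℕ.+ n) ℤ.* x) (total (strip q))
        (trans (sym (stable (strip q) φ N (ℕₚ.≤-trans (ℕₚ.m≤m⊔n (threshold {k} μ) (thresholds qs)) N≥)))
               (schur-kk (strip q) φ N)))
      (sym (collect-value φ N qs (ℕₚ.≤-trans (ℕₚ.m≤n⊔m (threshold {k} μ) (thresholds qs)) N≥)))))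
    where μ = parts (strip q)

theorem1p2 : (k ℓ : ℕ) → 1 ≤ k → 1 ≤ ℓ → (λ′ : Vec ℕ ℓ) → InP k ℓ λ′ →
    (z : ℕ) → z ≤ bottom k λ′ →
    (∀ i → 1 ≤ i → i < z → ent λ′ (suc i) < ent λ′ i) →
    (z ≢ bottom k λ′ → 1 ≤ z → ent λ′ (suc z) < ent λ′ z) →
    Σ (List (List ℕ × ℤ)) (λ bs →
    All (λ t → KBddPartition k (proj₁ t)) bs
    × Unique (map proj₁ bs)
    × All (λ t → + 0 ≤ℤ signZ (size λ′ Data.Nat.+ sum (proj₁ t)) * proj₂ t) bs
    × ∃[ G ] (All (λ t → Converges (KkSchurTrunc k (proj₁ t)) (G (proj₁ t))) bs
    × Converges (weightedKkSchurTrunc k λ′ (suc z)) (linComb G bs)))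
theorem1p2 k ℓ _ _ λ′ inP@(λ≤k , _) z _ strict-below strict-at =
  bs , collect-all s (λ q → Stripped.kbounded (strip q)) qs , collect-unique s qs , collect-sign s qs
  , limit , collect-all s converges qs , weighted-converges
  where
  p = vectorPartition λ′ inP
  s = size λ′
  B = ℤ.∣ Truncation.ht ℓ (depth ℓ) (weight p) ℤ.+ + depth ℓ ∣
  open Alternation k ℓ (depth ℓ) using (Strict; StrictBefore; weighted; weighted-alternating)

  first-λ : ∀ i → first p (toℕ i) ≡ suc (k ℕ.∸ lookup λ′ i ℕ.+ toℕ i)
  first-λ i = cong (λ x → suc (k ℕ.∸ x ℕ.+ toℕ i)) (entryAt-lookup λ′ i)

  drop-at : ∀ i → ent λ′ (suc (suc i)) < ent λ′ (suc i) → part p (suc i) < part p i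
  drop-at i = subst₂ _<_ (ent-entryAt λ′ (suc (suc i))) (ent-entryAt λ′ (suc i))

  below-bottom : ∀ i → bottom k λ′ ≤ i → ℓ ≤ first p i
  below-bottom i b≤i with first p i ℕ.<? ℓ
  ... | no d≮ℓ  = ℕₚ.≮⇒≥ d≮ℓ
  ... | yes d<ℓ = contradiction
    (ℕₚ.≤-trans (subst (λ x → suc x ≤ bottom k λ′) (Finₚ.toℕ-fromℕ< i<ℓ)
      (bottom-≥ k λ′ λ≤k (first p) first-λ (Fin.fromℕ< i<ℓ)
        (subst (λ x → first p x < ℓ) (sym (Finₚ.toℕ-fromℕ< i<ℓ)) d<ℓ))) b≤i)
    (ℕₚ.<-irrefl refl)
    where i<ℓ = ℕₚ.<-trans (above p i) d<ℓ

  strictness : ∀ z → (∀ i → 1 ≤ i → i < z → ent λ′ (suc i) < ent λ′ i) →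
    (z ≢ bottom k λ′ → 1 ≤ z → ent λ′ (suc z) < ent λ′ z) → StrictBefore B p z
  strictness zero    _  _  = tt
  strictness (suc z) below at = record
    { strict = λ i i<z → drop-at i (below (suc i) (s≤s z≤n) (s≤s i<z))
    ; last   = last′
    }
    where
    last′ : part p (suc z) < part p z ⊎ ℓ ≤ first p (suc z)
    last′ with suc z ℕ.≟ bottom k λ′
    ... | yes z≡b = inj₂ (below-bottom (suc z) (ℕₚ.≤-reflexive (sym z≡b)))
    ... | no z≢b  = inj₁ (drop-at z (at z≢b (s≤s z≤n)))

  expansion = weighted-alternating B z p (strictness z strict-below strict-at) (i≤+∣i∣ {k} _)
  qs = proj₁ expansion
  bs = collect s qs
  limit : List ℕ → Sym
  limit μ = KkSchurTrunc k μ (threshold {k} μ)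

  converges : ∀ q → Converges (KkSchurTrunc k (Stripped.parts (strip {k} {ℓ} q))) (limit (Stripped.parts (strip q)))
  converges q m = threshold {k} μ , λ N N≥ → trans (coeff-ev (KkSchurTrunc k μ N) m)
    (trans (Stripped.stable (strip q) _ N N≥) (sym (coeff-ev (limit μ) m)))
    where μ = Stripped.parts (strip q)

  weighted-converges : Converges (weightedKkSchurTrunc k λ′ (suc z)) (linComb limit bs)
  -- `N` must pass the bound for λ, where the expansion becomes exact, and the bounds after which
  -- the finitely many K-k-Schur truncations are constant.
  weighted-converges m = B ℕ.⊔ thresholds s qs , λ N N≥ → begin
    coeff (weightedKkSchurTrunc k λ′ (suc z) N) m
      ≡⟨ coeff-ev (weightedKkSchurTrunc k λ′ (suc z) N) m ⟩
    ev φ (weightedKkSchurTrunc k λ′ (suc z) N)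
      ≡⟨ katTrunc-value φ N {Φ = roots ℓ (marks z (first p))} (weightMult-roots k λ′ λ≤k (first p) first-λ z)
           (Δk-roots k λ′ λ≤k (first p) first-λ) (λ i → cong +_ (sym (entryAt-lookup λ′ i))) ⟩
    weighted p z (environment φ ℓ N)
      ≡⟨ proj₂ expansion (environment φ ℓ N) (ℕₚ.≤-trans (ℕₚ.m≤m⊔n B (thresholds s qs)) N≥) ⟩
    Alternation.combination k ℓ (depth ℓ) (Alternation.degree k ℓ (depth ℓ) p) qs (environment φ ℓ N)
      ≡⟨ cong (λ s → Alternation.combination k ℓ (depth ℓ) s qs (environment φ ℓ N)) (sym (sum-entryAt λ′)) ⟩
    Alternation.combination k ℓ (depth ℓ) s qs (environment φ ℓ N)
      ≡⟨ collect-value s φ N qs (ℕₚ.≤-trans (ℕₚ.m≤n⊔m B (thresholds s qs)) N≥) ⟩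
    pairing (λ μ → ev φ (limit μ)) bs
      ≡⟨ sym (ev-linComb φ limit bs) ⟩
    ev φ (linComb limit bs)
      ≡⟨ sym (coeff-ev (linComb limit bs) m) ⟩
    coeff (linComb limit bs) m ∎
    where
    open ≡-Reasoning
    φ : Mono → ℤ
    φ m′ = if ⌊ Listₚ.≡-dec ℕ._≟_ m′ m ⌋ then 1ℤ else 0ℤ
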